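{- Let $Y$ be a strongly connected finite digraph on which a finite abelian group $G$ acts by automorphisms so that the action on $V_Y$ is free, let $H\le G$, $\Gamma=G/H$, $Z=Y_H$, $X=Y_G$, and let $F$ be an algebraically closed field of characteristic zero. Then $$N_\Gamma(\gamma_{Y/X}(u))=\gamma_{Y/Z}(u)\quad\text{in }F[H][u].$$
   Context: Digraph $Y=(V_Y,E_Y)$ with incidence $e\mapsto(o(e),t(e))$; strongly connected means a directed path exists between any two distinct vertices. For a group $K$ acting on $Y$ by automorphisms, $Y_K$ is the quotient digraph with vertices $K\backslash V_Y$, edges $K\backslash E_Y$ and induced incidence. $\mathcal{A}_Y(w)=\sum_{o(\varepsilon)=w}t(\varepsilon)$ on $\mathbb{Z}V_Y$ is $\mathbb{Z}[K]$-linear, and if $K$ acts freely on $V_Y$ then $\mathbb{Z}V_Y[u]$ is a free $\mathbb{Z}[K][u]$-module of rank $\#V_{Y_K}$. Define $\gamma_{Y/Y_K}(u)=\det_{\mathbb{Z}[K][u]}(\mathcal{I}-\mathcal{A}_Yu)\in\mathbb{Z}[K][u]$ (so $\gamma_{Y/X}$ uses $K=G$ and $\gamma_{Y/Z}$ uses $K=H$). Since $F[G][u]$ is a free $F[H][u]$-module of finite rank, $N_\Gamma:F[G][u]\to F[H][u]$ is defined by $N_\Gamma(P)=\det_{F[H][u]}(m_P)$, $m_P$ the multiplication-by-$P$ map on $F[G][u]$. -}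

module Defs where

open import Algebra.Apartness.Bundles using (HeytingField; HeytingCommutativeRing)
open import Algebra.Bundles using (AbelianGroup; CommutativeRing; CommutativeMonoid)
open import Algebra.Core using (Op₁; Op₂)
open import Algebra.Module.Bundles using (LeftModule)
open import Algebra.Module.Morphism.Structures using (module LeftModuleMorphisms)
import Algebra.Module.Construct.TensorUnit as TensorUnit
import Algebra.Properties.AbelianGroup as AbelianGroupProperties
import Algebra.Properties.CommutativeMonoid.Sum as MonoidSum
import Algebra.Properties.CommutativeSemigroup as CommutativeSemigroupProperties
import Algebra.Properties.Semiring.Exp as SemiringExp
import Algebra.Properties.Semiring.Mult as SemiringMult
import Algebra.Properties.Semiring.Sum as SemiringSum
open import Data.Bool.Base using (if_then_else_)
open import Data.Fin.Base using (Fin; zero; suc; toℕ; punchIn)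
open import Data.Fin.Permutation using (Permutation′; permutation)
import Data.Fin.Properties as Fin
open import Data.Integer.Base using (ℤ; +_; -[1+_])
import Data.Integer.Properties as ℤ
open import Data.Nat.Base as ℕ using (ℕ; zero; suc; z≤n; s≤s)
import Data.Nat.Properties as ℕ
open import Data.Product.Base using (Σ; ∃; _×_; _,_; proj₁; proj₂)
open import Function.Base using (_∘_; id)
open import Function.Bundles using (Func; Inverse)
open import Level using (Level; _⊔_) renaming (suc to lsuc)
open import Relation.Binary.Bundles using (Setoid)
open import Relation.Binary.Construct.Closure.ReflexiveTransitive using (Star)
open import Relation.Binary.Core using (Rel)
open import Relation.Binary.Definitions using (Decidable)
open import Relation.Binary.PropositionalEquality.Core as ≡ using (_≡_)
import Relation.Binary.PropositionalEquality.Properties as ≡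
import Relation.Binary.Reasoning.Setoid as SetoidReasoning
open import Relation.Binary.Structures using (IsEquivalence)
open import Relation.Nullary.Decidable.Core using (Dec; yes; no; does; map′)
open import Relation.Nullary.Negation.Core using (¬_; contradiction)
open import Relation.Unary using (Pred)
import Relation.Unary as Unary

-- A bijection with an initial segment; in particular equality is decidable.
record Finite {a ℓ : Level} (S : Setoid a ℓ) : Set (a ⊔ ℓ) where
  open Setoid S
  field
    size        : ℕ
    enumeration : Inverse (≡.setoid (Fin size)) S

  elem : Fin size → Carrier
  elem = Inverse.to enumeration

  index : Carrier → Fin size
  index = Inverse.from enumeration

  index-cong : ∀ {x y} → x ≈ y → index x ≡ index y
  index-cong = Inverse.from-cong enumeration

  elem-index : ∀ x → elem (index x) ≈ x
  elem-index = Inverse.strictlyInverseˡ enumeration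

  index-elem : ∀ i → index (elem i) ≡ i
  index-elem = Inverse.strictlyInverseʳ enumeration

  index-injective : ∀ {x y} → index x ≡ index y → x ≈ y
  index-injective {x} {y} eq =
    trans (sym (elem-index x)) (trans (reflexive (≡.cong elem eq)) (elem-index y))

  _≟_ : Decidable _≈_
  x ≟ y = map′ index-injective index-cong (index x Fin.≟ index y)

  any? : ∀ {p} {P : Pred Carrier p} → (∀ {x y} → x ≈ y → P x → P y) →
         Unary.Decidable P → Dec (∃ P)
  any? resp P? = map′ (λ (i , Pi) → elem i , Pi)
    (λ (x , Px) → index x , resp (sym (elem-index x)) Px) (Fin.any? (λ i → P? (elem i)))

-- A decidable equivalence relation on Fin n has finitely many classes; reps
-- chooses one element of each class.
record Classes {n : ℕ} {r : Level} (_∼_ : Rel (Fin n) r) : Set r where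
  field
    count      : ℕ
    class      : Fin n → Fin count
    rep        : Fin count → Fin n
    class-resp : ∀ {i j} → i ∼ j → class i ≡ class j
    rep-class  : ∀ i → rep (class i) ∼ i
    class-rep  : ∀ c → class (rep c) ≡ c

classes : ∀ {n r} (_∼_ : Rel (Fin n) r) → IsEquivalence _∼_ → Decidable _∼_ → Classes _∼_
classes {zero} _∼_ eq dec = record
  { count = 0 ; class = λ () ; rep = λ () ; class-resp = λ { {()} } ; rep-class = λ () ; class-rep = λ () }
classes {suc n} _∼_ eq dec = extend (Fin.any? (λ j → dec zero (suc j)))
  where
  open IsEquivalence eq
  rest : Classes (λ i j → suc i ∼ suc j)
  rest = classes (λ i j → suc i ∼ suc j)
    (record { refl = refl ; sym = sym ; trans = trans }) (λ i j → dec (suc i) (suc j))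
  open Classes rest

  extend : Dec (∃ λ j → zero ∼ suc j) → Classes _∼_
  extend (yes (j , 0∼j)) = record
    { count = count ; class = class⁺ ; rep = suc ∘ rep ; class-resp = resp⁺ _ _
    ; rep-class = rep-class⁺ ; class-rep = class-rep }
    where
    class⁺ : Fin (suc n) → Fin count
    class⁺ zero    = class j
    class⁺ (suc i) = class i

    resp⁺ : ∀ i k → i ∼ k → class⁺ i ≡ class⁺ k
    resp⁺ zero    zero    p = ≡.refl
    resp⁺ zero    (suc k) p = class-resp (trans (sym 0∼j) p)
    resp⁺ (suc i) zero    p = class-resp (trans p 0∼j)
    resp⁺ (suc i) (suc k) p = class-resp p

    rep-class⁺ : ∀ i → suc (rep (class⁺ i)) ∼ i
    rep-class⁺ zero    = trans (rep-class j) (sym 0∼j)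
    rep-class⁺ (suc i) = rep-class i
  extend (no new) = record
    { count = suc count ; class = class⁺ ; rep = rep⁺ ; class-resp = resp⁺ _ _
    ; rep-class = rep-class⁺ ; class-rep = class-rep⁺ }
    where
    class⁺ : Fin (suc n) → Fin (suc count)
    class⁺ zero    = zero
    class⁺ (suc i) = suc (class i)

    rep⁺ : Fin (suc count) → Fin (suc n)
    rep⁺ zero    = zero
    rep⁺ (suc c) = suc (rep c)

    resp⁺ : ∀ i k → i ∼ k → class⁺ i ≡ class⁺ k
    resp⁺ zero    zero    p = ≡.refl
    resp⁺ zero    (suc k) p = contradiction (k , p) new
    resp⁺ (suc i) zero    p = contradiction (i , sym p) new
    resp⁺ (suc i) (suc k) p = ≡.cong suc (class-resp p)

    rep-class⁺ : ∀ i → rep⁺ (class⁺ i) ∼ i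
    rep-class⁺ zero    = refl
    rep-class⁺ (suc i) = rep-class i

    class-rep⁺ : ∀ c → class⁺ (rep⁺ c) ≡ c
    class-rep⁺ zero    = ≡.refl
    class-rep⁺ (suc c) = ≡.cong suc (class-rep c)

record Members {n : ℕ} {p : Level} (P : Pred (Fin n) p) : Set p where
  field
    count         : ℕ
    member        : Fin count → Fin n
    member-∈      : ∀ c → P (member c)
    position      : ∀ i → P i → Fin count
    member-pos    : ∀ i Pi → member (position i Pi) ≡ i
    pos-member    : ∀ c Pc → position (member c) Pc ≡ c

members : ∀ {n p} (P : Pred (Fin n) p) → Unary.Decidable P → Members P
members {zero} P P? = record
  { count = 0 ; member = λ () ; member-∈ = λ () ; position = λ () ; member-pos = λ () ; pos-member = λ () }
members {suc n} P P? = extend (P? zero)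
  where
  open Members (members (P ∘ suc) (P? ∘ suc))

  extend : Dec (P zero) → Members P
  extend (yes P0) = record
    { count = suc count ; member = member⁺ ; member-∈ = member-∈⁺ ; position = position⁺
    ; member-pos = member-pos⁺ ; pos-member = pos-member⁺ }
    where
    member⁺ : Fin (suc count) → Fin (suc n)
    member⁺ zero    = zero
    member⁺ (suc c) = suc (member c)

    member-∈⁺ : ∀ c → P (member⁺ c)
    member-∈⁺ zero    = P0
    member-∈⁺ (suc c) = member-∈ c

    position⁺ : ∀ i → P i → Fin (suc count)
    position⁺ zero    _  = zero
    position⁺ (suc i) Pi = suc (position i Pi)

    member-pos⁺ : ∀ i Pi → member⁺ (position⁺ i Pi) ≡ i
    member-pos⁺ zero    _  = ≡.refl
    member-pos⁺ (suc i) Pi = ≡.cong suc (member-pos i Pi)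

    pos-member⁺ : ∀ c Pc → position⁺ (member⁺ c) Pc ≡ c
    pos-member⁺ zero    _  = ≡.refl
    pos-member⁺ (suc c) Pc = ≡.cong suc (pos-member c Pc)
  extend (no ¬P0) = record
    { count = count ; member = suc ∘ member ; member-∈ = member-∈ ; position = position⁺
    ; member-pos = member-pos⁺ ; pos-member = pos-member }
    where
    position⁺ : ∀ i → P i → Fin count
    position⁺ zero    P0 = contradiction P0 ¬P0
    position⁺ (suc i) Pi = position i Pi

    member-pos⁺ : ∀ i Pi → suc (member (position⁺ i Pi)) ≡ i
    member-pos⁺ zero    P0 = contradiction P0 ¬P0
    member-pos⁺ (suc i) Pi = ≡.cong suc (member-pos i Pi)

module FreeModule {r ℓr : Level} (R : CommutativeRing r ℓr) where
  private module R = CommutativeRing R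
  open CommutativeRing R using (_≈_; _+_; _*_; 0#; 1#)
  open SemiringSum R.semiring using (sum)

  module _ {s ℓs : Level} {S : Setoid s ℓs} (fin : Finite S) where
    open Finite fin

    ∑ : (Setoid.Carrier S → R.Carrier) → R.Carrier
    ∑ f = sum (f ∘ elem)

    δ : Setoid.Carrier S → Setoid.Carrier S → R.Carrier
    δ s t = if does (s ≟ t) then 1# else 0#

  -- For finite S the free module RS is the module of functions S → R, an
  -- element s of S being identified with the function δ s.
  Free : ∀ {s ℓs} → Setoid s ℓs → Set (s ⊔ ℓs ⊔ r ⊔ ℓr)
  Free S = Func S R.setoid

  private
    module Sum = SemiringSum R.semiring

  indicator-cong : ∀ {p q} {P : Set p} {Q : Set q} (P? : Dec P) (Q? : Dec Q) →
                   (P → Q) → (Q → P) → ∀ {x y} → x ≈ y →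
                   (if does P? then x else 0#) ≈ (if does Q? then y else 0#)
  indicator-cong (yes p) (yes q) f g x≈y = x≈y
  indicator-cong (yes p) (no ¬q) f g x≈y = contradiction (f p) ¬q
  indicator-cong (no ¬p) (yes q) f g x≈y = contradiction (g q) ¬p
  indicator-cong (no ¬p) (no ¬q) f g x≈y = R.refl

  indicator-yes : ∀ {p} {P : Set p} (P? : Dec P) {x : R.Carrier} → P →
                  (if does P? then x else 0#) ≈ x
  indicator-yes (yes _) p = R.refl
  indicator-yes (no ¬p) p = contradiction p ¬p

  indicator-no : ∀ {p} {P : Set p} (P? : Dec P) {x : R.Carrier} → ¬ P →
                 (if does P? then x else 0#) ≈ 0#
  indicator-no (yes p) ¬p = contradiction p ¬p
  indicator-no (no _)  ¬p = R.refl

  sum-zero : ∀ {n} (f : Fin n → R.Carrier) → (∀ i → f i ≈ 0#) → sum f ≈ 0#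
  sum-zero {n} f f≈0 = R.trans (Sum.sum-cong-≋ f≈0) (Sum.sum-replicate-zero n)

  sum-single : ∀ {n} (f : Fin n → R.Carrier) (j : Fin n) →
               (∀ i → ¬ i ≡ j → f i ≈ 0#) → sum f ≈ f j
  sum-single f zero    f≈0 =
    R.trans (R.+-congˡ (sum-zero (f ∘ suc) (λ i → f≈0 (suc i) λ ()))) (R.+-identityʳ _)
  sum-single f (suc j) f≈0 =
    R.trans (R.+-cong (f≈0 zero λ ())
                      (sum-single (f ∘ suc) j (λ i i≢j → f≈0 (suc i) (i≢j ∘ Fin.suc-injective))))
            (R.+-identityˡ _)

  module FiniteSum {s ℓs : Level} {S : Setoid s ℓs} (fin : Finite S) where
    private module S = Setoid S
    open Finite fin

    ∑-cong : ∀ {f g : S.Carrier → R.Carrier} → (∀ x → f x ≈ g x) → ∑ fin f ≈ ∑ fin g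
    ∑-cong f≈g = Sum.sum-cong-≋ (λ i → f≈g (elem i))

    ∑-zero : ∀ {f : S.Carrier → R.Carrier} → (∀ x → f x ≈ 0#) → ∑ fin f ≈ 0#
    ∑-zero {f} f≈0 = sum-zero (f ∘ elem) (λ i → f≈0 (elem i))

    ∑-+ : ∀ (f g : S.Carrier → R.Carrier) → ∑ fin (λ x → f x + g x) ≈ ∑ fin f + ∑ fin g
    ∑-+ f g = Sum.∑-distrib-+ (f ∘ elem) (g ∘ elem)

    *-∑ : ∀ c (f : S.Carrier → R.Carrier) → c * ∑ fin f ≈ ∑ fin (λ x → c * f x)
    *-∑ c f = Sum.*-distribˡ-sum c (f ∘ elem)

    ∑-* : ∀ c (f : S.Carrier → R.Carrier) → ∑ fin f * c ≈ ∑ fin (λ x → f x * c)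
    ∑-* c f = Sum.*-distribʳ-sum c (f ∘ elem)

    ∑-single : ∀ (f : S.Carrier → R.Carrier) → (∀ {x y} → x S.≈ y → f x ≈ f y) →
               ∀ x → (∀ y → ¬ y S.≈ x → f y ≈ 0#) → ∑ fin f ≈ f x
    ∑-single f f-cong x f≈0 =
      R.trans (sum-single (f ∘ elem) (index x) (λ i i≢x →
                 f≈0 (elem i) λ eq → i≢x (≡.trans (≡.sym (index-elem i)) (index-cong eq))))
              (f-cong (elem-index x))

    ∑-reindex : ∀ (f : S.Carrier → R.Carrier) → (∀ {x y} → x S.≈ y → f x ≈ f y) →
                (π π⁻¹ : S.Carrier → S.Carrier) →
                (∀ {x y} → x S.≈ y → π x S.≈ π y) → (∀ {x y} → x S.≈ y → π⁻¹ x S.≈ π⁻¹ y) →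
                (∀ x → π (π⁻¹ x) S.≈ x) → (∀ x → π⁻¹ (π x) S.≈ x) →
                ∑ fin f ≈ ∑ fin (f ∘ π)
    ∑-reindex f f-cong π π⁻¹ π-cong π⁻¹-cong invˡ invʳ =
      R.trans (Sum.sum-permute (f ∘ elem) perm)
              (Sum.sum-cong-≋ (λ i → f-cong (elem-index (π (elem i)))))
      where
      perm : Permutation′ size
      perm = permutation (λ i → index (π (elem i))) (λ i → index (π⁻¹ (elem i)))
        (λ i → ≡.trans (index-cong (S.trans (π-cong (elem-index _)) (invˡ _))) (index-elem i))
        (λ i → ≡.trans (index-cong (S.trans (π⁻¹-cong (elem-index _)) (invʳ _))) (index-elem i))

    δ-cong : ∀ {s s′ t t′} → s S.≈ s′ → t S.≈ t′ → δ fin s t ≈ δ fin s′ t′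
    δ-cong s≈s′ t≈t′ = indicator-cong (_ ≟ _) (_ ≟ _)
      (λ p → S.trans (S.sym s≈s′) (S.trans p t≈t′))
      (λ p → S.trans s≈s′ (S.trans p (S.sym t≈t′))) R.refl

    δ-yes : ∀ {s t} → s S.≈ t → δ fin s t ≈ 1#
    δ-yes {s} {t} = indicator-yes (s ≟ t)

    δ-no : ∀ {s t} → ¬ s S.≈ t → δ fin s t ≈ 0#
    δ-no {s} {t} = indicator-no (s ≟ t)

    basisElement : S.Carrier → Free S
    basisElement s = record { to = δ fin s ; cong = δ-cong S.refl }

  ∑-swap : ∀ {s ℓs t ℓt} {S : Setoid s ℓs} {T : Setoid t ℓt} (finS : Finite S) (finT : Finite T)
           (f : Setoid.Carrier S → Setoid.Carrier T → R.Carrier) →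
           ∑ finS (λ x → ∑ finT (f x)) ≈ ∑ finT (λ y → ∑ finS (λ x → f x y))
  ∑-swap finS finT f = Sum.∑-comm (λ i j → f (Finite.elem finS i) (Finite.elem finT j))

  module _ {s ℓs : Level} (S : Setoid s ℓs) where
    open Func using (to; cong)

    infix 4 _≈ᶠ_
    _≈ᶠ_ : Rel (Free S) (s ⊔ ℓr)
    f ≈ᶠ g = ∀ x → to f x ≈ to g x

    infixl 6 _+ᶠ_
    _+ᶠ_ : Op₂ (Free S)
    f +ᶠ g = record
      { to = λ x → to f x + to g x ; cong = λ p → R.+-cong (cong f p) (cong g p) }

    0ᶠ : Free S
    0ᶠ = record { to = λ _ → 0# ; cong = λ _ → R.refl }

    -ᶠ_ : Op₁ (Free S)
    -ᶠ f = record { to = λ x → R.- to f x ; cong = λ p → R.-‿cong (cong f p) }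

    free-abelianGroup : AbelianGroup (s ⊔ ℓs ⊔ r ⊔ ℓr) (s ⊔ ℓr)
    free-abelianGroup = record
      { Carrier = Free S ; _≈_ = _≈ᶠ_ ; _∙_ = _+ᶠ_ ; ε = 0ᶠ ; _⁻¹ = -ᶠ_
      ; isAbelianGroup = record
        { isGroup = record
          { isMonoid = record
            { isSemigroup = record
              { isMagma = record
                { isEquivalence = record
                  { refl  = λ _ → R.refl
                  ; sym   = λ p x → R.sym (p x)
                  ; trans = λ p q x → R.trans (p x) (q x) }
                ; ∙-cong = λ p q x → R.+-cong (p x) (q x) }
              ; assoc = λ f g h x → R.+-assoc (to f x) (to g x) (to h x) }
            ; identity = (λ f x → R.+-identityˡ (to f x)) , (λ f x → R.+-identityʳ (to f x)) }
          ; inverse = (λ f x → R.-‿inverseˡ (to f x)) , (λ f x → R.-‿inverseʳ (to f x))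
          ; ⁻¹-cong = λ p x → R.-‿cong (p x) }
        ; comm = λ f g x → R.+-comm (to f x) (to g x) } }

open FreeModule public using (Free)

record FiniteAbelianGroup (g ℓ : Level) : Set (lsuc (g ⊔ ℓ)) where
  field
    abelianGroup : AbelianGroup g ℓ
  open AbelianGroup abelianGroup public
  field
    finite : Finite setoid

record Subgroup {g ℓ : Level} (G : FiniteAbelianGroup g ℓ) (p : Level) : Set (g ⊔ ℓ ⊔ lsuc p) where
  open FiniteAbelianGroup G
  field
    _∈H      : Pred Carrier p
    _∈H?     : Unary.Decidable _∈H
    ∈H-resp  : ∀ {x y} → x ≈ y → x ∈H → y ∈H
    ∙-closed : ∀ {x y} → x ∈H → y ∈H → (x ∙ y) ∈H
    ε-closed : ε ∈H
    ⁻¹-closed : ∀ {x} → x ∈H → (x ⁻¹) ∈H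

  subgroup : FiniteAbelianGroup (g ⊔ p) ℓ
  subgroup = record
    { abelianGroup = record
      { Carrier = Σ Carrier _∈H
      ; _≈_ = λ x y → proj₁ x ≈ proj₁ y
      ; _∙_ = λ (x , x∈) (y , y∈) → x ∙ y , ∙-closed x∈ y∈
      ; ε = ε , ε-closed
      ; _⁻¹ = λ (x , x∈) → x ⁻¹ , ⁻¹-closed x∈
      ; isAbelianGroup = record
        { isGroup = record
          { isMonoid = record
            { isSemigroup = record
              { isMagma = record
                { isEquivalence = record { refl = refl ; sym = sym ; trans = trans }
                ; ∙-cong = ∙-cong }
              ; assoc = λ x y z → assoc (proj₁ x) (proj₁ y) (proj₁ z) }
            ; identity = (λ x → identityˡ (proj₁ x)) , (λ x → identityʳ (proj₁ x)) }
          ; inverse = (λ x → inverseˡ (proj₁ x)) , (λ x → inverseʳ (proj₁ x))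
          ; ⁻¹-cong = ⁻¹-cong }
        ; comm = λ x y → comm (proj₁ x) (proj₁ y) } }
    ; finite = record
      { size = count
      ; enumeration = record
        { to = λ c → elem (member c) , member-∈ c
        ; from = λ (x , x∈) → position (index x) (∈H-resp (sym (elem-index x)) x∈)
        ; to-cong = λ { ≡.refl → refl }
        ; from-cong = λ x≈y → position-cong (index-cong x≈y)
        ; inverse =
            (λ { {x , _} ≡.refl → trans (reflexive (≡.cong elem (member-pos _ _))) (elem-index x) })
          , (λ {c} y≈ → ≡.trans (position-cong (≡.trans (index-cong y≈) (index-elem (member c))))
                                (pos-member c (member-∈ c))) } } }
    where
    open Finite finite
    open Members (members (_∈H ∘ elem) (_∈H? ∘ elem))

    member-injective : ∀ {c d} → member c ≡ member d → c ≡ d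
    member-injective {c} {d} eq =
      ≡.trans (≡.sym (pos-member c (member-∈ c))) (lemma eq (member-∈ c))
      where
      lemma : ∀ {i} → i ≡ member d → ∀ Pi → position i Pi ≡ d
      lemma ≡.refl Pi = pos-member d Pi

    position-cong : ∀ {i j} → i ≡ j → ∀ {Pi Pj} → position i Pi ≡ position j Pj
    position-cong {i} ≡.refl =
      member-injective (≡.trans (member-pos i _) (≡.sym (member-pos i _)))

record Action {g ℓ s ℓs : Level} (K : FiniteAbelianGroup g ℓ) (S : Setoid s ℓs)
              : Set (g ⊔ ℓ ⊔ s ⊔ ℓs) where
  private
    module K = FiniteAbelianGroup K
    module S = Setoid S
  infixr 7 _·_
  field
    _·_        : K.Carrier → S.Carrier → S.Carrier
    ·-cong     : ∀ {k l x y} → k K.≈ l → x S.≈ y → k · x S.≈ l · y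
    ·-identity : ∀ x → K.ε · x S.≈ x
    ·-assoc    : ∀ k l x → (k K.∙ l) · x S.≈ k · l · x

  ·-inverseˡ : ∀ k x → (k K.⁻¹) · k · x S.≈ x
  ·-inverseˡ k x = S.trans (S.sym (·-assoc _ _ x))
    (S.trans (·-cong (K.inverseˡ k) S.refl) (·-identity x))

  ·-inverseʳ : ∀ k x → k · (k K.⁻¹) · x S.≈ x
  ·-inverseʳ k x = S.trans (S.sym (·-assoc _ _ x))
    (S.trans (·-cong (K.inverseʳ k) S.refl) (·-identity x))

  IsFree : Set (g ⊔ ℓ ⊔ s ⊔ ℓs)
  IsFree = ∀ k x → k · x S.≈ x → k K.≈ K.ε

  _∼_ : Rel S.Carrier (g ⊔ ℓs)
  x ∼ y = ∃ λ k → k · x S.≈ y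

  ∼-isEquivalence : IsEquivalence _∼_
  ∼-isEquivalence = record
    { refl  = λ {x} → K.ε , ·-identity x
    ; sym   = λ {x} (k , kx≈y) →
        k K.⁻¹ , S.trans (·-cong K.refl (S.sym kx≈y)) (·-inverseˡ k x)
    ; trans = λ {x} (k , kx≈y) (l , ly≈z) →
        l K.∙ k , S.trans (·-assoc l k x) (S.trans (·-cong K.refl kx≈y) ly≈z) }

  orbits : Setoid s (g ⊔ ℓs)
  orbits = record { isEquivalence = ∼-isEquivalence }

  orbits-finite : Finite S → Finite orbits
  orbits-finite fin = record
    { size = count
    ; enumeration = record
      { to = λ c → elem (rep c)
      ; from = λ x → class (index x)
      ; to-cong = λ { ≡.refl → O.refl }
      ; from-cong = λ x∼y → class-resp (index-∼ x∼y)
      ; inverse =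
          (λ { {x} ≡.refl → O.trans (rep-class (index x)) (≈⇒∼ (elem-index x)) })
        , (λ {c} y∼ → ≡.trans (class-resp (index-∼ y∼))
                       (≡.trans (≡.cong class (index-elem (rep c))) (class-rep c))) } }
    where
    module O = IsEquivalence ∼-isEquivalence
    open Finite fin

    ≈⇒∼ : ∀ {x y} → x S.≈ y → x ∼ y
    ≈⇒∼ x≈y = K.ε , S.trans (·-identity _) x≈y

    index-∼ : ∀ {x y} → x ∼ y → elem (index x) ∼ elem (index y)
    index-∼ x∼y = O.trans (≈⇒∼ (elem-index _)) (O.trans x∼y (≈⇒∼ (S.sym (elem-index _))))

    orbitClasses : Classes (λ i j → elem i ∼ elem j)
    orbitClasses = classes (λ i j → elem i ∼ elem j)
      (record { refl = O.refl ; sym = O.sym ; trans = O.trans })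
      (λ i j → Finite.any? K.finite
        (λ k≈l → S.trans (·-cong (K.sym k≈l) S.refl)) (λ k → (k · elem i) ≟ elem j))
    open Classes orbitClasses

-- H acts on the underlying set of G by left multiplication; the orbits are
-- the cosets of H.
translation : ∀ {g ℓ p} (G : FiniteAbelianGroup g ℓ) (H : Subgroup G p) →
              Action (Subgroup.subgroup H) (FiniteAbelianGroup.setoid G)
translation G H = record
  { _·_ = λ h x → proj₁ h ∙ x ; ·-cong = ∙-cong
  ; ·-identity = identityˡ ; ·-assoc = λ h k → assoc (proj₁ h) (proj₁ k) }
  where open FiniteAbelianGroup G

regular : ∀ {g ℓ} (K : FiniteAbelianGroup g ℓ) → Action K (FiniteAbelianGroup.setoid K)
regular K = record
  { _·_ = _∙_ ; ·-cong = ∙-cong ; ·-identity = identityˡ ; ·-assoc = assoc }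
  where open FiniteAbelianGroup K

translation-free : ∀ {g ℓ p} (G : FiniteAbelianGroup g ℓ) (H : Subgroup G p) →
                   Action.IsFree (translation G H)
translation-free G H h x hx≈x = identityˡ-unique (proj₁ h) x hx≈x
  where open AbelianGroupProperties (FiniteAbelianGroup.abelianGroup G) using (identityˡ-unique)

restrict : ∀ {g ℓ p s ℓs} {G : FiniteAbelianGroup g ℓ} {S : Setoid s ℓs} (H : Subgroup G p) →
           Action G S → Action (Subgroup.subgroup H) S
restrict H α = record
  { _·_ = λ h x → proj₁ h · x ; ·-cong = ·-cong ; ·-identity = ·-identity
  ; ·-assoc = λ h k → ·-assoc (proj₁ h) (proj₁ k) }
  where open Action α

module GroupRing {r ℓr g ℓg : Level} (R : CommutativeRing r ℓr) (K : FiniteAbelianGroup g ℓg) where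
  private
    module R = CommutativeRing R
    module K = FiniteAbelianGroup K
  open CommutativeRing R using (_≈_; _+_; _*_; 0#; 1#)
  open FiniteAbelianGroup K using (_∙_; ε; _⁻¹)
  open FreeModule R hiding (Free)
  open FiniteSum K.finite
  open Func using (to; cong)
  open AbelianGroupProperties K.abelianGroup
    using (⁻¹-anti-homo-∙; ⁻¹-∙-comm; ε⁻¹≈ε; ⁻¹-involutive)
  open SetoidReasoning R.setoid

  module Convolution {s ℓs : Level} {S : Setoid s ℓs} (α : Action K S) where
    private module S = Setoid S
    open Action α

    -- The bilinear operation with δ k ⋆ δ x = δ (k · x).
    infixr 7 _⋆_
    _⋆_ : Free R K.setoid → Free R S → Free R S
    f ⋆ m = record
      { to   = λ x → ∑ K.finite λ k → to f k * to m ((k ⁻¹) · x)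
      ; cong = λ {x} {y} x≈y → ∑-cong {λ k → to f k * to m ((k ⁻¹) · x)} {λ k → to f k * to m ((k ⁻¹) · y)}
        (λ k → R.*-congˡ {to f k} (cong m (·-cong (K.refl {k ⁻¹}) x≈y))) }

    private
      infix 4 _≋_
      _≋_ = _≈ᶠ_ S
      infixl 6 _⊕_
      _⊕_ = _+ᶠ_ S

    ⋆-cong : ∀ {f g m n} → _≈ᶠ_ K.setoid f g → m ≋ n → f ⋆ m ≋ g ⋆ n
    ⋆-cong {f} {g} {m} {n} f≈g m≈n x =
      ∑-cong {λ k → to f k * to m ((k ⁻¹) · x)} {λ k → to g k * to n ((k ⁻¹) · x)} λ k → R.*-cong (f≈g k) (m≈n _)

    ⋆-zeroˡ : ∀ m → 0ᶠ K.setoid ⋆ m ≋ 0ᶠ S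
    ⋆-zeroˡ m x = ∑-zero {λ k → 0# * to m ((k ⁻¹) · x)} λ k → R.zeroˡ _

    ⋆-zeroʳ : ∀ f → f ⋆ 0ᶠ S ≋ 0ᶠ S
    ⋆-zeroʳ f x = ∑-zero {λ k → to f k * 0#} λ k → R.zeroʳ _

    ⋆-distribʳ : ∀ m f g → (_+ᶠ_ K.setoid f g) ⋆ m ≋ f ⋆ m ⊕ g ⋆ m
    ⋆-distribʳ m f g x = R.trans
      (∑-cong {λ k → (to f k + to g k) * to m ((k ⁻¹) · x)}
              {λ k → to f k * to m ((k ⁻¹) · x) + to g k * to m ((k ⁻¹) · x)}
              (λ k → R.distribʳ _ _ _))
      (∑-+ (λ k → to f k * to m ((k ⁻¹) · x)) (λ k → to g k * to m ((k ⁻¹) · x)))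

    ⋆-distribˡ : ∀ f m n → f ⋆ (m ⊕ n) ≋ f ⋆ m ⊕ f ⋆ n
    ⋆-distribˡ f m n x = R.trans
      (∑-cong {λ k → to f k * (to m ((k ⁻¹) · x) + to n ((k ⁻¹) · x))}
              {λ k → to f k * to m ((k ⁻¹) · x) + to f k * to n ((k ⁻¹) · x)}
              (λ k → R.distribˡ _ _ _))
      (∑-+ (λ k → to f k * to m ((k ⁻¹) · x)) (λ k → to f k * to n ((k ⁻¹) · x)))

    ⋆-identityˡ : ∀ m → basisElement ε ⋆ m ≋ m
    ⋆-identityˡ m x = begin
      ∑ K.finite (λ k → δ K.finite ε k * to m ((k ⁻¹) · x))
        ≈⟨ ∑-single (λ k → δ K.finite ε k * to m ((k ⁻¹) · x))
             (λ k≈l → R.*-cong (δ-cong K.refl k≈l) (cong m (·-cong (K.⁻¹-cong k≈l) S.refl)))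
             ε (λ k k≉ε → R.trans (R.*-congʳ (δ-no (k≉ε ∘ K.sym))) (R.zeroˡ _)) ⟩
      δ K.finite ε ε * to m ((ε ⁻¹) · x)
        ≈⟨ R.*-cong (δ-yes K.refl) (cong m (S.trans (·-cong ε⁻¹≈ε S.refl) (·-identity x))) ⟩
      1# * to m x
        ≈⟨ R.*-identityˡ _ ⟩
      to m x ∎

  open Convolution (regular K) public using () renaming (_⋆_ to _⊛_)

  module _ {s ℓs : Level} {S : Setoid s ℓs} (α : Action K S) where
    private module S = Setoid S
    open Action α
    open Convolution α

    ⋆-assoc : ∀ f g m → _≈ᶠ_ S ((f ⊛ g) ⋆ m) (f ⋆ g ⋆ m)
    ⋆-assoc f g m x = begin
      ∑ K.finite (λ k → ∑ K.finite (λ j → to f j * to g ((j ⁻¹) ∙ k)) * to m ((k ⁻¹) · x))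
        ≈⟨ ∑-cong {λ k → ∑ K.finite (λ j → to f j * to g ((j ⁻¹) ∙ k)) * to m ((k ⁻¹) · x)}
                  {λ k → ∑ K.finite (T k)}
             (λ k → R.trans (∑-* (to m ((k ⁻¹) · x)) (λ j → to f j * to g ((j ⁻¹) ∙ k)))
               (∑-cong {λ j → (to f j * to g ((j ⁻¹) ∙ k)) * to m ((k ⁻¹) · x)} {T k}
                 (λ j → R.*-assoc _ _ _))) ⟩
      ∑ K.finite (λ k → ∑ K.finite (λ j → to f j * (to g ((j ⁻¹) ∙ k) * to m ((k ⁻¹) · x))))
        ≈⟨ ∑-swap K.finite K.finite T ⟩
      ∑ K.finite (λ j → ∑ K.finite (λ k → to f j * (to g ((j ⁻¹) ∙ k) * to m ((k ⁻¹) · x))))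
        ≈⟨ ∑-cong {λ j → ∑ K.finite (λ k → T k j)}
                  {λ j → to f j * ∑ K.finite (λ l → to g l * to m ((l ⁻¹) · (j ⁻¹) · x))}
             (λ j → R.trans (R.sym (*-∑ (to f j) (λ k → to g ((j ⁻¹) ∙ k) * to m ((k ⁻¹) · x))))
                            (R.*-congˡ (shift j))) ⟩
      ∑ K.finite (λ j → to f j * ∑ K.finite (λ l → to g l * to m ((l ⁻¹) · (j ⁻¹) · x))) ∎
      where
      module Reg = Action (regular K)

      T : K.Carrier → K.Carrier → R.Carrier
      T k j = to f j * (to g ((j ⁻¹) ∙ k) * to m ((k ⁻¹) · x))

      shift : ∀ j → ∑ K.finite (λ k → to g ((j ⁻¹) ∙ k) * to m ((k ⁻¹) · x)) ≈
                    ∑ K.finite (λ l → to g l * to m ((l ⁻¹) · (j ⁻¹) · x))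
      shift j = begin
        ∑ K.finite (λ k → to g ((j ⁻¹) ∙ k) * to m ((k ⁻¹) · x))
          ≈⟨ ∑-reindex (λ k → to g ((j ⁻¹) ∙ k) * to m ((k ⁻¹) · x))
               (λ k≈l → R.*-cong (cong g (K.∙-congˡ k≈l)) (cong m (·-cong (K.⁻¹-cong k≈l) S.refl)))
               (j ∙_) ((j ⁻¹) ∙_) K.∙-congˡ K.∙-congˡ (Reg.·-inverseʳ j) (Reg.·-inverseˡ j) ⟩
        ∑ K.finite (λ l → to g ((j ⁻¹) ∙ (j ∙ l)) * to m (((j ∙ l) ⁻¹) · x))
          ≈⟨ ∑-cong {λ l → to g ((j ⁻¹) ∙ (j ∙ l)) * to m (((j ∙ l) ⁻¹) · x)}
                    {λ l → to g l * to m ((l ⁻¹) · (j ⁻¹) · x)}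
               (λ l → R.*-cong (cong g (Reg.·-inverseˡ j l))
               (cong m (S.trans (·-cong (⁻¹-anti-homo-∙ j l) S.refl) (·-assoc _ _ x)))) ⟩
        ∑ K.finite (λ l → to g l * to m ((l ⁻¹) · (j ⁻¹) · x)) ∎

  ⊛-comm : ∀ f g → _≈ᶠ_ K.setoid (f ⊛ g) (g ⊛ f)
  ⊛-comm f g x = begin
    ∑ K.finite (λ k → to f k * to g ((k ⁻¹) ∙ x))
      ≈⟨ ∑-reindex (λ k → to f k * to g ((k ⁻¹) ∙ x))
           (λ k≈l → R.*-cong (cong f k≈l) (cong g (K.∙-congʳ (K.⁻¹-cong k≈l))))
           flip flip flip-cong flip-cong flip-flip flip-flip ⟩
    ∑ K.finite (λ k → to f (flip k) * to g ((flip k ⁻¹) ∙ x))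
      ≈⟨ ∑-cong {λ k → to f (flip k) * to g ((flip k ⁻¹) ∙ x)} {λ k → to g k * to f ((k ⁻¹) ∙ x)}
           (λ k → R.trans (R.*-congˡ (cong g (flip-flip k))) (R.*-comm _ _)) ⟩
    ∑ K.finite (λ k → to g k * to f ((k ⁻¹) ∙ x)) ∎
    where
    flip : K.Carrier → K.Carrier
    flip k = (k ⁻¹) ∙ x

    flip-cong : ∀ {k l} → k K.≈ l → flip k K.≈ flip l
    flip-cong k≈l = K.∙-congʳ (K.⁻¹-cong k≈l)

    flip-flip : ∀ k → flip (flip k) K.≈ k
    flip-flip k =
      K.trans (K.∙-congʳ (K.trans (K.sym (⁻¹-∙-comm _ _)) (K.∙-congʳ (⁻¹-involutive k))))
      (K.trans (K.assoc _ _ _) (K.trans (K.∙-congˡ (K.inverseˡ x)) (K.identityʳ k)))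

  groupRing : CommutativeRing (g ⊔ ℓg ⊔ r ⊔ ℓr) (g ⊔ ℓr)
  groupRing = record
    { Carrier = Free R K.setoid ; _≈_ = _≈ᶠ_ K.setoid ; _+_ = _+ᶠ_ K.setoid ; _*_ = _⊛_
    ; -_ = -ᶠ_ K.setoid ; 0# = 0ᶠ K.setoid ; 1# = basisElement ε
    ; isCommutativeRing = record
      { isRing = record
        { +-isAbelianGroup = AbelianGroup.isAbelianGroup (free-abelianGroup K.setoid)
        ; *-cong = λ {f} {g} {m} {n} → ⋆-cong {f} {g} {m} {n}
        ; *-assoc = ⋆-assoc (regular K)
        ; *-identity = ⋆-identityˡ
            , (λ f x → R.trans (⊛-comm f (basisElement ε) x) (⋆-identityˡ f x))
        ; distrib = ⋆-distribˡ , ⋆-distribʳ }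
      ; *-comm = ⊛-comm } }
    where open Convolution (regular K)

  permutationModule : ∀ {s ℓs} {S : Setoid s ℓs} → Action K S →
    LeftModule (CommutativeRing.ring groupRing) (s ⊔ ℓs ⊔ r ⊔ ℓr) (s ⊔ ℓr)
  permutationModule {S = S} α = record
    { Carrierᴹ = Free R S ; _≈ᴹ_ = _≈ᶠ_ S ; _+ᴹ_ = _+ᶠ_ S ; _*ₗ_ = _⋆_ ; 0ᴹ = 0ᶠ S ; -ᴹ_ = -ᶠ_ S
    ; isLeftModule = record
      { isLeftSemimodule = record
        { +ᴹ-isCommutativeMonoid = AbelianGroup.isCommutativeMonoid (free-abelianGroup S)
        ; isPreleftSemimodule = record
          { *ₗ-cong = λ {f} {g} {m} {n} → ⋆-cong {f} {g} {m} {n} ; *ₗ-zeroˡ = ⋆-zeroˡ ; *ₗ-distribʳ = ⋆-distribʳ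
          ; *ₗ-identityˡ = ⋆-identityˡ ; *ₗ-assoc = ⋆-assoc α
          ; *ₗ-zeroʳ = ⋆-zeroʳ ; *ₗ-distribˡ = ⋆-distribˡ } }
      ; -ᴹ‿cong = λ {f} {g} → AbelianGroup.⁻¹-cong (free-abelianGroup S) {f} {g}
      ; -ᴹ‿inverse = AbelianGroup.inverse (free-abelianGroup S) } }
    where open Convolution α

open GroupRing public using (groupRing; permutationModule)

module Determinant {r ℓr : Level} (R : CommutativeRing r ℓr) where
  open CommutativeRing R hiding (zero)
  open SemiringSum semiring using (sum)
  open SemiringExp semiring using (_^_)

  -- Laplace expansion along the first row.
  det : ∀ {n} → (Fin n → Fin n → Carrier) → Carrier
  det {zero}  A = 1#
  det {suc n} A =
    sum λ j → (- 1#) ^ toℕ j * (A zero j * det (λ i k → A (suc i) (punchIn j k)))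

module _ {r ℓr m ℓm : Level} (R : CommutativeRing r ℓr)
         (M : LeftModule (CommutativeRing.ring R) m ℓm) where
  open CommutativeRing R using (Carrier; _≈_)
  open LeftModule M
  open MonoidSum +ᴹ-commutativeMonoid using () renaming (sum to sumᴹ)
  open LeftModuleMorphisms rawLeftModule rawLeftModule using (IsLeftModuleHomomorphism)

  record Basis (n : ℕ) : Set (r ⊔ ℓr ⊔ m ⊔ ℓm) where
    field
      vector    : Fin n → Carrierᴹ
      coord     : Carrierᴹ → Fin n → Carrier
      expansion : ∀ x → sumᴹ (λ i → coord x i *ₗ vector i) ≈ᴹ x
      unique    : ∀ x (c : Fin n → Carrier) →
                  sumᴹ (λ i → c i *ₗ vector i) ≈ᴹ x → ∀ i → c i ≈ coord x i

  record Endomorphism : Set (r ⊔ m ⊔ ℓm) where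
    field
      ⟦_⟧            : Carrierᴹ → Carrierᴹ
      isHomomorphism : IsLeftModuleHomomorphism ⟦_⟧
    open IsLeftModuleHomomorphism isHomomorphism public

  additive⇒endomorphism : (f : Carrierᴹ → Carrierᴹ) →
    (∀ {x y} → x ≈ᴹ y → f x ≈ᴹ f y) →
    (∀ x y → f (x +ᴹ y) ≈ᴹ f x +ᴹ f y) →
    (∀ c x → f (c *ₗ x) ≈ᴹ c *ₗ f x) → Endomorphism
  additive⇒endomorphism f f-cong f-+ f-* = record
    { ⟦_⟧ = f
    ; isHomomorphism = record
      { +ᴹ-isGroupHomomorphism = record
        { isMonoidHomomorphism = record
          { isMagmaHomomorphism = record
            { isRelHomomorphism = record { cong = f-cong } ; homo = f-+ }
          ; ε-homo = f-0 }
        ; ⁻¹-homo = λ x → inverseˡ-unique (f (-ᴹ x)) (f x)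
            (≈ᴹ-trans (≈ᴹ-sym (f-+ (-ᴹ x) x)) (≈ᴹ-trans (f-cong (-ᴹ‿inverseˡ x)) f-0)) }
      ; *ₗ-homo = f-* } }
    where
    open AbelianGroupProperties +ᴹ-abelianGroup using (identityˡ-unique; inverseˡ-unique)
    f-0 : f 0ᴹ ≈ᴹ 0ᴹ
    f-0 = identityˡ-unique (f 0ᴹ) (f 0ᴹ)
      (≈ᴹ-trans (≈ᴹ-sym (f-+ 0ᴹ 0ᴹ)) (f-cong (+ᴹ-identityˡ 0ᴹ)))

  -- Column j of the matrix lists the coordinates of φ (vector j); the value does
  -- not depend on the basis.
  determinant : ∀ {n} → Basis n → Endomorphism → Carrier
  determinant basis φ = Determinant.det R (λ i j → coord (⟦ vector j ⟧) i)
    where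
    open Basis basis
    open Endomorphism φ

record Polynomial {a ℓ : Level} (A : Set a) (_≈_ : Rel A ℓ) (0# : A) : Set (a ⊔ ℓ) where
  field
    coeff    : ℕ → A
    bound    : ℕ
    vanishes : ∀ n → bound ℕ.≤ n → coeff n ≈ 0#
open Polynomial

cauchyProduct : ∀ {r m} {R : Set r} {M : Set m} (_·_ : R → M → M) (_+_ : Op₂ M) →
                (ℕ → R) → (ℕ → M) → ℕ → M
cauchyProduct _·_ _+_ f m zero    = f 0 · m 0
cauchyProduct _·_ _+_ f m (suc n) =
  (f 0 · m (suc n)) + cauchyProduct _·_ _+_ (λ i → f (suc i)) m n

module PolynomialGroup {a ℓ : Level} (A : AbelianGroup a ℓ) where
  open AbelianGroup A
  open AbelianGroupProperties A using (ε⁻¹≈ε)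

  Poly : Set (a ⊔ ℓ)
  Poly = Polynomial Carrier _≈_ ε

  _≈ₚ_ : Rel Poly ℓ
  p ≈ₚ q = ∀ n → coeff p n ≈ coeff q n

  _+ₚ_ : Op₂ Poly
  p +ₚ q = record
    { coeff = λ n → coeff p n ∙ coeff q n
    ; bound = bound p ℕ.⊔ bound q
    ; vanishes = λ n b≤n → trans
        (∙-cong (vanishes p n (ℕ.≤-trans (ℕ.m≤m⊔n _ _) b≤n))
                (vanishes q n (ℕ.≤-trans (ℕ.m≤n⊔m (bound p) _) b≤n)))
        (identityˡ ε) }

  0ₚ : Poly
  0ₚ = record { coeff = λ _ → ε ; bound = 0 ; vanishes = λ _ _ → refl }

  -ₚ_ : Op₁ Poly
  -ₚ p = record
    { coeff = λ n → coeff p n ⁻¹ ; bound = bound p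
    ; vanishes = λ n b≤n → trans (⁻¹-cong (vanishes p n b≤n)) ε⁻¹≈ε }

  constantCoeff : Carrier → ℕ → Carrier
  constantCoeff x zero    = x
  constantCoeff x (suc _) = ε

  constant : Carrier → Poly
  constant x = record
    { coeff = constantCoeff x ; bound = 1 ; vanishes = λ { (suc _) _ → refl } }

  additiveGroup : AbelianGroup (a ⊔ ℓ) ℓ
  additiveGroup = record
    { Carrier = Poly ; _≈_ = _≈ₚ_ ; _∙_ = _+ₚ_ ; ε = 0ₚ ; _⁻¹ = -ₚ_
    ; isAbelianGroup = record
      { isGroup = record
        { isMonoid = record
          { isSemigroup = record
            { isMagma = record
              { isEquivalence = record
                { refl  = λ _ → refl
                ; sym   = λ p n → sym (p n)
                ; trans = λ p q n → trans (p n) (q n) }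
              ; ∙-cong = λ p q n → ∙-cong (p n) (q n) }
            ; assoc = λ p q r n → assoc _ _ _ }
          ; identity = (λ p n → identityˡ _) , (λ p n → identityʳ _) }
        ; inverse = (λ p n → inverseˡ _) , (λ p n → inverseʳ _)
        ; ⁻¹-cong = λ p n → ⁻¹-cong (p n) }
      ; comm = λ p q n → comm _ _ } }

module PolynomialAction {r ℓr m ℓm : Level} (R : CommutativeRing r ℓr)
                        (M : LeftModule (CommutativeRing.ring R) m ℓm) where
  private
    module R = CommutativeRing R
    module Rᵖ = PolynomialGroup R.+-abelianGroup
  open LeftModule M
  open PolynomialGroup +ᴹ-abelianGroup
  open SetoidReasoning ≈ᴹ-setoid

  private
    _∗_ = cauchyProduct _*ₗ_ _+ᴹ_
    _∗ᴿ_ = cauchyProduct R._*_ R._+_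

  ∗-cong : ∀ {f g m n} → (∀ i → f i R.≈ g i) → (∀ i → m i ≈ᴹ n i) → ∀ i → (f ∗ m) i ≈ᴹ (g ∗ n) i
  ∗-cong f≈g m≈n zero    = *ₗ-cong (f≈g 0) (m≈n 0)
  ∗-cong f≈g m≈n (suc i) =
    +ᴹ-cong (*ₗ-cong (f≈g 0) (m≈n (suc i))) (∗-cong (λ j → f≈g (suc j)) m≈n i)

  ∗-zeroˡ : ∀ {f} m → (∀ i → f i R.≈ R.0#) → ∀ i → (f ∗ m) i ≈ᴹ 0ᴹ
  ∗-zeroˡ m f≈0 zero    = ≈ᴹ-trans (*ₗ-congʳ (f≈0 0)) (*ₗ-zeroˡ _)
  ∗-zeroˡ m f≈0 (suc i) = ≈ᴹ-trans
    (+ᴹ-cong (≈ᴹ-trans (*ₗ-congʳ (f≈0 0)) (*ₗ-zeroˡ _)) (∗-zeroˡ m (λ j → f≈0 (suc j)) i))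
    (+ᴹ-identityˡ 0ᴹ)

  ∗-zeroʳ : ∀ f {m} → (∀ i → m i ≈ᴹ 0ᴹ) → ∀ i → (f ∗ m) i ≈ᴹ 0ᴹ
  ∗-zeroʳ f m≈0 zero    = ≈ᴹ-trans (*ₗ-congˡ (m≈0 0)) (*ₗ-zeroʳ _)
  ∗-zeroʳ f m≈0 (suc i) = ≈ᴹ-trans
    (+ᴹ-cong (≈ᴹ-trans (*ₗ-congˡ (m≈0 (suc i))) (*ₗ-zeroʳ _)) (∗-zeroʳ (λ j → f (suc j)) m≈0 i))
    (+ᴹ-identityˡ 0ᴹ)

  open CommutativeSemigroupProperties
    (CommutativeMonoid.commutativeSemigroup +ᴹ-commutativeMonoid) using (interchange)

  ∗-distribʳ : ∀ f g m i → ((λ j → f j R.+ g j) ∗ m) i ≈ᴹ (f ∗ m) i +ᴹ (g ∗ m) i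
  ∗-distribʳ f g m zero    = *ₗ-distribʳ _ _ _
  ∗-distribʳ f g m (suc i) = ≈ᴹ-trans
    (+ᴹ-cong (*ₗ-distribʳ _ _ _) (∗-distribʳ (λ j → f (suc j)) (λ j → g (suc j)) m i))
    (interchange _ _ _ _)

  ∗-distribˡ : ∀ f m n i → (f ∗ (λ j → m j +ᴹ n j)) i ≈ᴹ (f ∗ m) i +ᴹ (f ∗ n) i
  ∗-distribˡ f m n zero    = *ₗ-distribˡ _ _ _
  ∗-distribˡ f m n (suc i) = ≈ᴹ-trans
    (+ᴹ-cong (*ₗ-distribˡ _ _ _) (∗-distribˡ (λ j → f (suc j)) m n i))
    (interchange _ _ _ _)

  ∗-scale : ∀ c f m i → ((λ j → c R.* f j) ∗ m) i ≈ᴹ c *ₗ (f ∗ m) i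
  ∗-scale c f m zero    = *ₗ-assoc _ _ _
  ∗-scale c f m (suc i) = ≈ᴹ-trans
    (+ᴹ-cong (*ₗ-assoc _ _ _) (∗-scale c (λ j → f (suc j)) m i))
    (≈ᴹ-sym (*ₗ-distribˡ _ _ _))

  ∗-assoc : ∀ f g m i → ((f ∗ᴿ g) ∗ m) i ≈ᴹ (f ∗ (g ∗ m)) i
  ∗-assoc f g m zero    = *ₗ-assoc _ _ _
  ∗-assoc f g m (suc i) = begin
    (f 0 R.* g 0) *ₗ m (suc i) +ᴹ ((λ j → (f 0 R.* g (suc j)) R.+ (f′ ∗ᴿ g) j) ∗ m) i
      ≈⟨ +ᴹ-cong (*ₗ-assoc _ _ _) (∗-distribʳ (λ j → f 0 R.* g (suc j)) (f′ ∗ᴿ g) m i) ⟩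
    f 0 *ₗ g 0 *ₗ m (suc i) +ᴹ (((λ j → f 0 R.* g (suc j)) ∗ m) i +ᴹ ((f′ ∗ᴿ g) ∗ m) i)
      ≈⟨ +ᴹ-assoc _ _ _ ⟨
    f 0 *ₗ g 0 *ₗ m (suc i) +ᴹ ((λ j → f 0 R.* g (suc j)) ∗ m) i +ᴹ ((f′ ∗ᴿ g) ∗ m) i
      ≈⟨ +ᴹ-cong (≈ᴹ-trans (+ᴹ-congˡ (∗-scale (f 0) (λ j → g (suc j)) m i))
                           (≈ᴹ-sym (*ₗ-distribˡ _ _ _)))
                 (∗-assoc f′ g m i) ⟩
    f 0 *ₗ (g 0 *ₗ m (suc i) +ᴹ ((λ j → g (suc j)) ∗ m) i) +ᴹ (f′ ∗ (g ∗ m)) i ∎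
    where
    f′ : ℕ → R.Carrier
    f′ j = f (suc j)

  ∗-constantˡ : ∀ c m i → (Rᵖ.constantCoeff c ∗ m) i ≈ᴹ c *ₗ m i
  ∗-constantˡ c m zero    = ≈ᴹ-refl
  ∗-constantˡ c m (suc i) =
    ≈ᴹ-trans (+ᴹ-congˡ (∗-zeroˡ m (λ _ → R.refl) i)) (+ᴹ-identityʳ _)

  ∗-constantʳ : ∀ f x i → (f ∗ constantCoeff x) i ≈ᴹ f i *ₗ x
  ∗-constantʳ f x zero    = ≈ᴹ-refl
  ∗-constantʳ f x (suc i) = ≈ᴹ-trans
    (+ᴹ-cong (*ₗ-zeroʳ _) (∗-constantʳ (λ j → f (suc j)) x i)) (+ᴹ-identityˡ _)

  ∗-vanishes : ∀ a b {f m} → (∀ i → a ℕ.≤ i → f i R.≈ R.0#) → (∀ i → b ℕ.≤ i → m i ≈ᴹ 0ᴹ) →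
               ∀ i → a ℕ.+ b ℕ.≤ i → (f ∗ m) i ≈ᴹ 0ᴹ
  ∗-vanishes zero    b f≈0 m≈0 i       b≤i       = ∗-zeroˡ _ (λ j → f≈0 j z≤n) i
  ∗-vanishes (suc a) b f≈0 m≈0 (suc i) (s≤s a+b≤i) = ≈ᴹ-trans
    (+ᴹ-cong
      (≈ᴹ-trans (*ₗ-congˡ (m≈0 (suc i) (ℕ.≤-trans (ℕ.m≤n+m b a) (ℕ.m≤n⇒m≤1+n a+b≤i)))) (*ₗ-zeroʳ _))
      (∗-vanishes a b (λ j a≤j → f≈0 (suc j) (s≤s a≤j)) m≈0 i a+b≤i))
    (+ᴹ-identityˡ 0ᴹ)

  _*ₚ_ : Rᵖ.Poly → Poly → Poly
  p *ₚ x = record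
    { coeff = coeff p ∗ coeff x
    ; bound = bound p ℕ.+ bound x
    ; vanishes = ∗-vanishes (bound p) (bound x) (vanishes p) (vanishes x) }

module PolynomialRing {r ℓr : Level} (R : CommutativeRing r ℓr) where
  open CommutativeRing R hiding (zero)
  open PolynomialGroup +-abelianGroup public
  open PolynomialAction R (TensorUnit.leftModule {R = ring}) public renaming (_*ₚ_ to _*ᵖ_)
  open SetoidReasoning setoid

  private
    _∗_ = cauchyProduct _*_ _+_

  ∗-last : ∀ f g i → (f ∗ g) (suc i) ≈ f (suc i) * g 0 + (f ∗ (λ j → g (suc j))) i
  ∗-last f g zero    = +-comm _ _
  ∗-last f g (suc i) = begin
    f 0 * g (suc (suc i)) + ((λ j → f (suc j)) ∗ g) (suc i)
      ≈⟨ +-congˡ (∗-last (λ j → f (suc j)) g i) ⟩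
    f 0 * g (suc (suc i)) + (f (suc (suc i)) * g 0 + ((λ j → f (suc j)) ∗ (λ j → g (suc j))) i)
      ≈⟨ x∙yz≈y∙xz _ _ _ ⟩
    f (suc (suc i)) * g 0 + (f 0 * g (suc (suc i)) + ((λ j → f (suc j)) ∗ (λ j → g (suc j))) i) ∎
    where open CommutativeSemigroupProperties
                 (CommutativeMonoid.commutativeSemigroup +-commutativeMonoid) using (x∙yz≈y∙xz)

  ∗-comm : ∀ f g i → (f ∗ g) i ≈ (g ∗ f) i
  ∗-comm f g zero    = *-comm _ _
  ∗-comm f g (suc i) = trans
    (+-cong (*-comm _ _) (∗-comm (λ j → f (suc j)) g i)) (sym (∗-last g f i))

  polynomialRing : CommutativeRing (r ⊔ ℓr) ℓr
  polynomialRing = record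
    { Carrier = Poly ; _≈_ = _≈ₚ_ ; _+_ = _+ₚ_ ; _*_ = _*ᵖ_ ; -_ = -ₚ_ ; 0# = 0ₚ ; 1# = constant 1#
    ; isCommutativeRing = record
      { isRing = record
        { +-isAbelianGroup = AbelianGroup.isAbelianGroup additiveGroup
        ; *-cong = ∗-cong
        ; *-assoc = λ p q s → ∗-assoc (coeff p) (coeff q) (coeff s)
        ; *-identity = (λ p i → trans (∗-constantˡ 1# (coeff p) i) (*-identityˡ _))
                     , (λ p i → trans (∗-constantʳ (coeff p) 1# i) (*-identityʳ _))
        ; distrib = (λ p q s → ∗-distribˡ (coeff p) (coeff q) (coeff s))
                  , (λ p q s → ∗-distribʳ (coeff q) (coeff s) (coeff p)) }
      ; *-comm = λ p q → ∗-comm (coeff p) (coeff q) } }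

  u : Poly
  u = record { coeff = λ { 1 → 1# ; _ → 0# } ; bound = 2
             ; vanishes = λ { 1 (s≤s ()) ; (suc (suc _)) _ → refl } }

open PolynomialRing public using (polynomialRing)

module MixedAssociativity {r ℓr c : Level} (R : CommutativeRing r ℓr) {C : Set c}
  (_·_ : C → CommutativeRing.Carrier R → CommutativeRing.Carrier R)
  (·-distribˡ : ∀ k x y → CommutativeRing._≈_ R
    (k · CommutativeRing._+_ R x y) (CommutativeRing._+_ R (k · x) (k · y)))
  (·-assoc : ∀ k x y → CommutativeRing._≈_ R
    (CommutativeRing._*_ R (k · x) y) (k · CommutativeRing._*_ R x y)) where
  open CommutativeRing R using (_≈_; _+_; _*_; trans; sym; +-cong; +-congˡ; +-assoc)

  private
    _∗_ = cauchyProduct _·_ _+_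
    _∗ᴿ_ = cauchyProduct _*_ _+_

  mixed-scale : ∀ k f q i → ((λ j → k · f j) ∗ᴿ q) i ≈ (k · (f ∗ᴿ q) i)
  mixed-scale k f q zero    = ·-assoc _ _ _
  mixed-scale k f q (suc i) = trans
    (+-cong (·-assoc _ _ _) (mixed-scale k (λ j → f (suc j)) q i)) (sym (·-distribˡ _ _ _))

  mixed-assoc : ∀ f p q i → ((f ∗ p) ∗ᴿ q) i ≈ (f ∗ (p ∗ᴿ q)) i
  mixed-assoc f p q zero    = ·-assoc _ _ _
  mixed-assoc f p q (suc i) = trans
    (+-cong (·-assoc _ _ _) (PolynomialRing.∗-distribʳ R (λ j → f 0 · p (suc j)) (f′ ∗ p) q i))
    (trans (sym (+-assoc _ _ _))
      (+-cong (trans (+-congˡ (mixed-scale (f 0) (λ j → p (suc j)) q i)) (sym (·-distribˡ _ _ _)))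
              (mixed-assoc f′ p q i)))
    where
    f′ : ℕ → C
    f′ j = f (suc j)

module PolynomialModule {r ℓr m ℓm : Level} (R : CommutativeRing r ℓr)
                        (M : LeftModule (CommutativeRing.ring R) m ℓm) where
  private module R = CommutativeRing R
  open LeftModule M
  open PolynomialGroup +ᴹ-abelianGroup public
  open PolynomialAction R M public

  polynomialModule : LeftModule (CommutativeRing.ring (polynomialRing R)) (m ⊔ ℓm) ℓm
  polynomialModule = record
    { Carrierᴹ = Poly ; _≈ᴹ_ = _≈ₚ_ ; _+ᴹ_ = _+ₚ_ ; _*ₗ_ = _*ₚ_ ; 0ᴹ = 0ₚ ; -ᴹ_ = -ₚ_
    ; isLeftModule = record
      { isLeftSemimodule = record
        { +ᴹ-isCommutativeMonoid = AbelianGroup.isCommutativeMonoid additiveGroup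
        ; isPreleftSemimodule = record
          { *ₗ-cong = ∗-cong
          ; *ₗ-zeroˡ = λ x → ∗-zeroˡ (coeff x) (λ _ → R.refl)
          ; *ₗ-distribʳ = λ x p q → ∗-distribʳ (coeff p) (coeff q) (coeff x)
          ; *ₗ-identityˡ = λ x i → ≈ᴹ-trans (∗-constantˡ R.1# (coeff x) i) (*ₗ-identityˡ _)
          ; *ₗ-assoc = λ p q x → ∗-assoc (coeff p) (coeff q) (coeff x)
          ; *ₗ-zeroʳ = λ p → ∗-zeroʳ (coeff p) (λ _ → ≈ᴹ-refl)
          ; *ₗ-distribˡ = λ p x y → ∗-distribˡ (coeff p) (coeff x) (coeff y) } }
      ; -ᴹ‿cong = λ {x} {y} → AbelianGroup.⁻¹-cong additiveGroup {x} {y}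
      ; -ᴹ‿inverse = AbelianGroup.inverse additiveGroup } }

  private
    module Sum = MonoidSum +ᴹ-commutativeMonoid
    module Sumₚ = MonoidSum (LeftModule.+ᴹ-commutativeMonoid polynomialModule)

  coeff-sum : ∀ {n} (x : Fin n → Poly) i → coeff (Sumₚ.sum x) i ≡ Sum.sum (λ j → coeff (x j) i)
  coeff-sum {zero}  x i = ≡.refl
  coeff-sum {suc n} x i = ≡.cong (coeff (x zero) i +ᴹ_) (coeff-sum (λ j → x (suc j)) i)

  coeff-combination : ∀ {n} (c : Fin n → PolynomialGroup.Poly R.+-abelianGroup)
                      (v : Fin n → Carrierᴹ) i →
                      coeff (Sumₚ.sum (λ j → c j *ₚ constant (v j))) i ≈ᴹ
                      Sum.sum (λ j → coeff (c j) i *ₗ v j)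
  coeff-combination c v i = ≈ᴹ-trans (≈ᴹ-reflexive (coeff-sum (λ j → c j *ₚ constant (v j)) i))
    (Sum.sum-cong-≋ {x = λ j → coeff (c j *ₚ constant (v j)) i} {y = λ j → coeff (c j) i *ₗ v j}
      (λ j → ∗-constantʳ (coeff (c j)) (v j) i))

  polynomialBasis : ∀ {n} → Basis R M n → Basis (polynomialRing R) polynomialModule n
  polynomialBasis basis = record
    { vector = λ j → constant (vector j)
    ; coord  = λ x j → record
      { coeff = λ i → coord (coeff x i) j
      ; bound = bound x
      ; vanishes = λ i b≤i → R.sym (unique (coeff x i) (λ _ → R.0#)
          (≈ᴹ-trans (sum-zero (λ j → vector j)) (≈ᴹ-sym (vanishes x i b≤i))) j) }
    ; expansion = λ x i → ≈ᴹ-trans (coeff-combination _ vector i) (expansion (coeff x i))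
    ; unique = λ x c c≈x j i → unique (coeff x i) (λ j → coeff (c j) i)
        (≈ᴹ-trans (≈ᴹ-sym (coeff-combination c vector i)) (c≈x i)) j }
    where
    open Basis basis
    sum-zero : ∀ {k} (v : Fin k → Carrierᴹ) → Sum.sum (λ j → R.0# *ₗ v j) ≈ᴹ 0ᴹ
    sum-zero {k} v = ≈ᴹ-trans (Sum.sum-cong-≋ (λ j → *ₗ-zeroˡ (v j))) (Sum.sum-replicate-zero k)

open PolynomialModule public using (polynomialModule; polynomialBasis)

module _ {r ℓr m ℓm : Level} (R : CommutativeRing r ℓr)
         (M : LeftModule (CommutativeRing.ring R) m ℓm) where
  private
    module R[u] = CommutativeRing (polynomialRing R)
    module M = LeftModule M
    module M[u] = LeftModule (polynomialModule R M)
    module AM = AbelianGroupProperties M[u].+ᴹ-abelianGroup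
  open PolynomialModule R M using (Poly; _*ₚ_)
  open PolynomialRing R using (u)

  module _ (φ : Endomorphism R M) where
    private module φ = Endomorphism φ

    mapCoefficients : Poly → Poly
    mapCoefficients x = record
      { coeff = λ n → φ.⟦ coeff x n ⟧
      ; bound = bound x
      ; vanishes = λ n b≤n → M.≈ᴹ-trans (φ.⟦⟧-cong (vanishes x n b≤n)) φ.0ᴹ-homo }

    mapCoefficients-* : ∀ p x → mapCoefficients (p *ₚ x) M[u].≈ᴹ p *ₚ mapCoefficients x
    mapCoefficients-* p x = go (coeff p) (coeff x)
      where
      _∗_ = cauchyProduct M._*ₗ_ M._+ᴹ_
      go : ∀ f y n → φ.⟦ (f ∗ y) n ⟧ M.≈ᴹ (f ∗ (λ i → φ.⟦ y i ⟧)) n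
      go f y zero    = φ.*ₗ-homo _ _
      go f y (suc n) = M.≈ᴹ-trans (φ.+ᴹ-homo _ _)
        (M.+ᴹ-cong (φ.*ₗ-homo _ _) (go (λ i → f (suc i)) y n))

    -- x ↦ x - u φ(x), with φ extended to M[u] coefficientwise.
    𝓘-u : Endomorphism (polynomialRing R) (polynomialModule R M)
    𝓘-u = additive⇒endomorphism (polynomialRing R) (polynomialModule R M) f
      (λ {x} {y} → f-cong {x} {y}) f-+ f-*
      where
      A : Poly → Poly
      A = mapCoefficients

      f : Poly → Poly
      f x = x M[u].+ᴹ (M[u].-ᴹ (u *ₚ A x))

      A-cong : ∀ {x y} → x M[u].≈ᴹ y → A x M[u].≈ᴹ A y
      A-cong x≈y n = φ.⟦⟧-cong (x≈y n)

      f-cong : ∀ {x y} → x M[u].≈ᴹ y → f x M[u].≈ᴹ f y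
      f-cong {x} {y} x≈y = M[u].+ᴹ-cong {x} {y} {M[u].-ᴹ (u *ₚ A x)} {M[u].-ᴹ (u *ₚ A y)} x≈y
        (M[u].-ᴹ‿cong {u *ₚ A x} {u *ₚ A y}
          (M[u].*ₗ-cong {u} {u} {A x} {A y} (R[u].refl {u}) (A-cong {x} {y} x≈y)))

      open SetoidReasoning M[u].≈ᴹ-setoid
      open CommutativeSemigroupProperties
        (CommutativeMonoid.commutativeSemigroup M[u].+ᴹ-commutativeMonoid) using (interchange)

      infixl 6 _+_
      _+_ = M[u]._+ᴹ_
      neg = M[u].-ᴹ_

      sub-cong : ∀ x y z → y M[u].≈ᴹ z → (x + neg y) M[u].≈ᴹ (x + neg z)
      sub-cong x y z y≈z = M[u].+ᴹ-cong {x} {x} {neg y} {neg z} (M[u].≈ᴹ-refl {x})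
        (M[u].-ᴹ‿cong {y} {z} y≈z)

      +-congˡ : ∀ x y z → y M[u].≈ᴹ z → (x + y) M[u].≈ᴹ (x + z)
      +-congˡ x y z y≈z = M[u].+ᴹ-cong {x} {x} {y} {z} (M[u].≈ᴹ-refl {x}) y≈z

      *-congʳ : ∀ p {x y} → x M[u].≈ᴹ y → (p *ₚ x) M[u].≈ᴹ (p *ₚ y)
      *-congʳ p {x} {y} = M[u].*ₗ-cong {p} {p} {x} {y} (R[u].refl {p})

      f-+ : ∀ x y → f (x + y) M[u].≈ᴹ f x + f y
      f-+ x y = begin
        (x + y) + (neg (u *ₚ A (x + y)))
          ≈⟨ sub-cong (x + y) (u *ₚ A (x + y)) (u *ₚ (A x + A y))
               (*-congʳ u {A (x + y)} {A x + A y} (λ n → φ.+ᴹ-homo (coeff x n) (coeff y n))) ⟩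
        (x + y) + (neg (u *ₚ (A x + A y)))
          ≈⟨ sub-cong (x + y) (u *ₚ (A x + A y)) ((u *ₚ A x) + (u *ₚ A y))
               (M[u].*ₗ-distribˡ u (A x) (A y)) ⟩
        (x + y) + (neg ((u *ₚ A x) + (u *ₚ A y)))
          ≈⟨ +-congˡ (x + y) (neg ((u *ₚ A x) + (u *ₚ A y))) ((neg (u *ₚ A x)) + (neg (u *ₚ A y)))
               (M[u].≈ᴹ-sym {(neg (u *ₚ A x)) + (neg (u *ₚ A y))} {neg ((u *ₚ A x) + (u *ₚ A y))}
                 (AM.⁻¹-∙-comm (u *ₚ A x) (u *ₚ A y))) ⟩
        (x + y) + ((neg (u *ₚ A x)) + (neg (u *ₚ A y)))
          ≈⟨ interchange x y (neg (u *ₚ A x)) (neg (u *ₚ A y)) ⟩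
        f x + f y ∎

      *-neg : ∀ p y → (p *ₚ (neg y)) M[u].≈ᴹ (neg (p *ₚ y))
      *-neg p y = AM.inverseˡ-unique (p *ₚ (neg y)) (p *ₚ y) (begin
        (p *ₚ (neg y)) + (p *ₚ y)  ≈⟨ M[u].*ₗ-distribˡ p (neg y) y ⟨
        p *ₚ ((neg y) + y)         ≈⟨ *-congʳ p {(neg y) + y} {M[u].0ᴹ} (M[u].-ᴹ‿inverseˡ y) ⟩
        p *ₚ M[u].0ᴹ             ≈⟨ M[u].*ₗ-zeroʳ p ⟩
        M[u].0ᴹ                  ∎)

      u-comm : ∀ p y → (u *ₚ (p *ₚ y)) M[u].≈ᴹ (p *ₚ (u *ₚ y))
      u-comm p y = begin
        u *ₚ (p *ₚ y)     ≈⟨ M[u].*ₗ-assoc u p y ⟨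
        (u R[u].* p) *ₚ y ≈⟨ M[u].*ₗ-cong {u R[u].* p} {p R[u].* u} {y} {y}
                               (R[u].*-comm u p) (M[u].≈ᴹ-refl {y}) ⟩
        (p R[u].* u) *ₚ y ≈⟨ M[u].*ₗ-assoc p u y ⟩
        p *ₚ (u *ₚ y)     ∎

      f-* : ∀ p x → f (p *ₚ x) M[u].≈ᴹ p *ₚ f x
      f-* p x = begin
        (p *ₚ x) + (neg (u *ₚ A (p *ₚ x)))
          ≈⟨ sub-cong (p *ₚ x) (u *ₚ A (p *ₚ x)) (p *ₚ (u *ₚ A x))
               (M[u].≈ᴹ-trans {u *ₚ A (p *ₚ x)} {u *ₚ (p *ₚ A x)} {p *ₚ (u *ₚ A x)}
                 (*-congʳ u {A (p *ₚ x)} {p *ₚ A x} (mapCoefficients-* p x)) (u-comm p (A x))) ⟩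
        (p *ₚ x) + (neg (p *ₚ (u *ₚ A x)))
          ≈⟨ +-congˡ (p *ₚ x) (neg (p *ₚ (u *ₚ A x))) (p *ₚ (neg (u *ₚ A x)))
               (M[u].≈ᴹ-sym {p *ₚ (neg (u *ₚ A x))} {neg (p *ₚ (u *ₚ A x))} (*-neg p (u *ₚ A x))) ⟩
        (p *ₚ x) + (p *ₚ (neg (u *ₚ A x)))
          ≈⟨ M[u].*ₗ-distribˡ p x (neg (u *ₚ A x)) ⟨
        p *ₚ f x ∎

module _ {r ℓr g ℓg s ℓs : Level} (R : CommutativeRing r ℓr) (K : FiniteAbelianGroup g ℓg)
         {S : Setoid s ℓs} (fin : Finite S) (α : Action K S) (free : Action.IsFree α) where
  private
    module R = CommutativeRing R
    module K = FiniteAbelianGroup K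
    module S = Setoid S
    module O = Finite (Action.orbits-finite α fin)
    module ΣK = FreeModule.FiniteSum R K.finite
    module ΣS = FreeModule.FiniteSum R fin
    module M = LeftModule (permutationModule R K α)
    module Sumᴹ = MonoidSum M.+ᴹ-commutativeMonoid
  open CommutativeRing R using (_≈_; _*_; 0#; 1#)
  open Action α
  open Func using (to; cong)
  open FreeModule R using (∑; δ; sum-single)
  open SemiringSum R.semiring using (sum)
  open GroupRing.Convolution R K α using (_⋆_)
  open FiniteAbelianGroup K using (_∙_; _⁻¹)
  open SetoidReasoning R.setoid

  private
    x₀ : Fin O.size → S.Carrier
    x₀ = O.elem

    restriction : Free R S → Fin O.size → Free R K.setoid
    restriction m i = record
      { to = λ k → to m (k · x₀ i) ; cong = λ k≈l → cong m (·-cong k≈l S.refl) }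

    -- The only term contributing to (Σ c i δ (x₀ i)) (k · x₀ i) is (i , k).
    combination : ∀ (c : Fin O.size → Free R K.setoid) i k →
                  sum (λ j → to (c j ⋆ ΣS.basisElement (x₀ j)) (k · x₀ i)) ≈ to (c i) k
    combination c i k = begin
      sum (λ j → ∑ K.finite (term j))     ≈⟨ sum-single _ i (λ j j≢i → ΣK.∑-zero {term j} (off-orbit j j≢i)) ⟩
      ∑ K.finite (term i)                 ≈⟨ ΣK.∑-single (term i) (term-cong i) k off-diagonal ⟩
      to (c i) k * δ fin (x₀ i) ((k ⁻¹) · k · x₀ i)
        ≈⟨ R.*-congˡ (ΣS.δ-yes (S.sym (·-inverseˡ k (x₀ i)))) ⟩
      to (c i) k * 1#                     ≈⟨ R.*-identityʳ _ ⟩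
      to (c i) k                          ∎
      where
      term : Fin O.size → K.Carrier → R.Carrier
      term j l = to (c j) l * δ fin (x₀ j) ((l ⁻¹) · k · x₀ i)

      term-cong : ∀ j {l l′} → l K.≈ l′ → term j l ≈ term j l′
      term-cong j l≈l′ = R.*-cong (cong (c j) l≈l′)
        (ΣS.δ-cong S.refl (·-cong (K.⁻¹-cong l≈l′) S.refl))

      off-orbit : ∀ j → ¬ j ≡ i → ∀ l → term j l ≈ 0#
      off-orbit j j≢i l = R.trans (R.*-congˡ (ΣS.δ-no λ eq → j≢i
        (≡.trans (≡.sym (O.index-elem j)) (≡.trans (O.index-cong (same eq)) (O.index-elem i))))) (R.zeroʳ _)
        where
        same : x₀ j S.≈ (l ⁻¹) · k · x₀ i → x₀ j ∼ x₀ i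
        same eq = IsEquivalence.sym ∼-isEquivalence
          ((l ⁻¹) ∙ k , S.trans (·-assoc (l ⁻¹) k (x₀ i)) (S.sym eq))

      off-diagonal : ∀ l → ¬ l K.≈ k → term i l ≈ 0#
      off-diagonal l l≉k = R.trans (R.*-congˡ (ΣS.δ-no λ eq → l≉k (same eq))) (R.zeroʳ _)
        where
        open AbelianGroupProperties K.abelianGroup using (inverseʳ-unique; ⁻¹-involutive)
        same : x₀ i S.≈ (l ⁻¹) · k · x₀ i → l K.≈ k
        same eq = K.sym (K.trans
          (inverseʳ-unique (l ⁻¹) k (free _ _ (S.trans (·-assoc (l ⁻¹) k (x₀ i)) (S.sym eq))))
          (⁻¹-involutive l))

    to-sum : ∀ {n} (y : Fin n → Free R S) x → to (Sumᴹ.sum y) x ≡ sum (λ j → to (y j) x)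
    to-sum {zero}  y x = ≡.refl
    to-sum {suc n} y x = ≡.cong (to (y zero) x R.+_) (to-sum (λ j → y (suc j)) x)

  -- One element x₀ i is chosen in each orbit; the coordinate of m at x₀ i is
  -- the sum of m (k · x₀ i) k over all k in K.
  orbitBasis : Basis (groupRing R K) (permutationModule R K α) (Finite.size (orbits-finite fin))
  orbitBasis = record
    { vector    = λ i → ΣS.basisElement (x₀ i)
    ; coord     = restriction
    ; expansion = λ m x → expand m x (O.elem-index x)
    ; unique    = λ m c c≈m i k → R.trans (R.sym (combination c i k))
        (R.trans (R.reflexive (≡.sym (to-sum (λ j → c j ⋆ ΣS.basisElement (x₀ j)) (k · x₀ i))))
                 (c≈m (k · x₀ i))) }
    where
    expand : ∀ m x → x₀ (O.index x) ∼ x →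
             to (Sumᴹ.sum (λ j → restriction m j ⋆ ΣS.basisElement (x₀ j))) x ≈ to m x
    expand m x (k , kx₀≈x) = begin
      to (Sumᴹ.sum y) x             ≈⟨ cong (Sumᴹ.sum y) kx₀≈x ⟨
      to (Sumᴹ.sum y) (k · x₀ i)    ≡⟨ to-sum y (k · x₀ i) ⟩
      sum (λ j → to (y j) (k · x₀ i)) ≈⟨ combination (restriction m) i k ⟩
      to m (k · x₀ i)               ≈⟨ cong m kx₀≈x ⟩
      to m x                        ∎
      where
      i : Fin O.size
      i = O.index x
      y : Fin O.size → Free R S
      y j = restriction m j ⋆ ΣS.basisElement (x₀ j)

record FiniteDigraph (v ℓv e ℓe : Level) : Set (lsuc (v ⊔ ℓv ⊔ e ⊔ ℓe)) where
  field
    V : Setoid v ℓv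
    E : Setoid e ℓe
    o : Func E V
    t : Func E V
    V-finite : Finite V
    E-finite : Finite E

  private
    module V = Setoid V
    module E = Setoid E

  Arc : Rel V.Carrier (ℓv ⊔ e)
  Arc x y = ∃ λ ε → Func.to o ε V.≈ x × Func.to t ε V.≈ y

  StronglyConnected : Set (v ⊔ ℓv ⊔ e)
  StronglyConnected = ∀ x y → ¬ x V.≈ y → Star Arc x y

record DigraphAction {g ℓ v ℓv e ℓe : Level} (K : FiniteAbelianGroup g ℓ)
                     (Y : FiniteDigraph v ℓv e ℓe) : Set (g ⊔ ℓ ⊔ v ⊔ ℓv ⊔ e ⊔ ℓe) where
  open FiniteDigraph Y
  private module V = Setoid V
  field
    onV : Action K V
    onE : Action K E
    o-equivariant : ∀ k ε → Func.to o (Action._·_ onE k ε) V.≈ Action._·_ onV k (Func.to o ε)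
    t-equivariant : ∀ k ε → Func.to t (Action._·_ onE k ε) V.≈ Action._·_ onV k (Func.to t ε)

quotient : ∀ {g ℓ v ℓv e ℓe} {K : FiniteAbelianGroup g ℓ} (Y : FiniteDigraph v ℓv e ℓe) →
           DigraphAction K Y → FiniteDigraph v (g ⊔ ℓv) e (g ⊔ ℓe)
quotient Y α = record
  { V = Action.orbits onV
  ; E = Action.orbits onE
  ; o = record
    { to = Func.to o
    ; cong = λ {ε} (k , kε≈ε′) → k , V.trans (V.sym (o-equivariant k ε)) (Func.cong o kε≈ε′) }
  ; t = record
    { to = Func.to t
    ; cong = λ {ε} (k , kε≈ε′) → k , V.trans (V.sym (t-equivariant k ε)) (Func.cong t kε≈ε′) }
  ; V-finite = Action.orbits-finite onV V-finite
  ; E-finite = Action.orbits-finite onE E-finite }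
  where
  open FiniteDigraph Y
  open DigraphAction α
  module V = Setoid V

restrictAction : ∀ {g ℓ p v ℓv e ℓe} {G : FiniteAbelianGroup g ℓ} {Y : FiniteDigraph v ℓv e ℓe}
                 (H : Subgroup G p) → DigraphAction G Y → DigraphAction (Subgroup.subgroup H) Y
restrictAction H α = record
  { onV = restrict H onV ; onE = restrict H onE
  ; o-equivariant = λ h → o-equivariant (proj₁ h)
  ; t-equivariant = λ h → t-equivariant (proj₁ h) }
  where open DigraphAction α

module _ {r ℓr g ℓg v ℓv e ℓe : Level} (R : CommutativeRing r ℓr) (K : FiniteAbelianGroup g ℓg)
         (Y : FiniteDigraph v ℓv e ℓe) (α : DigraphAction K Y) where
  open FiniteDigraph Y
  open DigraphAction α
  private
    module R = CommutativeRing R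
    module K = FiniteAbelianGroup K
    module V = Setoid V
    module E = Setoid E
    module FV = Finite V-finite
    module ΣV = FreeModule.FiniteSum R V-finite
    module ΣE = FreeModule.FiniteSum R E-finite
    module ΣK = FreeModule.FiniteSum R K.finite
    module onV = Action onV
    module onE = Action onE
  open CommutativeRing R using (_≈_; _+_; _*_; 0#; 1#)
  open FreeModule R using (∑; δ; ∑-swap; indicator-cong)
  open GroupRing.Convolution R K onV using (_⋆_)
  open FiniteAbelianGroup K using (_⁻¹)
  open onV using (_·_)
  open Func using (to; cong)
  open SetoidReasoning R.setoid

  -- 𝓐(w) = Σ_{o(ε)=w} t(ε), evaluated at x.
  adjacency : V.Carrier → V.Carrier → R.Carrier
  adjacency w x = ∑ E-finite λ ε →
    if does (to o ε FV.≟ w) then δ V-finite (to t ε) x else 0#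

  adjacency-cong : ∀ {w w′ x x′} → w V.≈ w′ → x V.≈ x′ → adjacency w x ≈ adjacency w′ x′
  adjacency-cong {w} {w′} {x} {x′} w≈w′ x≈x′ = ΣE.∑-cong
    {λ ε → if does (to o ε FV.≟ w) then δ V-finite (to t ε) x else 0#}
    {λ ε → if does (to o ε FV.≟ w′) then δ V-finite (to t ε) x′ else 0#}
    (λ ε → indicator-cong (_ FV.≟ _) (_ FV.≟ _) (λ p → V.trans p w≈w′)
      (λ p → V.trans p (V.sym w≈w′)) (ΣV.δ-cong V.refl x≈x′))

  adjacency-equivariant : ∀ k w x → adjacency (k · w) x ≈ adjacency w ((k ⁻¹) · x)
  adjacency-equivariant k w x = begin
    ∑ E-finite term
      ≈⟨ ΣE.∑-reindex term term-cong (onE._·_ k) (onE._·_ (k ⁻¹)) (onE.·-cong K.refl)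
           (onE.·-cong K.refl) (onE.·-inverseʳ k) (onE.·-inverseˡ k) ⟩
    ∑ E-finite (λ ε → term (onE._·_ k ε))
      ≈⟨ ΣE.∑-cong {λ ε → term (onE._·_ k ε)}
           {λ ε → if does (to o ε FV.≟ w) then δ V-finite (to t ε) ((k ⁻¹) · x) else 0#}
           (λ ε → indicator-cong (_ FV.≟ _) (_ FV.≟ _)
             (λ p → cancel (V.trans (V.sym (o-equivariant k ε)) p))
             (λ p → V.trans (o-equivariant k ε) (onV.·-cong K.refl p))
             (indicator-cong (_ FV.≟ _) (_ FV.≟ _)
               (λ p → V.trans (V.sym (onV.·-inverseˡ k _))
                              (onV.·-cong K.refl (V.trans (V.sym (t-equivariant k ε)) p)))
               (λ p → V.trans (t-equivariant k ε)
                        (V.trans (onV.·-cong K.refl p) (onV.·-inverseʳ k x)))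
               R.refl)) ⟩
    adjacency w ((k ⁻¹) · x) ∎
    where
    term : E.Carrier → R.Carrier
    term ε = if does (to o ε FV.≟ (k · w)) then δ V-finite (to t ε) x else 0#

    term-cong : ∀ {ε ε′} → ε E.≈ ε′ → term ε ≈ term ε′
    term-cong {ε} {ε′} ε≈ε′ = indicator-cong (to o ε FV.≟ (k · w)) (to o ε′ FV.≟ (k · w))
      (V.trans (V.sym (cong o ε≈ε′))) (V.trans (cong o ε≈ε′))
      (ΣV.δ-cong (cong t ε≈ε′) V.refl)

    cancel : ∀ {y z} → k · y V.≈ k · z → y V.≈ z
    cancel {y} {z} p = V.trans (V.sym (onV.·-inverseˡ k y))
      (V.trans (onV.·-cong K.refl p) (onV.·-inverseˡ k z))

  -- The linear extension of w ↦ 𝓐(w).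
  adjacencyMap : Free R V → Free R V
  adjacencyMap f = record
    { to   = λ x → ∑ V-finite λ w → to f w * adjacency w x
    ; cong = λ {x} {y} x≈y → ΣV.∑-cong {λ w → to f w * adjacency w x} {λ w → to f w * adjacency w y}
        (λ w → R.*-congˡ (adjacency-cong V.refl x≈y)) }

  𝓐 : Endomorphism (groupRing R K) (permutationModule R K onV)
  𝓐 = additive⇒endomorphism (groupRing R K) (permutationModule R K onV) adjacencyMap
    (λ {f} {g} f≈g x → ΣV.∑-cong {λ w → to f w * adjacency w x} {λ w → to g w * adjacency w x}
      (λ w → R.*-congʳ (f≈g w)))
    (λ f g x → R.trans
      (ΣV.∑-cong {λ w → (to f w + to g w) * adjacency w x}
                 {λ w → to f w * adjacency w x + to g w * adjacency w x} (λ w → R.distribʳ _ _ _))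
      (ΣV.∑-+ (λ w → to f w * adjacency w x) (λ w → to g w * adjacency w x)))
    linear
    where
    linear : ∀ c f x → to (adjacencyMap (c ⋆ f)) x ≈ to (c ⋆ adjacencyMap f) x
    linear c f x = begin
      ∑ V-finite (λ w → ∑ K.finite (λ k → to c k * to f ((k ⁻¹) · w)) * adjacency w x)
        ≈⟨ ΣV.∑-cong {λ w → ∑ K.finite (λ k → to c k * to f ((k ⁻¹) · w)) * adjacency w x}
                     {λ w → ∑ K.finite (T w)}
             (λ w → R.trans (ΣK.∑-* (adjacency w x) (λ k → to c k * to f ((k ⁻¹) · w)))
               (ΣK.∑-cong {λ k → (to c k * to f ((k ⁻¹) · w)) * adjacency w x} {T w}
                 (λ k → R.*-assoc _ _ _))) ⟩
      ∑ V-finite (λ w → ∑ K.finite (T w))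
        ≈⟨ ∑-swap V-finite K.finite T ⟩
      ∑ K.finite (λ k → ∑ V-finite (λ w → T w k))
        ≈⟨ ΣK.∑-cong {λ k → ∑ V-finite (λ w → T w k)}
             {λ k → to c k * ∑ V-finite (λ w → to f w * adjacency w ((k ⁻¹) · x))}
             (λ k → R.trans (R.sym (ΣV.*-∑ (to c k) (λ w → to f ((k ⁻¹) · w) * adjacency w x)))
                            (R.*-congˡ (shift k))) ⟩
      ∑ K.finite (λ k → to c k * ∑ V-finite (λ w → to f w * adjacency w ((k ⁻¹) · x))) ∎
      where
      T : V.Carrier → K.Carrier → R.Carrier
      T w k = to c k * (to f ((k ⁻¹) · w) * adjacency w x)

      shift : ∀ k → ∑ V-finite (λ w → to f ((k ⁻¹) · w) * adjacency w x) ≈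
                    ∑ V-finite (λ w → to f w * adjacency w ((k ⁻¹) · x))
      shift k = begin
        ∑ V-finite (λ w → to f ((k ⁻¹) · w) * adjacency w x)
          ≈⟨ ΣV.∑-reindex (λ w → to f ((k ⁻¹) · w) * adjacency w x)
               (λ w≈w′ → R.*-cong (cong f (onV.·-cong K.refl w≈w′)) (adjacency-cong w≈w′ V.refl))
               (k ·_) ((k ⁻¹) ·_) (onV.·-cong K.refl) (onV.·-cong K.refl)
               (onV.·-inverseʳ k) (onV.·-inverseˡ k) ⟩
        ∑ V-finite (λ w → to f ((k ⁻¹) · k · w) * adjacency (k · w) x)
          ≈⟨ ΣV.∑-cong {λ w → to f ((k ⁻¹) · k · w) * adjacency (k · w) x}
               {λ w → to f w * adjacency w ((k ⁻¹) · x)}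
               (λ w → R.*-cong (cong f (onV.·-inverseˡ k w)) (adjacency-equivariant k w x)) ⟩
        ∑ V-finite (λ w → to f w * adjacency w ((k ⁻¹) · x)) ∎

_[_][u] : ∀ {r ℓr g ℓg} → CommutativeRing r ℓr → FiniteAbelianGroup g ℓg →
          CommutativeRing (g ⊔ ℓg ⊔ r ⊔ ℓr) (g ⊔ ℓr)
R [ K ][u] = polynomialRing (groupRing R K)

γ : ∀ {g ℓg v ℓv e ℓe} {K : FiniteAbelianGroup g ℓg} (Y : FiniteDigraph v ℓv e ℓe)
    (α : DigraphAction K Y) → Action.IsFree (DigraphAction.onV α) →
    CommutativeRing.Carrier (ℤ.+-*-commutativeRing [ K ][u])
γ {K = K} Y α free = determinant (ℤ.+-*-commutativeRing [ K ][u])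
  (polynomialModule ℤ[K] ℤV) (polynomialBasis ℤ[K] ℤV basis) (𝓘-u ℤ[K] ℤV (𝓐 ℤ.+-*-commutativeRing K Y α))
  where
  open DigraphAction α
  ℤ[K] = groupRing ℤ.+-*-commutativeRing K
  ℤV = permutationModule ℤ.+-*-commutativeRing K onV
  basis : Basis ℤ[K] ℤV (Finite.size (FiniteDigraph.V-finite (quotient Y α)))
  basis = orbitBasis ℤ.+-*-commutativeRing K (FiniteDigraph.V-finite Y) onV free

module _ {r ℓr g ℓg p : Level} (R : CommutativeRing r ℓr) (G : FiniteAbelianGroup g ℓg)
         (H : Subgroup G p) where
  private
    K = Subgroup.subgroup H
    module R = CommutativeRing R
    module G = FiniteAbelianGroup G
    module K = FiniteAbelianGroup K
    module ΣG = FreeModule.FiniteSum R G.finite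
    module ΣK = FreeModule.FiniteSum R K.finite
    module RG = CommutativeRing (groupRing R G)
    module M = LeftModule (permutationModule R K (translation G H))
    module RG[u] = CommutativeRing (R [ G ][u])
    module M[u] = LeftModule (polynomialModule (groupRing R K) (permutationModule R K (translation G H)))
  open CommutativeRing R using (_≈_; _*_)
  open FiniteAbelianGroup G using (_∙_; _⁻¹)
  open FreeModule R using (∑; ∑-swap)
  open Func using (to; cong)
  open GroupRing R G using (_⊛_)
  open GroupRing.Convolution R K (translation G H) using (_⋆_)
  open SetoidReasoning R.setoid

  ⊛-⋆-comm : ∀ a c b → (a ⊛ (c ⋆ b)) RG.≈ (c ⋆ (a ⊛ b))
  ⊛-⋆-comm a c b x = begin
    ∑ G.finite (λ k → to a k * ∑ K.finite (λ h → to c h * to b ((proj₁ h ⁻¹) ∙ ((k ⁻¹) ∙ x))))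
      ≈⟨ ΣG.∑-cong {λ k → to a k * ∑ K.finite (λ h → to c h * to b ((proj₁ h ⁻¹) ∙ ((k ⁻¹) ∙ x)))}
           {λ k → ∑ K.finite (T k)}
           (λ k → R.trans (ΣK.*-∑ (to a k) (λ h → to c h * to b ((proj₁ h ⁻¹) ∙ ((k ⁻¹) ∙ x))))
             (ΣK.∑-cong {λ h → to a k * (to c h * to b ((proj₁ h ⁻¹) ∙ ((k ⁻¹) ∙ x)))} {T k}
               (λ h → R.trans (*-swap _ _ _) (R.*-congˡ (R.*-congˡ (cong b (∙-swap _ _ _))))))) ⟩
    ∑ G.finite (λ k → ∑ K.finite (T k))
      ≈⟨ ∑-swap G.finite K.finite T ⟩
    ∑ K.finite (λ h → ∑ G.finite (λ k → T k h))
      ≈⟨ ΣK.∑-cong {λ h → ∑ G.finite (λ k → T k h)}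
           {λ h → to c h * ∑ G.finite (λ k → to a k * to b ((k ⁻¹) ∙ ((proj₁ h ⁻¹) ∙ x)))}
           (λ h → R.sym (ΣG.*-∑ (to c h) (λ k → to a k * to b ((k ⁻¹) ∙ ((proj₁ h ⁻¹) ∙ x))))) ⟩
    ∑ K.finite (λ h → to c h * ∑ G.finite (λ k → to a k * to b ((k ⁻¹) ∙ ((proj₁ h ⁻¹) ∙ x)))) ∎
    where
    open CommutativeSemigroupProperties R.*-commutativeSemigroup renaming (x∙yz≈y∙xz to *-swap)
    open CommutativeSemigroupProperties
      (CommutativeMonoid.commutativeSemigroup G.commutativeMonoid) renaming (x∙yz≈y∙xz to ∙-swap)
    T : G.Carrier → K.Carrier → R.Carrier
    T k h = to c h * (to a k * to b ((k ⁻¹) ∙ ((proj₁ h ⁻¹) ∙ x)))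

  ⋆-⊛-assoc : ∀ c a b → ((c ⋆ a) ⊛ b) RG.≈ (c ⋆ (a ⊛ b))
  ⋆-⊛-assoc c a b = RG.trans {(c ⋆ a) ⊛ b} {b ⊛ (c ⋆ a)} {c ⋆ (a ⊛ b)} (RG.*-comm (c ⋆ a) b)
    (RG.trans {b ⊛ (c ⋆ a)} {c ⋆ (b ⊛ a)} {c ⋆ (a ⊛ b)} (⊛-⋆-comm b c a)
      (M.*ₗ-congˡ {c} {b ⊛ a} {a ⊛ b} (RG.*-comm b a)))

  open MixedAssociativity (groupRing R G) _⋆_ M.*ₗ-distribˡ ⋆-⊛-assoc

  multiplication : RG[u].Carrier → Endomorphism (R [ K ][u])
    (polynomialModule (groupRing R K) (permutationModule R K (translation G H)))
  multiplication P = additive⇒endomorphism (R [ K ][u])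
    (polynomialModule (groupRing R K) (permutationModule R K (translation G H)))
    (P RG[u].*_)
    (λ {Q} {Q′} → RG[u].*-congˡ {P} {Q} {Q′})
    (RG[u].distribˡ P)
    (λ c Q → let cQ = c M[u].*ₗ Q in
      RG[u].trans {P RG[u].* cQ} {cQ RG[u].* P} {c M[u].*ₗ (P RG[u].* Q)} (RG[u].*-comm P cQ)
      (RG[u].trans {cQ RG[u].* P} {c M[u].*ₗ (Q RG[u].* P)} {c M[u].*ₗ (P RG[u].* Q)}
        (mixed-assoc (coeff c) (coeff Q) (coeff P))
        (M[u].*ₗ-congˡ {c} {Q RG[u].* P} {P RG[u].* Q} (RG[u].*-comm Q P))))

  -- The basis consists of one element from each coset of H, so it is indexed by Γ.
  N : RG[u].Carrier → CommutativeRing.Carrier (R [ K ][u])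
  N P = determinant (R [ K ][u])
    (polynomialModule (groupRing R K) (permutationModule R K (translation G H)))
    (polynomialBasis (groupRing R K) (permutationModule R K (translation G H))
      (orbitBasis R K G.finite (translation G H) (translation-free G H)))
    (multiplication P)

module _ {f ℓ₁ ℓ₂ : Level} (F : HeytingField f ℓ₁ ℓ₂) where
  open HeytingField F

  fieldRing : CommutativeRing f ℓ₁
  fieldRing = HeytingCommutativeRing.commutativeRing heytingCommutativeRing

  private module F = CommutativeRing fieldRing
  open SemiringSum F.semiring using (sum)
  open SemiringExp F.semiring using (_^_)
  open SemiringMult F.semiring using () renaming (_×_ to _×ℕ_)

  eval : CommutativeRing.Carrier (polynomialRing fieldRing) → Carrier → Carrier
  eval p x = sum {bound p} λ i → coeff p (toℕ i) * x ^ toℕ i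

  -- Every non-constant polynomial, i.e. one with a coefficient of positive degree
  -- that is apart from 0, has a root.
  AlgebraicallyClosed : Set (f ⊔ ℓ₁ ⊔ ℓ₂)
  AlgebraicallyClosed = ∀ p → (∃ λ n → coeff p (suc n) # 0#) → ∃ λ x → eval p x ≈ 0#

  CharacteristicZero : Set ℓ₁
  CharacteristicZero = ∀ n → ¬ (suc n ×ℕ 1#) ≈ 0#

  fromℤ : ℤ → Carrier
  fromℤ (+ n)    = n ×ℕ 1#
  fromℤ -[1+ n ] = - (suc n ×ℕ 1#)

  -- Induced on coefficients by fromℤ.
  baseChange : ∀ {g ℓg} (K : FiniteAbelianGroup g ℓg) →
               CommutativeRing.Carrier (ℤ.+-*-commutativeRing [ K ][u]) →
               CommutativeRing.Carrier (fieldRing [ K ][u])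
  baseChange K P = record
    { coeff = λ n → record
      { to   = λ k → fromℤ (Func.to (coeff P n) k)
      ; cong = λ k≈l → F.reflexive (≡.cong fromℤ (Func.cong (coeff P n) k≈l)) }
    ; bound = bound P
    ; vanishes = λ n b≤n k → F.reflexive (≡.cong fromℤ (vanishes P n b≤n k)) }

{-# OPTIONS --safe #-}

-- A determinant over F[G][u] of a matrix M turns into one over F[H][u] by replacing every entry by the matrix of
-- multiplication by it in a basis of coset representatives. The norm of det M is the determinant of the block matrix so
-- obtained: eliminate with the pivot M₀₀ and induct, both sides being multiplicative in M. For M = I - 𝓐u every pivot is
-- congruent to 1 modulo u, so it can be cancelled. If xⱼ represent the G-orbits of V and gₖ the cosets of H, then gₖ xⱼ
-- represent the H-orbits, and the block matrix is the one of the H-linear map I - 𝓐u in the basis gₖ xⱼ. It remains to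
-- change the basis, and to note that determinants commute with ℤ → F.
module Submission where

open import Defs
open import Algebra.Apartness.Bundles using (HeytingField)
open import Algebra.Bundles using (CommutativeMonoid; CommutativeRing)
open import Algebra.Module.Bundles using (LeftModule)
open import Algebra.Morphism.Structures using (module RingMorphisms)
import Algebra.Properties.AbelianGroup as AbelianGroupProperties
import Algebra.Properties.CommutativeSemigroup as CommutativeSemigroupProperties
import Algebra.Properties.Ring as RingProperties
import Algebra.Properties.Semiring.Exp as SemiringExp
import Algebra.Properties.Semiring.Mult as SemiringMult
import Algebra.Properties.Semiring.Sum as SemiringSum
open import Data.Bool.Base using (if_then_else_)
open import Data.Fin.Base using (Fin; zero; suc; toℕ; punchIn; _↑ˡ_; _↑ʳ_; splitAt; remQuot; combine)
import Data.Fin.Properties as Fin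
import Data.Integer.Base as ℤ
import Data.Integer.Properties as ℤ
open import Data.Nat.Base as ℕ using (ℕ; zero; suc; z≤n; s≤s)
import Data.Nat.Properties as ℕ
open import Data.Product.Base using (∃; _×_; _,_; proj₁; proj₂; map₁)
open import Data.Sum.Base using (_⊎_; inj₁; inj₂)
open import Data.Vec.Functional using (_∷_; tail)
open import Function.Base using (_∘_)
open import Function.Bundles using (Func)
open import Level using (Level; _⊔_)
open import Relation.Binary.Bundles using (Setoid)
open import Relation.Binary.PropositionalEquality.Core as ≡ using (_≡_; _≢_)
import Relation.Binary.Reasoning.Setoid as SetoidReasoning
open import Relation.Nullary.Decidable.Core using (Dec; yes; no; does)
open import Relation.Nullary.Negation.Core using (contradiction)
open Polynomial

-- Determinants

-- The only cancellation used is that of a polynomial with constant coefficient 1, which is regular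
-- over every commutative ring. This is why the induction has to carry along the congruence of the
-- matrix to the identity modulo u, and why the elimination step is free of division: it scales all
-- later columns by the pivot and pays with a power of it, which again has constant coefficient 1.
--
-- Linear maps are handled through kernels κ x y, the coefficient of δ y in the image of δ x. The
-- group enters a kernel only through the demand of invariance. Passing from G to H therefore keeps
-- the values, and matrices for different sets of representatives arise by reading the same function
-- at different points.
--
-- Multiplicativity of the determinant, needed over all the rings involved, is obtained from the
-- uniqueness of alternating forms, so that permutations never appear.

remQuot-↑ʳ : ∀ {n} m (p : Fin (n ℕ.* m)) → remQuot {suc n} m (m ↑ʳ p) ≡ map₁ suc (remQuot {n} m p)
remQuot-↑ʳ {n} m p rewrite Fin.splitAt-↑ʳ m (n ℕ.* m) p = ≡.refl

module Determinants {r ℓ : Level} (R : CommutativeRing r ℓ) where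
  open CommutativeRing R hiding (zero)
  open Determinant R public
  open SemiringSum semiring using (sum; ∑-distrib-+; *-distribˡ-sum; *-distribʳ-sum)
    renaming (sum-cong-≋ to sum-cong-impl)
  open SemiringExp semiring using (_^_)
  open RingProperties ring using (-‿distribˡ-*; -‿distribʳ-*; -1*x≈-x; -‿involutive; -0#≈0#)
  open FreeModule R using (sum-zero) public
  open SetoidReasoning setoid
  open CommutativeSemigroupProperties *-commutativeSemigroup
    using () renaming (x∙yz≈y∙xz to *-swap)

  sum-cong : ∀ {n} {f g : Fin n → Carrier} → (∀ i → f i ≈ g i) → sum f ≈ sum g
  sum-cong {f = f} {g} = sum-cong-impl {x = f} {y = g}

  Row : ℕ → Set r
  Row m = Fin m → Carrier

  Matrix : ℕ → ℕ → Set r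
  Matrix n m = Fin n → Row m

  infix 4 _≋_ _≈ᴹ_
  _≋_ : ∀ {m} → Row m → Row m → Set ℓ
  x ≋ y = ∀ j → x j ≈ y j

  _≈ᴹ_ : ∀ {n m} → Matrix n m → Matrix n m → Set ℓ
  A ≈ᴹ B = ∀ i → A i ≋ B i

  minor : ∀ {n m} → Fin (suc m) → Matrix n (suc m) → Matrix n m
  minor j A i k = A i (punchIn j k)

  sign : ∀ {n} → Fin n → Carrier
  sign j = (- 1#) ^ toℕ j

  det-cong : ∀ {n} {A B : Matrix n n} → A ≈ᴹ B → det A ≈ det B
  det-cong {zero}  A≈B = refl
  det-cong {suc n} A≈B = sum-cong λ j →
    *-congˡ {x = sign j} (*-cong (A≈B zero j) (det-cong λ i k → A≈B (suc i) (punchIn j k)))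

  sum-linear : ∀ {n} a b (f g : Row n) → sum (λ i → a * f i + b * g i) ≈ a * sum f + b * sum g
  sum-linear a b f g = begin
    sum (λ i → a * f i + b * g i)                  ≈⟨ ∑-distrib-+ (λ i → a * f i) (λ i → b * g i) ⟩
    sum (λ i → a * f i) + sum (λ i → b * g i)      ≈⟨ +-cong (*-distribˡ-sum a f) (*-distribˡ-sum b g) ⟨
    a * sum f + b * sum g                          ∎

  -- A relation between three matrices, used in place of an operation that overwrites a row. Minors
  -- and prepended rows then inherit it without any comparison of indices.
  record Combination {n m} (i : Fin n) (a b : Carrier) (A B C : Matrix n m) : Set ℓ where
    field
      combined : ∀ k → A i k ≈ a * B i k + b * C i k
      elseˡ    : ∀ j → j ≢ i → A j ≋ B j
      elseʳ    : ∀ j → j ≢ i → A j ≋ C j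

  -- Vanishing is demanded for adjacent equal rows only, since this is what the expansion along the
  -- first row yields by induction. `head-repeated` recovers the case of rows further apart from it.
  record Alternating {n m} (f : Matrix n m → Carrier) : Set (r ⊔ ℓ) where
    field
      cong        : ∀ {A B} → A ≈ᴹ B → f A ≈ f B
      linear      : ∀ {i a b A B C} → Combination i a b A B C → f A ≈ a * f B + b * f C
      alternating : ∀ {A} i j → toℕ j ≡ suc (toℕ i) → A i ≋ A j → f A ≈ 0#

  det-linear : ∀ {n i a b} {A B C : Matrix n n} → Combination i a b A B C → det A ≈ a * det B + b * det C
  det-linear {suc n} {zero} {a} {b} {A} {B} {C} comb = begin
    det A ≈⟨ sum-cong term ⟩
    sum (λ j → a * T B j + b * T C j) ≈⟨ sum-linear a b (T B) (T C) ⟩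
    a * det B + b * det C ∎
    where
    open Combination comb
    T : Matrix (suc n) (suc n) → Fin (suc n) → Carrier
    T X j = sign j * (X zero j * det (minor j (tail X)))
    factor : ∀ s c x d → s * ((c * x) * d) ≈ c * (s * (x * d))
    factor s c x d = trans (*-congˡ (*-assoc c x d)) (*-swap s c (x * d))
    term : ∀ j → T A j ≈ a * T B j + b * T C j
    term j = let s = sign j ; d = det (minor j (tail A)) in begin
      s * (A zero j * d) ≈⟨ *-congˡ {x = s} (*-congʳ (combined j)) ⟩
      s * ((a * B zero j + b * C zero j) * d) ≈⟨ *-congˡ (distribʳ d _ _) ⟩
      s * ((a * B zero j) * d + (b * C zero j) * d) ≈⟨ distribˡ s _ _ ⟩
      s * ((a * B zero j) * d) + s * ((b * C zero j) * d) ≈⟨ +-cong (factor s a _ d) (factor s b _ d) ⟩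
      a * (s * (B zero j * d)) + b * (s * (C zero j * d))
        ≈⟨ +-cong (*-congˡ (*-congˡ (*-congˡ (det-cong λ i k → elseˡ (suc i) (λ ()) (punchIn j k)))))
                  (*-congˡ (*-congˡ (*-congˡ (det-cong λ i k → elseʳ (suc i) (λ ()) (punchIn j k))))) ⟩
      a * T B j + b * T C j ∎
  det-linear {suc n} {suc i} {a} {b} {A} {B} {C} comb = begin
    det A ≈⟨ sum-cong term ⟩
    sum (λ j → a * T B j + b * T C j) ≈⟨ sum-linear a b (T B) (T C) ⟩
    a * det B + b * det C ∎
    where
    open Combination comb
    T : Matrix (suc n) (suc n) → Fin (suc n) → Carrier
    T X j = sign j * (X zero j * det (minor j (tail X)))
    factor : ∀ s x c d → s * (x * (c * d)) ≈ c * (s * (x * d))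
    factor s x c d = trans (*-congˡ (*-swap x c d)) (*-swap s c (x * d))
    minor-comb : ∀ j → Combination i a b (minor j (tail A)) (minor j (tail B)) (minor j (tail C))
    minor-comb j = record
      { combined = λ k → combined (punchIn j k)
      ; elseˡ = λ l l≢i k → elseˡ (suc l) (l≢i ∘ Fin.suc-injective) (punchIn j k)
      ; elseʳ = λ l l≢i k → elseʳ (suc l) (l≢i ∘ Fin.suc-injective) (punchIn j k) }
    term : ∀ j → T A j ≈ a * T B j + b * T C j
    term j = let s = sign j ; x = A zero j ; dB = det (minor j (tail B)) ; dC = det (minor j (tail C)) in begin
      s * (x * det (minor j (tail A))) ≈⟨ *-congˡ {x = s} (*-congˡ (det-linear (minor-comb j))) ⟩
      s * (x * (a * dB + b * dC)) ≈⟨ *-congˡ (distribˡ x _ _) ⟩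
      s * (x * (a * dB) + x * (b * dC)) ≈⟨ distribˡ s _ _ ⟩
      s * (x * (a * dB)) + s * (x * (b * dC)) ≈⟨ +-cong (factor s x a dB) (factor s x b dC) ⟩
      a * (s * (x * dB)) + b * (s * (x * dC))
        ≈⟨ +-cong (*-congˡ (*-congˡ (*-congʳ (elseˡ zero (λ ()) j))))
                  (*-congˡ (*-congˡ (*-congʳ (elseʳ zero (λ ()) j)))) ⟩
      a * T B j + b * T C j ∎

  -- The terms indexed by (zero , k) and (suc k , zero) carry opposite signs; the remaining
  -- pairs (suc j , suc k) are again of the given form.
  sum-pairs-cancel : ∀ n {m} (F : (p q : Fin m) (c : Fin n → Fin m) → Carrier) (s : Fin (suc (suc n)) → Fin m) →
    (∀ p q {c c′} → (∀ l → c l ≡ c′ l) → F p q c ≈ F q p c′) →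
    sum (λ j → sum λ k → sign j * (sign k * F (s j) (s (punchIn j k)) (λ l → s (punchIn j (punchIn k l))))) ≈ 0#
  sum-pairs-cancel n {m} F s F-sym = begin
    sum (T zero) + sum (λ j → T (suc j) zero + sum (λ k → T (suc j) (suc k)))
      ≈⟨ +-congˡ (∑-distrib-+ (λ j → T (suc j) zero) (λ j → sum (λ k → T (suc j) (suc k)))) ⟩
    sum (T zero) + (sum (λ j → T (suc j) zero) + sum (λ j → sum (λ k → T (suc j) (suc k))))
      ≈⟨ +-assoc _ _ _ ⟨
    sum (T zero) + sum (λ j → T (suc j) zero) + sum (λ j → sum (λ k → T (suc j) (suc k)))
      ≈⟨ +-cong (trans (sym (∑-distrib-+ (T zero) (λ j → T (suc j) zero))) (sum-zero _ opposite)) (rest n F s F-sym) ⟩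
    0# + 0# ≈⟨ +-identityˡ 0# ⟩
    0# ∎
    where
    T : Fin (suc (suc n)) → Fin (suc n) → Carrier
    T j k = sign j * (sign k * F (s j) (s (punchIn j k)) (λ l → s (punchIn j (punchIn k l))))

    opposite : ∀ k → T zero k + T (suc k) zero ≈ 0#
    opposite k = let x = F (s zero) (s (suc k)) (λ l → s (suc (punchIn k l))) in begin
      1# * (sign k * x) + (- 1# * sign k) * (1# * F (s (suc k)) (s zero) (λ l → s (suc (punchIn k l))))
        ≈⟨ +-cong (*-identityˡ _) (*-congˡ (trans (*-identityˡ _) (F-sym _ _ (λ _ → ≡.refl)))) ⟩
      sign k * x + (- 1# * sign k) * x ≈⟨ +-congˡ (trans (*-assoc _ _ _) (-1*x≈-x _)) ⟩
      sign k * x + - (sign k * x) ≈⟨ -‿inverseʳ _ ⟩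
      0# ∎

    signs-cancel : ∀ {a b} x → (- 1# * a) * ((- 1# * b) * x) ≈ a * (b * x)
    signs-cancel {a} {b} x = begin
      (- 1# * a) * ((- 1# * b) * x) ≈⟨ *-cong (-1*x≈-x a) (*-congʳ (-1*x≈-x b)) ⟩
      - a * (- b * x)               ≈⟨ *-congˡ (-‿distribˡ-* b x) ⟨
      - a * - (b * x)               ≈⟨ -‿distribʳ-* (- a) (b * x) ⟨
      - (- a * (b * x))             ≈⟨ -‿cong (-‿distribˡ-* a (b * x)) ⟨
      - - (a * (b * x))             ≈⟨ -‿involutive _ ⟩
      a * (b * x)                   ∎

    rest : ∀ n {m} (F : (p q : Fin m) (c : Fin n → Fin m) → Carrier) (s : Fin (suc (suc n)) → Fin m) →
      (∀ p q {c c′} → (∀ l → c l ≡ c′ l) → F p q c ≈ F q p c′) →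
      sum {suc n} (λ j → sum {n} λ k → sign (suc j) * (sign (suc k) *
        F (s (suc j)) (s (punchIn (suc j) (suc k))) (λ l → s (punchIn (suc j) (punchIn (suc k) l))))) ≈ 0#
    rest zero    F s F-sym = +-identityˡ 0#
    rest (suc n) {m} F s F-sym = trans
      (sum-cong λ j → sum-cong λ k → trans (signs-cancel _)
        (*-congˡ {x = sign j} (*-congˡ {x = sign k}
          -- The only congruence of `F` in its last argument is the one contained in `F-sym`. Two
          -- applications replace that argument by a pointwise equal one and restore the order of
          -- the first two.
          (trans (F-sym (s (suc j)) (s (suc (punchIn j k))) (λ _ → ≡.refl)) (F-sym _ _ (shifted j k))))))
      -- Neither chosen column is `s zero` any more, so it has become the first of the complementary
      -- columns.
      (sum-pairs-cancel n (λ p q c → F p q (s zero ∷ c)) (s ∘ suc)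
        (λ p q c≗c′ → F-sym p q (λ { zero → ≡.refl ; (suc l) → c≗c′ l })))
      where
      shifted : ∀ j k l → s (punchIn (suc j) (punchIn (suc k) l)) ≡ (s zero ∷ (λ l → s (suc (punchIn j (punchIn k l))))) l
      shifted j k zero    = ≡.refl
      shifted j k (suc l) = ≡.refl

  -- If the first two rows agree, expanding along both gives a signed sum over ordered pairs of
  -- distinct columns p, q whose summand contains `A zero p * A zero q`, which is symmetric, and
  -- `sum-pairs-cancel` applies. Equal rows further down survive in every minor.
  det-alternating : ∀ {n} {A : Matrix n n} (i j : Fin n) → toℕ j ≡ suc (toℕ i) → A i ≋ A j → det A ≈ 0#
  det-alternating {suc (suc n)} {A} zero (suc zero) _ A₀≋A₁ = trans
    (sum-cong λ j → begin
      sign j * (A zero j * sum (T j))   ≈⟨ *-congˡ {x = sign j} (*-distribˡ-sum (A zero j) (T j)) ⟩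
      sign j * sum (λ k → A zero j * T j k)
        ≈⟨ *-congˡ {x = sign j} (sum-cong (term j)) ⟩
      sign j * sum (λ k → sign k * F j (punchIn j k) (λ l → punchIn j (punchIn k l)))
        ≈⟨ *-distribˡ-sum (sign j) (λ k → sign k * F j (punchIn j k) (λ l → punchIn j (punchIn k l))) ⟩
      sum (λ k → sign j * (sign k * F j (punchIn j k) (λ l → punchIn j (punchIn k l)))) ∎)
    (sum-pairs-cancel n F (λ j → j) F-sym)
    where
    F : (p q : Fin (suc (suc n))) (c : Fin n → Fin (suc (suc n))) → Carrier
    F p q c = A zero p * (A zero q * det (λ i l → A (suc (suc i)) (c l)))

    F-sym : ∀ p q {c c′} → (∀ l → c l ≡ c′ l) → F p q c ≈ F q p c′
    F-sym p q c≗c′ = trans (*-swap (A zero p) (A zero q) _) (*-congˡ (*-congˡ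
      (det-cong λ i l → reflexive (≡.cong (A (suc (suc i))) (c≗c′ l)))))

    T : Fin (suc (suc n)) → Fin (suc n) → Carrier
    T j k = sign k * (A (suc zero) (punchIn j k) * det (minor k (minor j (tail (tail A)))))

    term : ∀ j k → A zero j * T j k ≈
      sign k * F j (punchIn j k) (λ l → punchIn j (punchIn k l))
    term j k = trans (*-swap (A zero j) (sign k) _)
      (*-congˡ (*-congˡ (*-congʳ (sym (A₀≋A₁ (punchIn j k))))))
  det-alternating {suc n} {A} (suc i) (suc j) eq Aᵢ≋Aⱼ = sum-zero _ λ k → begin
    sign k * (A zero k * det (minor k (tail A)))
      ≈⟨ *-congˡ {x = sign k} (*-congˡ {x = A zero k}
           (det-alternating i j (ℕ.suc-injective eq) (λ l → Aᵢ≋Aⱼ (punchIn k l)))) ⟩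
    sign k * (A zero k * 0#)  ≈⟨ *-congˡ {x = sign k} (zeroʳ _) ⟩
    sign k * 0#               ≈⟨ zeroʳ _ ⟩
    0#                        ∎

  det-form : ∀ {n} → Alternating (det {n})
  det-form = record { cong = det-cong ; linear = det-linear ; alternating = det-alternating }

  -- Recursion instead of a test for equality of indices makes the lower right minor of `𝟙` reduce
  -- to `𝟙`.
  𝟙 : ∀ {n} → Matrix n n
  𝟙 zero    zero    = 1#
  𝟙 zero    (suc j) = 0#
  𝟙 (suc i) zero    = 0#
  𝟙 (suc i) (suc j) = 𝟙 i j

  sum-*-𝟙 : ∀ {n} (x : Row n) k → sum (λ j → x j * 𝟙 j k) ≈ x k
  sum-*-𝟙 x zero    = trans (+-cong (*-identityʳ _) (sum-zero (λ j → x (suc j) * 0#) λ j → zeroʳ _)) (+-identityʳ _)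
  sum-*-𝟙 x (suc k) = trans (+-cong (zeroʳ _) (sum-*-𝟙 (tail x) k)) (+-identityˡ _)

  sum-𝟙-* : ∀ {n} i (x : Row n) → sum (λ j → 𝟙 i j * x j) ≈ x i
  sum-𝟙-* zero    x = trans (+-cong (*-identityˡ _) (sum-zero (λ j → 0# * x (suc j)) λ j → zeroˡ _)) (+-identityʳ _)
  sum-𝟙-* (suc i) x = trans (+-cong (zeroˡ _) (sum-𝟙-* i (tail x))) (+-identityˡ _)

  infixl 7 _⊠_
  _⊠_ : ∀ {n m k} → Matrix n m → Matrix m k → Matrix n k
  (A ⊠ B) i j = sum λ k → A i k * B k j

  -- Uniqueness of alternating forms and multiplicativity of the determinant

  module _ {n m} {f : Matrix (suc n) m → Carrier} (alt : Alternating f) where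
    open Alternating alt

    ∷-form : ∀ x → Alternating (λ A → f (x ∷ A))
    ∷-form x = record
      { cong = λ A≈B → cong λ { zero j → refl ; (suc i) j → A≈B i j }
      ; linear = λ {i} comb → let open Combination comb in linear {suc i} record
        { combined = combined
        ; elseˡ = λ { zero _ k → refl ; (suc j) j≢i → elseˡ j (j≢i ∘ ≡.cong suc) }
        ; elseʳ = λ { zero _ k → refl ; (suc j) j≢i → elseʳ j (j≢i ∘ ≡.cong suc) } }
      ; alternating = λ i j j≡1+i → alternating (suc i) (suc j) (≡.cong suc j≡1+i) }

    head-linear : ∀ a b {x y z A} → (∀ k → x k ≈ a * y k + b * z k) →
                  f (x ∷ A) ≈ a * f (y ∷ A) + b * f (z ∷ A)
    head-linear a b x≋ay+bz = linear {zero} record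
      { combined = x≋ay+bz
      ; elseˡ = λ { zero 0≢0 → contradiction ≡.refl 0≢0 ; (suc i) _ k → refl }
      ; elseʳ = λ { zero 0≢0 → contradiction ≡.refl 0≢0 ; (suc i) _ k → refl } }

    head-+ : ∀ {x y z A} → (∀ k → x k ≈ y k + z k) → f (x ∷ A) ≈ f (y ∷ A) + f (z ∷ A)
    head-+ x≋y+z = trans
      (head-linear 1# 1# λ k → trans (x≋y+z k) (sym (+-cong (*-identityˡ _) (*-identityˡ _))))
      (+-cong (*-identityˡ _) (*-identityˡ _))

    head-sum : ∀ {l} (c : Row l) (v : Matrix l m) A →
               f ((λ k → sum λ j → c j * v j k) ∷ A) ≈ sum (λ j → c j * f (v j ∷ A))
    head-sum {zero}  c v A = trans (head-linear 0# 0# {y = λ _ → 0#} {z = λ _ → 0#}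
      λ k → sym (trans (+-cong (zeroˡ 0#) (zeroˡ 0#)) (+-identityˡ 0#)))
      (trans (+-cong (zeroˡ _) (zeroˡ _)) (+-identityˡ 0#))
    head-sum {suc l} c v A = trans
      (head-linear (c zero) 1# {y = v zero} {z = λ k → sum λ j → c (suc j) * v (suc j) k}
        λ k → +-congˡ (sym (*-identityˡ _)))
      (+-congˡ (trans (*-identityˡ _) (head-sum (tail c) (tail v) A)))

  module _ {n m} {f : Matrix (suc (suc n)) m → Carrier} (alt : Alternating f) where
    open Alternating alt

    -- Polarisation: expand the vanishing value at `z ∷ z ∷ A` with z = x + y, where the terms with
    -- a repeated x or y vanish too.
    swap : ∀ x y A → f (x ∷ y ∷ A) ≈ - f (y ∷ x ∷ A)
    swap x y A = begin
      f (x ∷ y ∷ A)                                       ≈⟨ +-identityʳ _ ⟨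
      f (x ∷ y ∷ A) + 0#                                  ≈⟨ +-congˡ (-‿inverseʳ _) ⟨
      f (x ∷ y ∷ A) + (f (y ∷ x ∷ A) - f (y ∷ x ∷ A))     ≈⟨ +-assoc _ _ _ ⟨
      f (x ∷ y ∷ A) + f (y ∷ x ∷ A) - f (y ∷ x ∷ A)       ≈⟨ +-congʳ sum≈0 ⟩
      0# - f (y ∷ x ∷ A)                                  ≈⟨ +-identityˡ _ ⟩
      - f (y ∷ x ∷ A)                                     ∎
      where
      z : Row m
      z k = x k + y k
      equal : ∀ x → f (x ∷ x ∷ A) ≈ 0#
      equal x = alternating zero (suc zero) ≡.refl (λ k → refl)
      expand : ∀ w → f (w ∷ z ∷ A) ≈ f (w ∷ x ∷ A) + f (w ∷ y ∷ A)
      expand w = head-+ (∷-form alt w) (λ k → refl)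
      sum≈0 : f (x ∷ y ∷ A) + f (y ∷ x ∷ A) ≈ 0#
      sum≈0 = begin
        f (x ∷ y ∷ A) + f (y ∷ x ∷ A)
          ≈⟨ +-cong (+-identityˡ _) (+-identityʳ _) ⟨
        (0# + f (x ∷ y ∷ A)) + (f (y ∷ x ∷ A) + 0#)
          ≈⟨ +-cong (+-congʳ (equal x)) (+-congˡ (equal y)) ⟨
        (f (x ∷ x ∷ A) + f (x ∷ y ∷ A)) + (f (y ∷ x ∷ A) + f (y ∷ y ∷ A))
          ≈⟨ +-cong (expand x) (expand y) ⟨
        f (x ∷ z ∷ A) + f (y ∷ z ∷ A)
          ≈⟨ head-+ alt (λ k → refl) ⟨
        f (z ∷ z ∷ A) ≈⟨ equal z ⟩
        0# ∎

  -- Adjacent swaps carry the first row down to its copy; each changes only the sign.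
  head-repeated : ∀ {n m} {f : Matrix (suc n) m → Carrier} → Alternating f →
                  ∀ x A i → A i ≋ x → f (x ∷ A) ≈ 0#
  head-repeated alt x A zero    A₀≋x = Alternating.alternating alt zero (suc zero) ≡.refl (λ k → sym (A₀≋x k))
  head-repeated {f = f} alt x A (suc i) Aᵢ≋x = begin
    f (x ∷ A)               ≈⟨ cong (λ { zero k → refl ; (suc zero) k → refl ; (suc (suc j)) k → refl }) ⟩
    f (x ∷ A zero ∷ tail A) ≈⟨ swap alt x (A zero) (tail A) ⟩
    - f (A zero ∷ x ∷ tail A) ≈⟨ -‿cong (head-repeated (∷-form alt (A zero)) x (tail A) i Aᵢ≋x) ⟩
    - 0# ≈⟨ -0#≈0# ⟩
    0# ∎
    where open Alternating alt

  -- Row by row, linearity splits off a multiple of a value of `f` at a matrix containing the row x,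
  -- which is 0. It is applied to a form whose first row is already fixed to be x, in order to clear
  -- a column below that row.
  rows-modulo : ∀ {n m} {f : Matrix n m → Carrier} → Alternating f → ∀ x →
    (∀ A i → A i ≋ x → f A ≈ 0#) →
    ∀ A B (c : Row n) → (∀ i k → A i k ≈ B i k + c i * x k) → f A ≈ f B
  rows-modulo {zero}  alt x f-x A B c A≈B+cx = Alternating.cong alt (λ ())
  rows-modulo {suc n} {f = f} alt x f-x A B c A≈B+cx = begin
    f A ≈⟨ cong (λ { zero k → refl ; (suc i) k → refl }) ⟩
    f (A zero ∷ tail A)
      ≈⟨ head-linear alt 1# (c zero) {y = B zero} {z = x} (λ k → trans (A≈B+cx zero k) (+-congʳ (sym (*-identityˡ _)))) ⟩
    1# * f (B zero ∷ tail A) + c zero * f (x ∷ tail A)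
      ≈⟨ +-cong (*-identityˡ _) (trans (*-congˡ (f-x (x ∷ tail A) zero (λ k → refl))) (zeroʳ _)) ⟩
    f (B zero ∷ tail A) + 0# ≈⟨ +-identityʳ _ ⟩
    f (B zero ∷ tail A)
      ≈⟨ rows-modulo (∷-form alt (B zero)) x (λ A i → f-x (B zero ∷ A) (suc i)) (tail A) (tail B) (tail c) (λ i → A≈B+cx (suc i)) ⟩
    f (B zero ∷ tail B) ≈⟨ cong (λ { zero k → refl ; (suc i) k → refl }) ⟩
    f B ∎
    where open Alternating alt

  -- Row `j` passes each of the `toℕ j` rows above it by one swap.
  rotate : ∀ {n m} {f : Matrix (suc n) m → Carrier} → Alternating f →
           ∀ v j → f (v j ∷ v ∘ punchIn j) ≈ sign j * f v
  rotate alt v zero = trans (Alternating.cong alt (λ { zero k → refl ; (suc i) k → refl })) (sym (*-identityˡ _))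
  rotate {suc n} {f = f} alt v (suc j) = begin
    f (v (suc j) ∷ v ∘ punchIn (suc j))
      ≈⟨ cong (λ { zero k → refl ; (suc zero) k → refl ; (suc (suc i)) k → refl }) ⟩
    f (v (suc j) ∷ v zero ∷ tail v ∘ punchIn j)   ≈⟨ swap alt _ _ _ ⟩
    - f (v zero ∷ v (suc j) ∷ tail v ∘ punchIn j) ≈⟨ -‿cong (rotate (∷-form alt (v zero)) (tail v) j) ⟩
    - (sign j * f (v zero ∷ tail v))              ≈⟨ -‿cong (*-congˡ (cong λ { zero k → refl ; (suc i) k → refl })) ⟩
    - (sign j * f v)                              ≈⟨ -1*x≈-x _ ⟨
    - 1# * (sign j * f v)                         ≈⟨ *-assoc _ _ _ ⟨
    sign (suc j) * f v                            ∎
    where open Alternating alt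

  insertZero : ∀ {n} → Fin (suc n) → Row n → Row (suc n)
  insertZero         zero    x zero    = 0#
  insertZero         zero    x (suc k) = x k
  insertZero {suc n} (suc j) x zero    = x zero
  insertZero {suc n} (suc j) x (suc k) = insertZero j (tail x) k

  insertZero-cong : ∀ {n} j {x y : Row n} → x ≋ y → insertZero j x ≋ insertZero j y
  insertZero-cong         zero    x≋y zero    = refl
  insertZero-cong         zero    x≋y (suc k) = x≋y k
  insertZero-cong {suc n} (suc j) x≋y zero    = x≋y zero
  insertZero-cong {suc n} (suc j) x≋y (suc k) = insertZero-cong j (x≋y ∘ suc) k

  insertZero-linear : ∀ {n} j a b (y z : Row n) k →
    insertZero j (λ k → a * y k + b * z k) k ≈ a * insertZero j y k + b * insertZero j z k
  insertZero-linear         zero    a b y z zero    = sym (trans (+-cong (zeroʳ a) (zeroʳ b)) (+-identityˡ 0#))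
  insertZero-linear         zero    a b y z (suc k) = refl
  insertZero-linear {suc n} (suc j) a b y z zero    = refl
  insertZero-linear {suc n} (suc j) a b y z (suc k) = insertZero-linear j a b (tail y) (tail z) k

  insertZero-𝟙 : ∀ {n} j (i : Fin n) → insertZero j (𝟙 i) ≋ 𝟙 (punchIn j i)
  insertZero-𝟙 zero    i       zero    = refl
  insertZero-𝟙 zero    i       (suc k) = refl
  insertZero-𝟙 (suc j) zero    zero    = refl
  insertZero-𝟙 (suc j) zero    (suc k) = insertZero-0 j k
    where
    insertZero-0 : ∀ {n} j (k : Fin (suc n)) → insertZero {n} j (λ _ → 0#) k ≈ 0#
    insertZero-0         zero    zero    = refl
    insertZero-0         zero    (suc k) = refl
    insertZero-0 {suc n} (suc j) zero    = refl
    insertZero-0 {suc n} (suc j) (suc k) = insertZero-0 j k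
  insertZero-𝟙 (suc j) (suc i) zero    = refl
  insertZero-𝟙 (suc j) (suc i) (suc k) = insertZero-𝟙 j i k

  -- `insertZero j` is a linear section of the deletion of column `j`. This decomposition is the
  -- hypothesis of `rows-modulo` for the row `𝟙 j`.
  insertZero-punchIn : ∀ {n} j (x : Row (suc n)) k → x k ≈ insertZero j (x ∘ punchIn j) k + x j * 𝟙 j k
  insertZero-punchIn         zero    x zero    = sym (trans (+-identityˡ _) (*-identityʳ _))
  insertZero-punchIn         zero    x (suc k) = sym (trans (+-congˡ (zeroʳ _)) (+-identityʳ _))
  insertZero-punchIn {suc n} (suc j) x zero    = sym (trans (+-congˡ (zeroʳ _)) (+-identityʳ _))
  insertZero-punchIn {suc n} (suc j) x (suc k) = insertZero-punchIn j (tail x) k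

  record LinearRowMap {m m′} (L : Row m → Row m′) : Set (r ⊔ ℓ) where
    field
      L-cong   : ∀ {x y} → x ≋ y → L x ≋ L y
      L-linear : ∀ a b y z k → L (λ k → a * y k + b * z k) k ≈ a * L y k + b * L z k

  -- Inserting a zero column and multiplying on the right by a fixed matrix both act row by row, so
  -- this serves the uniqueness theorem and the product formula alike.
  compose-form : ∀ {n m m′} {f : Matrix n m′ → Carrier} {L : Row m → Row m′} →
                 Alternating f → LinearRowMap L → Alternating (λ A → f (λ i → L (A i)))
  compose-form alt lin = record
    { cong = λ A≈B → cong (λ i → L-cong (A≈B i))
    ; linear = λ {i} {a} {b} {A} {B} {C} comb → let open Combination comb in linear record
      { combined = λ k → trans (L-cong combined k) (L-linear a b (B i) (C i) k)
      ; elseˡ = λ j j≢i → L-cong (elseˡ j j≢i)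
      ; elseʳ = λ j j≢i → L-cong (elseʳ j j≢i) }
    ; alternating = λ i j j≡1+i Aᵢ≋Aⱼ → alternating i j j≡1+i (L-cong Aᵢ≋Aⱼ) }
    where
    open Alternating alt
    open LinearRowMap lin

  -- Every form obeys the expansion that defines `det`. Write the first row in the rows of `𝟙`; in
  -- the term of `𝟙 j`, clear column `j` below. What remains is a form in the rows of the minor, to
  -- which induction applies, and its value at `𝟙` is that of `f` at the identity with row `j` moved
  -- to the top, which explains the sign.
  alternating-unique : ∀ {n} {f : Matrix n n → Carrier} → Alternating f → ∀ A → f A ≈ det A * f 𝟙
  alternating-unique {zero}  alt A = trans (Alternating.cong alt (λ ())) (sym (*-identityˡ _))
  alternating-unique {suc n} {f} alt A = begin
    f A ≈⟨ cong (λ { zero k → sym (sum-*-𝟙 (A zero) k) ; (suc i) k → refl }) ⟩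
    f ((λ k → sum λ j → A zero j * 𝟙 j k) ∷ tail A) ≈⟨ head-sum alt (A zero) 𝟙 (tail A) ⟩
    sum (λ j → A zero j * f (𝟙 j ∷ tail A)) ≈⟨ sum-cong term ⟩
    sum (λ j → (sign j * (A zero j * det (minor j (tail A)))) * f 𝟙)
      ≈⟨ *-distribʳ-sum (f 𝟙) (λ j → sign j * (A zero j * det (minor j (tail A)))) ⟨
    det A * f 𝟙 ∎
    where
    open Alternating alt
    term : ∀ j → A zero j * f (𝟙 j ∷ tail A) ≈ (sign j * (A zero j * det (minor j (tail A)))) * f 𝟙
    term j = let d = det (minor j (tail A)) in begin
      A zero j * f (𝟙 j ∷ tail A)
        ≈⟨ *-congˡ (rows-modulo (∷-form alt (𝟙 j)) (𝟙 j) (head-repeated alt (𝟙 j)) (tail A)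
             (λ i → insertZero j (minor j (tail A) i)) (λ i → A (suc i) j) (λ i → insertZero-punchIn j (A (suc i)))) ⟩
      A zero j * f (𝟙 j ∷ λ i → insertZero j (minor j (tail A) i))
        ≈⟨ *-congˡ (alternating-unique (compose-form (∷-form alt (𝟙 j))
             (record { L-cong = insertZero-cong j ; L-linear = insertZero-linear j })) (minor j (tail A))) ⟩
      A zero j * (d * f (𝟙 j ∷ λ i → insertZero j (𝟙 i)))
        ≈⟨ *-congˡ (*-congˡ (trans (cong (λ { zero k → refl ; (suc i) k → insertZero-𝟙 j i k })) (rotate alt 𝟙 j))) ⟩
      A zero j * (d * (sign j * f 𝟙)) ≈⟨ *-assoc _ _ _ ⟨
      (A zero j * d) * (sign j * f 𝟙) ≈⟨ *-assoc _ _ _ ⟨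
      ((A zero j * d) * sign j) * f 𝟙 ≈⟨ *-congʳ (*-comm _ _) ⟩
      (sign j * (A zero j * d)) * f 𝟙 ∎

  -- For fixed B, the determinant of `A ⊠ B` is an alternating form in the rows of A with value
  -- `det B` at the identity.
  det-⊠ : ∀ {n} (A B : Matrix n n) → det (A ⊠ B) ≈ det A * det B
  det-⊠ A B = trans
    (alternating-unique (compose-form det-form (record { L-cong = L-cong ; L-linear = L-linear })) A)
    (*-congˡ (det-cong λ i k → sum-𝟙-* i (λ j → B j k)))
    where
    L : Row _ → Row _
    L x k = sum λ j → x j * B j k
    L-cong : ∀ {x y} → x ≋ y → L x ≋ L y
    L-cong x≋y k = sum-cong λ j → *-congʳ (x≋y j)
    L-linear : ∀ a b y z k → L (λ k → a * y k + b * z k) k ≈ a * L y k + b * L z k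
    L-linear a b y z k = trans
      (sum-cong λ j → trans (distribʳ (B j k) _ _) (+-cong (*-assoc _ _ _) (*-assoc _ _ _)))
      (sum-linear a b (λ j → y j * B j k) (λ j → z j * B j k))

  -- Triangular and block determinants

  det-first-row : ∀ {n} (A : Matrix (suc n) (suc n)) → (∀ j → A zero (suc j) ≈ 0#) →
                  det A ≈ A zero zero * det (minor zero (tail A))
  det-first-row A A₀ⱼ≈0 = trans
    (+-cong (*-identityˡ _) (sum-zero (λ j → sign (suc j) * (A zero (suc j) * det (minor (suc j) (tail A)))) λ j →
      trans (*-congˡ {x = sign (suc j)} (trans (*-congʳ (A₀ⱼ≈0 j)) (zeroˡ _))) (zeroʳ _)))
    (+-identityʳ _)

  -- The first term of the expansion contains the entry in the zero column; deleting any later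
  -- column leaves a minor that still begins with the zero column.
  det-zero-column : ∀ {n} (A : Matrix (suc n) (suc n)) → (∀ i → A i zero ≈ 0#) → det A ≈ 0#
  det-zero-column A Aᵢ₀≈0 = sum-zero (λ j → sign j * (A zero j * det (minor j (tail A)))) (term A Aᵢ₀≈0)
    where
    term : ∀ {n} (A : Matrix (suc n) (suc n)) → (∀ i → A i zero ≈ 0#) →
           ∀ j → sign j * (A zero j * det (minor j (tail A))) ≈ 0#
    term         A Aᵢ₀≈0 zero    = trans (*-identityˡ _) (trans (*-congʳ (Aᵢ₀≈0 zero)) (zeroˡ _))
    term {suc n} A Aᵢ₀≈0 (suc j) = trans
      (*-congˡ {x = sign (suc j)} (trans
        (*-congˡ (det-zero-column (minor (suc j) (tail A)) (λ i → Aᵢ₀≈0 (suc i)))) (zeroʳ _)))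
      (zeroʳ _)

  det-first-column : ∀ {n} (A : Matrix (suc n) (suc n)) → (∀ i → A (suc i) zero ≈ 0#) →
                     det A ≈ A zero zero * det (minor zero (tail A))
  det-first-column {n} A Aᵢ₀≈0 = trans
    (+-cong (*-identityˡ _) (sum-zero (λ j → sign (suc j) * (A zero (suc j) * det (minor (suc j) (tail A)))) term))
    (+-identityʳ _)
    where
    minor-zero : ∀ {n} (B : Matrix n (suc n)) → (∀ i → B i zero ≈ 0#) → ∀ j → det (minor (suc j) B) ≈ 0#
    minor-zero {suc n} B Bᵢ₀≈0 j = det-zero-column (minor (suc j) B) Bᵢ₀≈0
    term : ∀ j → sign (suc j) * (A zero (suc j) * det (minor (suc j) (tail A))) ≈ 0#
    term j = trans (*-congˡ {x = sign (suc j)} (trans (*-congˡ (minor-zero (tail A) Aᵢ₀≈0 j)) (zeroʳ _))) (zeroʳ _)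

  det-𝟙 : ∀ {n} → det (𝟙 {n}) ≈ 1#
  det-𝟙 {zero}  = refl
  det-𝟙 {suc n} = trans (det-first-row (𝟙 {suc n}) (λ j → refl)) (trans (*-identityˡ _) (det-𝟙 {n}))

  sum-+ : ∀ m {k} (f : Row (m ℕ.+ k)) → sum f ≈ sum (λ i → f (i ↑ˡ k)) + sum (λ j → f (m ↑ʳ j))
  sum-+ zero    f = sym (+-identityˡ _)
  sum-+ (suc m) f = trans (+-congˡ (sum-+ m (tail f))) (sym (+-assoc _ _ _))

  punchIn-↑ˡ : ∀ {m} k (j : Fin (suc m)) c → punchIn (j ↑ˡ k) (c ↑ˡ k) ≡ punchIn j c ↑ˡ k
  punchIn-↑ˡ k zero    c       = ≡.refl
  punchIn-↑ˡ k (suc j) zero    = ≡.refl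
  punchIn-↑ˡ k (suc j) (suc c) = ≡.cong suc (punchIn-↑ˡ k j c)

  punchIn-↑ʳ : ∀ m {k} (j : Fin (suc m)) (c : Fin k) → punchIn (j ↑ˡ k) (m ↑ʳ c) ≡ suc m ↑ʳ c
  punchIn-↑ʳ m       zero    c = ≡.refl
  punchIn-↑ʳ (suc m) (suc j) c = ≡.cong suc (punchIn-↑ʳ m j c)

  -- The first row vanishes outside the left block, so the expansion runs over columns of that block
  -- only, and deleting one of them preserves the block shape and the lower right block.
  det-lower-blocks : ∀ m {k} (X : Matrix (m ℕ.+ k) (m ℕ.+ k)) → (∀ i j → X (i ↑ˡ k) (m ↑ʳ j) ≈ 0#) →
    det X ≈ det (λ i j → X (i ↑ˡ k) (j ↑ˡ k)) * det (λ i j → X (m ↑ʳ i) (m ↑ʳ j))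
  det-lower-blocks zero    X X≈0 = sym (*-identityˡ _)
  det-lower-blocks (suc m) {k} X X≈0 = begin
    det X ≈⟨ sum-+ (suc m) T ⟩
    sum (λ j → T (j ↑ˡ k)) + sum (λ j → T (suc m ↑ʳ j))
      ≈⟨ +-cong (sum-cong left) (sum-zero (λ j → T (suc m ↑ʳ j)) right) ⟩
    sum (λ j → (sign j * (P zero j * det (minor j (tail P)))) * dQ) + 0#
      ≈⟨ +-identityʳ _ ⟩
    sum (λ j → (sign j * (P zero j * det (minor j (tail P)))) * dQ)
      ≈⟨ *-distribʳ-sum dQ (λ j → sign j * (P zero j * det (minor j (tail P)))) ⟨
    det P * dQ ∎
    where
    T : Fin (suc m ℕ.+ k) → Carrier
    T j = sign j * (X zero j * det (minor j (tail X)))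
    P = λ i j → X (i ↑ˡ k) (j ↑ˡ k)
    dQ = det (λ i j → X (suc m ↑ʳ i) (suc m ↑ʳ j))
    right : ∀ j → T (suc m ↑ʳ j) ≈ 0#
    right j = trans (*-congˡ {x = sign (suc m ↑ʳ j)} (trans (*-congʳ (X≈0 zero j)) (zeroˡ _))) (zeroʳ _)
    left : ∀ j → T (j ↑ˡ k) ≈ (sign j * (P zero j * det (minor j (tail P)))) * dQ
    left j = begin
      sign (j ↑ˡ k) * (P zero j * det (minor (j ↑ˡ k) (tail X)))
        ≈⟨ *-cong (reflexive (≡.cong ((- 1#) ^_) (Fin.toℕ-↑ˡ j k))) (*-congˡ (trans
             (det-lower-blocks m (minor (j ↑ˡ k) (tail X)) λ i c →
               trans (reflexive (≡.cong (X (suc i ↑ˡ k)) (punchIn-↑ʳ m j c))) (X≈0 (suc i) c))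
             (*-cong (det-cong λ i c → reflexive (≡.cong (X (suc i ↑ˡ k)) (punchIn-↑ˡ k j c)))
                     (det-cong λ i c → reflexive (≡.cong (X (suc m ↑ʳ i)) (punchIn-↑ʳ m j c)))))) ⟩
      sign j * (P zero j * (det (minor j (tail P)) * dQ)) ≈⟨ *-congˡ {x = sign j} (*-assoc _ _ _) ⟨
      sign j * ((P zero j * det (minor j (tail P))) * dQ) ≈⟨ *-assoc _ _ _ ⟨
      (sign j * (P zero j * det (minor j (tail P)))) * dQ ∎

  -- Here expansion must go by columns, which `det-first-column` allows only when nothing stands
  -- below the corner entry. An identity block provides such columns one after another.
  det-unit-upper-blocks : ∀ m {k} (X : Matrix (m ℕ.+ k) (m ℕ.+ k)) →
    (∀ i j → X (i ↑ˡ k) (j ↑ˡ k) ≈ 𝟙 i j) → (∀ i j → X (m ↑ʳ i) (j ↑ˡ k) ≈ 0#) →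
    det X ≈ det (λ i j → X (m ↑ʳ i) (m ↑ʳ j))
  det-unit-upper-blocks zero    X X≈𝟙 X≈0 = refl
  det-unit-upper-blocks (suc m) {k} X X≈𝟙 X≈0 = begin
    det X
      ≈⟨ det-first-column X (split-elim m (λ i → X≈𝟙 (suc i) zero) (λ i → X≈0 i zero)) ⟩
    X zero zero * det (minor zero (tail X))
      ≈⟨ *-cong (X≈𝟙 zero zero) (det-unit-upper-blocks m (minor zero (tail X))
           (λ i j → X≈𝟙 (suc i) (suc j)) (λ i j → X≈0 i (suc j))) ⟩
    1# * det (λ i j → X (suc m ↑ʳ i) (suc m ↑ʳ j)) ≈⟨ *-identityˡ _ ⟩
    det (λ i j → X (suc m ↑ʳ i) (suc m ↑ʳ j)) ∎
    where
    split-elim : ∀ m {k p} {P : Fin (m ℕ.+ k) → Set p} → (∀ i → P (i ↑ˡ k)) → (∀ j → P (m ↑ʳ j)) → ∀ i → P i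
    split-elim zero    l r i       = r i
    split-elim (suc m) l r zero    = l zero
    split-elim (suc m) {P = P} l r (suc i) = split-elim m {P = P ∘ suc} (l ∘ suc) r i

  sum-⊎ : ∀ m {k} (F : Fin m ⊎ Fin k → Carrier) →
          sum (λ i → F (splitAt m i)) ≈ sum (F ∘ inj₁) + sum (F ∘ inj₂)
  sum-⊎ m {k} F = trans (sum-+ m (λ i → F (splitAt m i)))
    (+-cong (sum-cong λ i → reflexive (≡.cong F (Fin.splitAt-↑ˡ m i k)))
            (sum-cong λ j → reflexive (≡.cong F (Fin.splitAt-↑ʳ m k j))))

  infixl 6 _⊞_
  _⊞_ : ∀ {n m} → Matrix n m → Matrix n m → Matrix n m
  (A ⊞ B) i j = A i j + B i j

  𝟘 : ∀ {n m} → Matrix n m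
  𝟘 i j = 0#

  𝟘-⊠ : ∀ {n m k} (A : Matrix m k) → 𝟘 {n} ⊠ A ≈ᴹ 𝟘
  𝟘-⊠ A i j = sum-zero (λ k → 0# * A k j) λ k → zeroˡ _

  ⊠-𝟘 : ∀ {n m k} (A : Matrix n m) → A ⊠ 𝟘 {m} {k} ≈ᴹ 𝟘
  ⊠-𝟘 A i j = sum-zero (λ k → A i k * 0#) λ k → zeroʳ _

  𝟙-⊠ : ∀ {n m} (A : Matrix n m) → 𝟙 ⊠ A ≈ᴹ A
  𝟙-⊠ A i j = sum-𝟙-* i (λ k → A k j)

  ⊠-𝟙 : ∀ {n m} (A : Matrix n m) → A ⊠ 𝟙 ≈ᴹ A
  ⊠-𝟙 A i j = sum-*-𝟙 (A i) j

  -- Indexing by sum types separates the case distinction from `splitAt`, so that the sums in a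
  -- product can be split before any case is known.
  entry : ∀ {n n′ m m′} → Matrix n m → Matrix n m′ → Matrix n′ m → Matrix n′ m′ →
          Fin n ⊎ Fin n′ → Fin m ⊎ Fin m′ → Carrier
  entry P Q S T (inj₁ i) (inj₁ j) = P i j
  entry P Q S T (inj₁ i) (inj₂ j) = Q i j
  entry P Q S T (inj₂ i) (inj₁ j) = S i j
  entry P Q S T (inj₂ i) (inj₂ j) = T i j

  blocks : ∀ {n n′ m m′} → Matrix n m → Matrix n m′ → Matrix n′ m → Matrix n′ m′ → Matrix (n ℕ.+ n′) (m ℕ.+ m′)
  blocks {n} {m = m} P Q S T i j = entry P Q S T (splitAt n i) (splitAt m j)

  module _ {n n′ m m′} (P : Matrix n m) (Q : Matrix n m′) (S : Matrix n′ m) (T : Matrix n′ m′) where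

    blocks-↑ˡ-↑ˡ : ∀ i j → blocks P Q S T (i ↑ˡ n′) (j ↑ˡ m′) ≡ P i j
    blocks-↑ˡ-↑ˡ i j rewrite Fin.splitAt-↑ˡ n i n′ | Fin.splitAt-↑ˡ m j m′ = ≡.refl

    blocks-↑ˡ-↑ʳ : ∀ i j → blocks P Q S T (i ↑ˡ n′) (m ↑ʳ j) ≡ Q i j
    blocks-↑ˡ-↑ʳ i j rewrite Fin.splitAt-↑ˡ n i n′ | Fin.splitAt-↑ʳ m m′ j = ≡.refl

    blocks-↑ʳ-↑ʳ : ∀ i j → blocks P Q S T (n ↑ʳ i) (m ↑ʳ j) ≡ T i j
    blocks-↑ʳ-↑ʳ i j rewrite Fin.splitAt-↑ʳ n n′ i | Fin.splitAt-↑ʳ m m′ j = ≡.refl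

  blocks-cong : ∀ {n n′ m m′} {P P′ : Matrix n m} {Q Q′ : Matrix n m′} {S S′ : Matrix n′ m} {T T′ : Matrix n′ m′} →
    P ≈ᴹ P′ → Q ≈ᴹ Q′ → S ≈ᴹ S′ → T ≈ᴹ T′ → blocks P Q S T ≈ᴹ blocks P′ Q′ S′ T′
  blocks-cong {n} {m = m} p q s t i j with splitAt n i | splitAt m j
  ... | inj₁ i | inj₁ j = p i j
  ... | inj₁ i | inj₂ j = q i j
  ... | inj₂ i | inj₁ j = s i j
  ... | inj₂ i | inj₂ j = t i j

  module _ {n n′ m m′ k k′} (P : Matrix n m) (Q : Matrix n m′) (S : Matrix n′ m) (T : Matrix n′ m′)
           (P′ : Matrix m k) (Q′ : Matrix m k′) (S′ : Matrix m′ k) (T′ : Matrix m′ k′) where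

    blocks-⊠ : blocks P Q S T ⊠ blocks P′ Q′ S′ T′ ≈ᴹ
      blocks (P ⊠ P′ ⊞ Q ⊠ S′) (P ⊠ Q′ ⊞ Q ⊠ T′) (S ⊠ P′ ⊞ T ⊠ S′) (S ⊠ Q′ ⊞ T ⊠ T′)
    blocks-⊠ i j = trans (sum-⊎ m (λ l → entry P Q S T (splitAt n i) l * entry P′ Q′ S′ T′ l (splitAt k j)))
                         (go (splitAt n i) (splitAt k j))
      where
      go : ∀ a b → sum (λ l → entry P Q S T a (inj₁ l) * entry P′ Q′ S′ T′ (inj₁ l) b) +
                   sum (λ l → entry P Q S T a (inj₂ l) * entry P′ Q′ S′ T′ (inj₂ l) b) ≈
           entry (P ⊠ P′ ⊞ Q ⊠ S′) (P ⊠ Q′ ⊞ Q ⊠ T′) (S ⊠ P′ ⊞ T ⊠ S′) (S ⊠ Q′ ⊞ T ⊠ T′) a b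
      go (inj₁ i) (inj₁ j) = refl
      go (inj₁ i) (inj₂ j) = refl
      go (inj₂ i) (inj₁ j) = refl
      go (inj₂ i) (inj₂ j) = refl

  det-blocks-diagonal : ∀ {n m} (P : Matrix n n) (T : Matrix m m) → det (blocks P 𝟘 𝟘 T) ≈ det P * det T
  det-blocks-diagonal {n} P T = trans
    (det-lower-blocks n (blocks P 𝟘 𝟘 T) (λ i j → reflexive (blocks-↑ˡ-↑ʳ P 𝟘 𝟘 T i j)))
    (*-cong (det-cong λ i j → reflexive (blocks-↑ˡ-↑ˡ P 𝟘 𝟘 T i j))
            (det-cong λ i j → reflexive (blocks-↑ʳ-↑ʳ P 𝟘 𝟘 T i j)))

  -- With W = ( 0 T ; T′ 0 ), which is an involution, diag(X , 1) W = W diag(1 , Y). This avoids having to know n = m.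
  det-intertwined : ∀ {n m} (X : Matrix n n) (Y : Matrix m m) (T : Matrix n m) (T′ : Matrix m n) →
    X ⊠ T ≈ᴹ T ⊠ Y → T ⊠ T′ ≈ᴹ 𝟙 → T′ ⊠ T ≈ᴹ 𝟙 → det X ≈ det Y
  det-intertwined {n} {m} X Y T T′ XT≈TY TT′≈𝟙 T′T≈𝟙 = begin
    det X                       ≈⟨ trans (*-congˡ (det-𝟙 {m})) (*-identityʳ _) ⟨
    det X * det (𝟙 {m})         ≈⟨ det-blocks-diagonal X (𝟙 {m}) ⟨
    det D                       ≈⟨ *-identityʳ _ ⟨
    -- No inverse of `det W` is at hand; its square is 1, so a second factor `det W` takes that
    -- role.
    det D * 1#                  ≈⟨ *-congˡ det-W² ⟨
    det D * (det W * det W)     ≈⟨ *-assoc _ _ _ ⟨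
    det D * det W * det W       ≈⟨ *-congʳ (trans (sym (det-⊠ D W)) (trans (det-cong DW≈WE) (det-⊠ W E))) ⟩
    det W * det E * det W       ≈⟨ *-assoc _ _ _ ⟩
    det W * (det E * det W)     ≈⟨ *-swap _ _ _ ⟩
    det E * (det W * det W)     ≈⟨ *-congˡ det-W² ⟩
    det E * 1#                  ≈⟨ *-identityʳ _ ⟩
    det E                       ≈⟨ det-blocks-diagonal (𝟙 {n}) Y ⟩
    det (𝟙 {n}) * det Y         ≈⟨ trans (*-congʳ (det-𝟙 {n})) (*-identityˡ _) ⟩
    det Y                       ∎
    where
    D W E : Matrix (n ℕ.+ m) (n ℕ.+ m)
    D = blocks X 𝟘 𝟘 𝟙
    W = blocks 𝟘 T T′ 𝟘
    E = blocks 𝟙 𝟘 𝟘 Y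

    zero+zero : ∀ {a b} → a ≈ 0# → b ≈ 0# → a + b ≈ 0#
    zero+zero p q = trans (+-cong p q) (+-identityˡ 0#)
    zero+ : ∀ {a b c} → a ≈ 0# → b ≈ c → a + b ≈ c
    zero+ p q = trans (+-cong p q) (+-identityˡ _)
    +zero : ∀ {a b c} → a ≈ c → b ≈ 0# → a + b ≈ c
    +zero p q = trans (+-cong p q) (+-identityʳ _)

    DW≈ : D ⊠ W ≈ᴹ blocks 𝟘 (X ⊠ T) T′ 𝟘
    DW≈ i j = trans (blocks-⊠ X 𝟘 𝟘 𝟙 𝟘 T T′ 𝟘 i j) (blocks-cong
      (λ i j → zero+zero (⊠-𝟘 X i j) (𝟘-⊠ T′ i j))
      (λ i j → +zero refl (𝟘-⊠ (𝟘 {m}) i j))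
      (λ i j → zero+ (𝟘-⊠ (𝟘 {n}) i j) (𝟙-⊠ T′ i j))
      (λ i j → zero+zero (𝟘-⊠ T i j) (⊠-𝟘 𝟙 i j)) i j)

    WE≈ : W ⊠ E ≈ᴹ blocks 𝟘 (T ⊠ Y) T′ 𝟘
    WE≈ i j = trans (blocks-⊠ 𝟘 T T′ 𝟘 𝟙 𝟘 𝟘 Y i j) (blocks-cong
      (λ i j → zero+zero (𝟘-⊠ 𝟙 i j) (⊠-𝟘 T i j))
      (λ i j → zero+ (𝟘-⊠ (𝟘 {n}) i j) refl)
      (λ i j → +zero (⊠-𝟙 T′ i j) (𝟘-⊠ (𝟘 {m}) i j))
      (λ i j → zero+zero (⊠-𝟘 T′ i j) (𝟘-⊠ Y i j)) i j)

    DW≈WE : D ⊠ W ≈ᴹ W ⊠ E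
    DW≈WE i j = trans (DW≈ i j) (trans
      (blocks-cong {P = 𝟘} {𝟘} {X ⊠ T} {T ⊠ Y} {T′} {T′} {𝟘} {𝟘} (λ _ _ → refl) XT≈TY (λ _ _ → refl) (λ _ _ → refl) i j)
      (sym (WE≈ i j)))

    W²≈ : W ⊠ W ≈ᴹ blocks (𝟙 {n}) 𝟘 𝟘 (𝟙 {m})
    W²≈ i j = trans (blocks-⊠ 𝟘 T T′ 𝟘 𝟘 T T′ 𝟘 i j) (blocks-cong
      (λ i j → zero+ (𝟘-⊠ (𝟘 {n}) i j) (TT′≈𝟙 i j))
      (λ i j → zero+zero (𝟘-⊠ T i j) (⊠-𝟘 T i j))
      (λ i j → zero+zero (⊠-𝟘 T′ i j) (𝟘-⊠ T′ i j))
      (λ i j → +zero (T′T≈𝟙 i j) (𝟘-⊠ (𝟘 {m}) i j)) i j)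

    det-W² : det W * det W ≈ 1#
    det-W² = begin
      det W * det W                ≈⟨ det-⊠ W W ⟨
      det (W ⊠ W)                  ≈⟨ det-cong W²≈ ⟩
      det (blocks (𝟙 {n}) 𝟘 𝟘 (𝟙 {m})) ≈⟨ det-blocks-diagonal (𝟙 {n}) (𝟙 {m}) ⟩
      det (𝟙 {n}) * det (𝟙 {m})    ≈⟨ *-cong (det-𝟙 {n}) (det-𝟙 {m}) ⟩
      1# * 1#                      ≈⟨ *-identityˡ 1# ⟩
      1#                           ∎

  sum-* : ∀ n {m} (F : Fin n × Fin m → Carrier) → sum (λ p → F (remQuot {n} m p)) ≈ sum (λ i → sum λ k → F (i , k))
  sum-* zero        F = refl
  sum-* (suc n) {m} F = begin
    sum (λ p → F (remQuot {suc n} m p)) ≈⟨ sum-+ m (λ p → F (remQuot {suc n} m p)) ⟩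
    sum (λ k → F (remQuot {suc n} m (k ↑ˡ (n ℕ.* m)))) + sum (λ p → F (remQuot {suc n} m (m ↑ʳ p)))
      ≈⟨ +-cong (sum-cong λ k → reflexive (≡.cong F (Fin.remQuot-combine {suc n} {m} zero k)))
                (sum-cong λ p → reflexive (≡.cong F (remQuot-↑ʳ {n} m p))) ⟩
    sum (λ k → F (zero , k)) + sum (λ p → F (map₁ suc (remQuot {n} m p)))
      ≈⟨ +-congˡ (sum-* n (F ∘ map₁ suc)) ⟩
    sum (λ i → sum λ k → F (i , k)) ∎

  -- The block number is the outer index: for `suc n` blocks the index set unfolds to m + n m, which
  -- exposes the first block row and column.
  flatten : ∀ {n n′ m m′} → (Fin n → Fin n′ → Matrix m m′) → Matrix (n ℕ.* m) (n′ ℕ.* m′)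
  flatten {n} {n′} {m} {m′} A p q =
    let (i , k) = remQuot {n} m p ; (j , l) = remQuot {n′} m′ q in A i j k l

  flatten-cong : ∀ {n m} {A B : Fin n → Fin n → Matrix m m} → (∀ i j → A i j ≈ᴹ B i j) → flatten A ≈ᴹ flatten B
  flatten-cong A≈B p q = A≈B _ _ _ _

  flatten-⊠ : ∀ {n m} (A B : Fin n → Fin n → Matrix m m) →
    flatten A ⊠ flatten B ≈ᴹ flatten (λ i j k l → sum λ h → (A i h ⊠ B h j) k l)
  flatten-⊠ {n} {m} A B p q =
    let (i , k) = remQuot {n} m p ; (j , l) = remQuot {n} m q in sum-* n (λ (h , o) → A i h k o * B h j o l)

-- Block matrices obtained from a matrix representation of the entries

Homomorphism : ∀ {r ℓ s ℓs} (R : CommutativeRing r ℓ) (S : CommutativeRing s ℓs) →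
               (CommutativeRing.Carrier R → CommutativeRing.Carrier S) → Set (r ⊔ ℓ ⊔ ℓs)
Homomorphism R S = RingMorphisms.IsRingHomomorphism (CommutativeRing.rawRing R) (CommutativeRing.rawRing S)

module HomomorphismProperties {r ℓ s ℓs : Level} {R : CommutativeRing r ℓ} {S : CommutativeRing s ℓs}
  {φ : CommutativeRing.Carrier R → CommutativeRing.Carrier S} (hom : Homomorphism R S φ) where
  private
    module R = CommutativeRing R
    module S = CommutativeRing S
    module DR = Determinants R
    module DS = Determinants S
    module ΣR = SemiringSum R.semiring
    module ΣS = SemiringSum S.semiring
  open RingMorphisms.IsRingHomomorphism hom
  open SemiringExp R.semiring using () renaming (_^_ to _^R_)
  open SemiringExp S.semiring using () renaming (_^_ to _^S_)

  sum-homo : ∀ {n} (f : Fin n → R.Carrier) → φ (ΣR.sum f) S.≈ ΣS.sum (φ ∘ f)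
  sum-homo {zero}  f = 0#-homo
  sum-homo {suc n} f = S.trans (+-homo _ _) (S.+-congˡ (sum-homo (tail f)))

  -1^-homo : ∀ n → φ ((R.- R.1#) ^R n) S.≈ (S.- S.1#) ^S n
  -1^-homo zero    = 1#-homo
  -1^-homo (suc n) = S.trans (*-homo _ _) (S.*-cong (S.trans (-‿homo _) (S.-‿cong 1#-homo)) (-1^-homo n))

  det-homo : ∀ {n} (A : DR.Matrix n n) → φ (DR.det A) S.≈ DS.det (λ i j → φ (A i j))
  det-homo {zero}  A = 1#-homo
  det-homo {suc n} A = S.trans
    (sum-homo (λ j → DR.sign j R.* (A zero j R.* DR.det (DR.minor j (tail A)))))
    (DS.sum-cong λ j → S.trans (*-homo _ _) (S.*-cong (-1^-homo (toℕ j))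
      (S.trans (*-homo (A zero j) _) (S.*-congˡ {x = φ (A zero j)} (det-homo (DR.minor j (tail A)))))))

  𝟙-homo : ∀ {n} (i j : Fin n) → φ (DR.𝟙 i j) S.≈ DS.𝟙 i j
  𝟙-homo zero    zero    = 1#-homo
  𝟙-homo zero    (suc j) = 0#-homo
  𝟙-homo (suc i) zero    = 0#-homo
  𝟙-homo (suc i) (suc j) = 𝟙-homo i j

record MatrixRepresentation {r ℓ s ℓs} (S : CommutativeRing s ℓs) (R : CommutativeRing r ℓ) (m : ℕ)
                            : Set (r ⊔ ℓ ⊔ s ⊔ ℓs) where
  private module S = CommutativeRing S
  open Determinants R
  field
    ρ      : S.Carrier → Matrix m m
    ρ-cong : ∀ {a b} → a S.≈ b → ρ a ≈ᴹ ρ b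
    ρ-+    : ∀ a b → ρ (a S.+ b) ≈ᴹ ρ a ⊞ ρ b
    ρ-*    : ∀ a b → ρ (a S.* b) ≈ᴹ ρ a ⊠ ρ b
    ρ-0    : ρ S.0# ≈ᴹ 𝟘
    ρ-1    : ρ S.1# ≈ᴹ 𝟙

module _ {r ℓ s ℓs t ℓt : Level} {S : CommutativeRing s ℓs} {R : CommutativeRing r ℓ} {m : ℕ}
  (rep : MatrixRepresentation S R m)
  {T : CommutativeRing t ℓt} {ε : CommutativeRing.Carrier S → CommutativeRing.Carrier T} (ε-hom : Homomorphism S T ε)
  where
  private
    module S = CommutativeRing S
    module R = CommutativeRing R
    module T = CommutativeRing T
    module DS = Determinants S
    module DR = Determinants R
    module DT = Determinants T
    module ΣS = SemiringSum S.semiring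
    module ΣR = SemiringSum R.semiring
    module ε = RingMorphisms.IsRingHomomorphism ε-hom
    module εH = HomomorphismProperties {R = S} {S = T} ε-hom
  open MatrixRepresentation rep
  open RingProperties S.ring using (-‿distribʳ-*)

  -- The two sides of the comparison: substitute matrices for the entries and take one large
  -- determinant, or take the determinant over S and then its norm det ∘ ρ.
  Φ Ψ : ∀ {n} → DS.Matrix n n → R.Carrier
  Φ A = DR.det (DR.flatten (λ i j → ρ (A i j)))
  Ψ A = DR.det (ρ (DS.det A))

  Φ-cong : ∀ {n} {A B : DS.Matrix n n} → A DS.≈ᴹ B → Φ A R.≈ Φ B
  Φ-cong {n} A≈B = DR.det-cong (DR.flatten-cong {n} λ i j → ρ-cong (A≈B i j))

  Ψ-cong : ∀ {n} {A B : DS.Matrix n n} → A DS.≈ᴹ B → Ψ A R.≈ Ψ B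
  Ψ-cong A≈B = DR.det-cong (ρ-cong (DS.det-cong A≈B))

  ρ-sum : ∀ {n} (f : Fin n → S.Carrier) k l → ρ (ΣS.sum f) k l R.≈ ΣR.sum (λ i → ρ (f i) k l)
  ρ-sum {zero}  f k l = ρ-0 k l
  ρ-sum {suc n} f k l = R.trans (ρ-+ _ _ k l) (R.+-congˡ (ρ-sum (tail f) k l))

  Φ-⊠ : ∀ {n} (A B : DS.Matrix n n) → Φ (A DS.⊠ B) R.≈ Φ A R.* Φ B
  Φ-⊠ {n} A B = R.trans
    (DR.det-cong λ p q → R.trans
      (DR.flatten-cong {n} {A = λ i j → ρ ((A DS.⊠ B) i j)}
        {B = λ i j k l → ΣR.sum λ h → (ρ (A i h) DR.⊠ ρ (B h j)) k l}
        (λ i j k l → R.trans (ρ-sum (λ h → A i h S.* B h j) k l) (DR.sum-cong λ h → ρ-* (A i h) (B h j) k l)) p q)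
      (R.sym (DR.flatten-⊠ {n} (λ i j → ρ (A i j)) (λ i j → ρ (B i j)) p q)))
    (DR.det-⊠ (DR.flatten (λ i j → ρ (A i j))) (DR.flatten (λ i j → ρ (B i j))))

  det-ρ-* : ∀ a b → DR.det (ρ (a S.* b)) R.≈ DR.det (ρ a) R.* DR.det (ρ b)
  det-ρ-* a b = R.trans (DR.det-cong (ρ-* a b)) (DR.det-⊠ (ρ a) (ρ b))

  Ψ-⊠ : ∀ {n} (A B : DS.Matrix n n) → Ψ (A DS.⊠ B) R.≈ Ψ A R.* Ψ B
  Ψ-⊠ A B = R.trans (DR.det-cong (ρ-cong (DS.det-⊠ A B))) (det-ρ-* (DS.det A) (DS.det B))

  private
    flatten-entry : ∀ {n} (A : DS.Matrix n n) {p q i j k l} →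
      remQuot {n} m p ≡ (i , k) → remQuot {n} m q ≡ (j , l) →
      DR.flatten (λ i j → ρ (A i j)) p q R.≈ ρ (A i j) k l
    flatten-entry A p≡ik q≡jl = R.reflexive (≡.cong₂ (λ (i , k) (j , l) → ρ (A i j) k l) p≡ik q≡jl)

    module _ {n} (A : DS.Matrix (suc n) (suc n)) where

      ρA : DR.Matrix (m ℕ.+ n ℕ.* m) (m ℕ.+ n ℕ.* m)
      ρA = DR.flatten (λ i j → ρ (A i j))

      entry-ˡˡ : ∀ k l → ρA (k ↑ˡ (n ℕ.* m)) (l ↑ˡ (n ℕ.* m)) R.≈ ρ (A zero zero) k l
      entry-ˡˡ k l = flatten-entry A (Fin.remQuot-combine {suc n} zero k) (Fin.remQuot-combine {suc n} zero l)

      entry-ˡʳ : ∀ k q → let (j , l) = remQuot {n} m q in ρA (k ↑ˡ (n ℕ.* m)) (m ↑ʳ q) R.≈ ρ (A zero (suc j)) k l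
      entry-ˡʳ k q = flatten-entry A (Fin.remQuot-combine {suc n} zero k) (remQuot-↑ʳ {n} m q)

      entry-ʳˡ : ∀ p l → let (i , k) = remQuot {n} m p in ρA (m ↑ʳ p) (l ↑ˡ (n ℕ.* m)) R.≈ ρ (A (suc i) zero) k l
      entry-ʳˡ p l = flatten-entry A (remQuot-↑ʳ {n} m p) (Fin.remQuot-combine {suc n} zero l)

      entry-ʳʳ : ∀ p q → ρA (m ↑ʳ p) (m ↑ʳ q) R.≈ DR.flatten (λ i j → ρ (A (suc i) (suc j))) p q
      entry-ʳʳ p q = flatten-entry A (remQuot-↑ʳ {n} m p) (remQuot-↑ʳ {n} m q)

      Φ-first-row : (∀ j → A zero (suc j) S.≈ S.0#) →
        Φ A R.≈ DR.det (ρ (A zero zero)) R.* Φ (λ i j → A (suc i) (suc j))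
      Φ-first-row A₀ⱼ≈0 = R.trans
        (DR.det-lower-blocks m ρA (λ k q → R.trans (entry-ˡʳ k q) (R.trans (ρ-cong (A₀ⱼ≈0 _) _ _) (ρ-0 _ _))))
        (R.*-cong (DR.det-cong entry-ˡˡ) (DR.det-cong entry-ʳʳ))

      Φ-first-column : A zero zero S.≈ S.1# → (∀ i → A (suc i) zero S.≈ S.0#) → Φ A R.≈ Φ (λ i j → A (suc i) (suc j))
      Φ-first-column A₀₀≈1 Aᵢ₀≈0 = R.trans
        (DR.det-unit-upper-blocks m ρA
          (λ k l → R.trans (entry-ˡˡ k l) (R.trans (ρ-cong A₀₀≈1 k l) (ρ-1 k l)))
          (λ p l → R.trans (entry-ʳˡ p l) (R.trans (ρ-cong (Aᵢ₀≈0 _) _ _) (ρ-0 _ _))))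
        (DR.det-cong entry-ʳʳ)

  -- With pivot a = A₀₀ and A = ( a b ; c D ), one has A ( 1 -b ; 0 a ) = ( a 0 ; c aD - cb ), and both Φ and Ψ are
  -- multiplicative; the factor introduced by a is cancelled.
  det-flatten : (∀ a → ε a T.≈ T.1# → ∀ x y → x R.* DR.det (ρ a) R.≈ y R.* DR.det (ρ a) → x R.≈ y) →
    ∀ n (A : DS.Matrix n n) → (∀ i j → ε (A i j) T.≈ DT.𝟙 i j) → Φ A R.≈ Ψ A
  det-flatten cancel zero    A εA≈𝟙 = R.sym (R.trans (DR.det-cong ρ-1) (DR.det-𝟙 {m}))
  det-flatten cancel (suc n) A εA≈𝟙 = cancel (DS.det aI) ε-det-aI (Φ A) (Ψ A) (let open SetoidReasoning R.setoid in begin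
    -- The induction hypothesis is used twice, for the scalar matrix `aI` and for the complement
    -- `C`. The first use gives the extra factor the same form `Ψ aI` on both sides, so that it can
    -- be cancelled; both matrices reduce to the identity under `ε`.
    Φ A R.* Ψ aI                    ≈⟨ R.*-congˡ (det-flatten cancel n aI ε-aI) ⟨
    Φ A R.* Φ aI                    ≈⟨ R.*-congˡ (Φ-first-column U S.refl (λ i → S.refl)) ⟨
    Φ A R.* Φ U                     ≈⟨ Φ-⊠ A U ⟨
    Φ (A DS.⊠ U)                    ≈⟨ Φ-cong AU≈L ⟩
    Φ L                             ≈⟨ Φ-first-row L (λ j → S.refl) ⟩
    DR.det (ρ a) R.* Φ C            ≈⟨ R.*-congˡ (det-flatten cancel n C ε-C) ⟩
    DR.det (ρ a) R.* Ψ C            ≈⟨ det-ρ-* a (DS.det C) ⟨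
    DR.det (ρ (a S.* DS.det C))     ≈⟨ DR.det-cong (ρ-cong (DS.det-first-row L (λ j → S.refl))) ⟨
    Ψ L                             ≈⟨ Ψ-cong AU≈L ⟨
    Ψ (A DS.⊠ U)                    ≈⟨ Ψ-⊠ A U ⟩
    Ψ A R.* Ψ U
      ≈⟨ R.*-congˡ (DR.det-cong (ρ-cong (S.trans (DS.det-first-column U (λ i → S.refl)) (S.*-identityˡ _)))) ⟩
    Ψ A R.* Ψ aI                    ∎)
    where
    a = A zero zero

    aI C : DS.Matrix n n
    aI i j = a S.* DS.𝟙 i j
    C i j = A (suc i) (suc j) S.* a S.- A (suc i) zero S.* A zero (suc j)

    U L : DS.Matrix (suc n) (suc n)
    U zero    zero    = S.1#
    U zero    (suc j) = S.- A zero (suc j)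
    U (suc i) zero    = S.0#
    U (suc i) (suc j) = aI i j
    L zero    zero    = a
    L zero    (suc j) = S.0#
    L (suc i) zero    = A (suc i) zero
    L (suc i) (suc j) = C i j

    column : ∀ i j → (A DS.⊠ U) i (suc j) S.≈ A i (suc j) S.* a S.- A i zero S.* A zero (suc j)
    column i j = let open SetoidReasoning S.setoid in begin
      A i zero S.* S.- A zero (suc j) S.+ ΣS.sum (λ k → A i (suc k) S.* (a S.* DS.𝟙 k j))
        ≈⟨ S.+-cong (S.sym (-‿distribʳ-* _ _)) (S.trans (DS.sum-cong (λ k → S.sym (S.*-assoc (A i (suc k)) a (DS.𝟙 k j))))
             (DS.sum-*-𝟙 (λ k → A i (suc k) S.* a) j)) ⟩
      S.- (A i zero S.* A zero (suc j)) S.+ A i (suc j) S.* a ≈⟨ S.+-comm _ _ ⟩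
      A i (suc j) S.* a S.- A i zero S.* A zero (suc j) ∎

    first : ∀ i → (A DS.⊠ U) i zero S.≈ A i zero
    first i = S.trans (S.+-cong (S.*-identityʳ _) (DS.sum-zero (λ k → A i (suc k) S.* S.0#) (λ k → S.zeroʳ _)))
      (S.+-identityʳ _)

    AU≈L : (A DS.⊠ U) DS.≈ᴹ L
    AU≈L zero    zero    = first zero
    AU≈L zero    (suc j) = S.trans (column zero j) (S.trans (S.+-congʳ (S.*-comm _ _)) (S.-‿inverseʳ _))
    AU≈L (suc i) zero    = first (suc i)
    AU≈L (suc i) (suc j) = column (suc i) j

    ε-aI : ∀ i j → ε (aI i j) T.≈ DT.𝟙 i j
    ε-aI i j = T.trans (ε.*-homo _ _) (T.trans (T.*-cong (εA≈𝟙 zero zero) (εH.𝟙-homo i j)) (T.*-identityˡ _))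

    ε-det-aI : ε (DS.det aI) T.≈ T.1#
    ε-det-aI = T.trans (εH.det-homo aI) (T.trans (DT.det-cong ε-aI) (DT.det-𝟙 {n}))

    ε-C : ∀ i j → ε (C i j) T.≈ DT.𝟙 i j
    ε-C i j = let open SetoidReasoning T.setoid in begin
      ε (C i j) ≈⟨ ε.+-homo _ _ ⟩
      ε (A (suc i) (suc j) S.* a) T.+ ε (S.- (A (suc i) zero S.* A zero (suc j)))
        ≈⟨ T.+-cong (ε.*-homo _ _) (T.trans (ε.-‿homo _) (T.-‿cong (ε.*-homo _ _))) ⟩
      ε (A (suc i) (suc j)) T.* ε a T.- ε (A (suc i) zero) T.* ε (A zero (suc j))
        ≈⟨ T.+-cong (T.*-cong (εA≈𝟙 (suc i) (suc j)) (εA≈𝟙 zero zero))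
             (T.-‿cong (T.*-cong (εA≈𝟙 (suc i) zero) (εA≈𝟙 zero (suc j)))) ⟩
      DT.𝟙 i j T.* T.1# T.- T.0# T.* T.0# ≈⟨ T.+-cong (T.*-identityʳ _) (T.-‿cong (T.zeroˡ _)) ⟩
      DT.𝟙 i j T.- T.0# ≈⟨ T.+-congˡ (RingProperties.-0#≈0# T.ring) ⟩
      DT.𝟙 i j T.+ T.0# ≈⟨ T.+-identityʳ _ ⟩
      DT.𝟙 i j ∎

-- Polynomial rings

module Polynomials {r ℓ : Level} (R : CommutativeRing r ℓ) where
  open CommutativeRing R hiding (zero)
  open RingProperties ring using (+-cancelʳ)
  open PolynomialRing R using (constant; constantCoeff; ∗-constantˡ; ∗-constantʳ; ∗-cong) public
  private
    module R[u] = CommutativeRing (polynomialRing R)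
    module ΣR = SemiringSum semiring
    module ΣR[u] = SemiringSum R[u].semiring
    _∗_ = cauchyProduct _*_ _+_

  coeff-sum : ∀ {m} (f : Fin m → R[u].Carrier) n → coeff (ΣR[u].sum f) n ≈ ΣR.sum (λ i → coeff (f i) n)
  coeff-sum {zero}  f n = refl
  coeff-sum {suc m} f n = +-congˡ (coeff-sum (tail f) n)

  constantCoeff-hom : Homomorphism (polynomialRing R) R (λ p → coeff p 0)
  constantCoeff-hom = record
    { isSemiringHomomorphism = record
      { isNearSemiringHomomorphism = record
        { +-isMonoidHomomorphism = record
          { isMagmaHomomorphism = record
            { isRelHomomorphism = record { cong = λ p≈q → p≈q 0 }
            ; homo = λ _ _ → refl }
          ; ε-homo = refl }
        ; *-homo = λ _ _ → refl }
      ; 1#-homo = refl }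
    ; -‿homo = λ _ → refl }

  constantCoeff-0 : ∀ n → constantCoeff 0# n ≈ 0#
  constantCoeff-0 zero    = refl
  constantCoeff-0 (suc n) = refl

  constant-hom : Homomorphism R (polynomialRing R) constant
  constant-hom = record
    { isSemiringHomomorphism = record
      { isNearSemiringHomomorphism = record
        { +-isMonoidHomomorphism = record
          { isMagmaHomomorphism = record
            { isRelHomomorphism = record { cong = λ { x≈y zero → x≈y ; x≈y (suc n) → refl } }
            ; homo = λ { x y zero → refl ; x y (suc n) → sym (+-identityˡ 0#) } }
          ; ε-homo = constantCoeff-0 }
        ; *-homo = λ { x y zero → refl
                     ; x y (suc n) → sym (trans (∗-constantˡ x (constantCoeff y) (suc n)) (zeroʳ x)) } }
      ; 1#-homo = λ n → refl }
    ; -‿homo = λ { x zero → refl ; x (suc n) → sym (RingProperties.-0#≈0# ring) } }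

  ∗-cong-≤ : ∀ f {g h} n → (∀ i → i ℕ.≤ n → g i ≈ h i) → (f ∗ g) n ≈ (f ∗ h) n
  ∗-cong-≤ f zero    g≈h = *-congˡ (g≈h 0 z≤n)
  ∗-cong-≤ f (suc n) g≈h = +-cong (*-congˡ (g≈h (suc n) ℕ.≤-refl))
    (∗-cong-≤ (f ∘ suc) n (λ i i≤n → g≈h i (ℕ.m≤n⇒m≤1+n i≤n)))

  -- Such a `p` would be invertible among power series; coefficients of x and y are compared in
  -- increasing degree.
  *-cancelˡ-unit : ∀ p → coeff p 0 ≈ 1# → ∀ x y → p R[u].* x R[u].≈ p R[u].* y → x R[u].≈ y
  *-cancelˡ-unit p p₀≈1 x y px≈py n = go n n ℕ.≤-refl
    where
    cancel-p₀ : ∀ {a b} → coeff p 0 * a ≈ coeff p 0 * b → a ≈ b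
    cancel-p₀ p₀a≈p₀b = trans (sym (trans (*-congʳ p₀≈1) (*-identityˡ _)))
      (trans p₀a≈p₀b (trans (*-congʳ p₀≈1) (*-identityˡ _)))
    go : ∀ n i → i ℕ.≤ n → coeff x i ≈ coeff y i
    go zero    zero z≤n = cancel-p₀ (px≈py 0)
    go (suc n) i i≤1+n with ℕ.m≤n⇒m<n∨m≡n i≤1+n
    ... | inj₁ (s≤s i≤n) = go n i i≤n
    -- In degree `suc n` the product is the constant coefficient of `p` times the top coefficient,
    -- plus a sum over coefficients of degree at most n, which agree by `go n`.
    ... | inj₂ ≡.refl = cancel-p₀ (+-cancelʳ _ _ _
      (trans (px≈py (suc n)) (+-congˡ (sym (∗-cong-≤ (coeff p ∘ suc) n (go n))))))

  *-cancelʳ-unit : ∀ p → coeff p 0 ≈ 1# → ∀ x y → x R[u].* p R[u].≈ y R[u].* p → x R[u].≈ y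
  *-cancelʳ-unit p p₀≈1 x y xp≈yp = *-cancelˡ-unit p p₀≈1 x y
    (R[u].trans {p R[u].* x} {x R[u].* p} {p R[u].* y} (R[u].*-comm p x)
      (R[u].trans {x R[u].* p} {y R[u].* p} {p R[u].* y} xp≈yp (R[u].*-comm y p)))

module _ {r ℓ s ℓs : Level} {S : CommutativeRing s ℓs} {R : CommutativeRing r ℓ} {m : ℕ}
         (rep : MatrixRepresentation S R m) where
  private
    module S = CommutativeRing S
    module R = CommutativeRing R
    module S[u] = CommutativeRing (polynomialRing S)
    module R[u] = CommutativeRing (polynomialRing R)
    module PS = Polynomials S
    module PR = Polynomials R
    module DR = Determinants R
    module DS = Determinants S
    module DR[u] = Determinants (polynomialRing R)
    module DS[u] = Determinants (polynomialRing S)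
    module ΣR = SemiringSum R.semiring
    _∗S_ = cauchyProduct S._*_ S._+_
    _∗R_ = cauchyProduct R._*_ R._+_
  open MatrixRepresentation rep

  ρ[u] : S[u].Carrier → DR[u].Matrix m m
  ρ[u] p k l = record
    { coeff    = λ n → ρ (coeff p n) k l
    ; bound    = bound p
    ; vanishes = λ n b≤n → R.trans (ρ-cong (vanishes p n b≤n) k l) (ρ-0 k l) }

  ρ-∗ : ∀ f g n k l → ρ ((f ∗S g) n) k l R.≈
        ΣR.sum (λ h → ((λ i → ρ (f i) k h) ∗R (λ i → ρ (g i) h l)) n)
  ρ-∗ f g zero    k l = ρ-* (f 0) (g 0) k l
  ρ-∗ f g (suc n) k l = R.trans (ρ-+ _ _ k l) (R.trans
    (R.+-cong (ρ-* (f 0) (g (suc n)) k l) (ρ-∗ (f ∘ suc) g n k l))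
    (R.sym (ΣR.∑-distrib-+ (λ h → ρ (f 0) k h R.* ρ (g (suc n)) h l)
      (λ h → ((λ i → ρ (f (suc i)) k h) ∗R (λ i → ρ (g i) h l)) n))))

  polynomialRepresentation : MatrixRepresentation (polynomialRing S) (polynomialRing R) m
  polynomialRepresentation = record
    { ρ = ρ[u]
    ; ρ-cong = λ p≈q k l n → ρ-cong (p≈q n) k l
    ; ρ-+ = λ p q k l n → ρ-+ (coeff p n) (coeff q n) k l
    ; ρ-* = λ p q k l n → R.trans (ρ-∗ (coeff p) (coeff q) n k l)
        (R.sym (PR.coeff-sum (λ h → ρ[u] p k h R[u].* ρ[u] q h l) n))
    ; ρ-0 = λ k l n → ρ-0 k l
    ; ρ-1 = λ { k l zero → R.trans (ρ-1 k l) (R.sym (𝟙₀ k l))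
              ; k l (suc n) → R.trans (ρ-0 k l) (R.sym (𝟙₁₊ k l n)) } }
    where
    𝟙₀ : ∀ {m} (k l : Fin m) → coeff (DR[u].𝟙 k l) 0 R.≈ DR.𝟙 k l
    𝟙₀ = HomomorphismProperties.𝟙-homo {R = polynomialRing R} {S = R} PR.constantCoeff-hom
    𝟙₁₊ : ∀ {m} (k l : Fin m) n → coeff (DR[u].𝟙 k l) (suc n) R.≈ R.0#
    𝟙₁₊ zero    zero    n = R.refl
    𝟙₁₊ zero    (suc l) n = R.refl
    𝟙₁₊ (suc k) zero    n = R.refl
    𝟙₁₊ (suc k) (suc l) n = 𝟙₁₊ k l n

  -- The reduction is u = 0. If p has constant coefficient 1, then `ρ[u] p` is the identity at u =
  -- 0, so its determinant has constant coefficient 1 and can be cancelled.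
  det-flatten[u] : ∀ n (A : DS[u].Matrix n n) → (∀ i j → coeff (A i j) 0 S.≈ DS.𝟙 i j) →
    DR[u].det (DR[u].flatten (λ i j → ρ[u] (A i j))) R[u].≈ DR[u].det (ρ[u] (DS[u].det A))
  det-flatten[u] = det-flatten polynomialRepresentation {T = S} PS.constantCoeff-hom λ p p₀≈1 →
    PR.*-cancelʳ-unit (DR[u].det (ρ[u] p)) (R.trans
      (HomomorphismProperties.det-homo {R = polynomialRing R} {S = R} PR.constantCoeff-hom (ρ[u] p))
      (R.trans (DR.det-cong (λ k l → R.trans (ρ-cong p₀≈1 k l) (ρ-1 k l))) (DR.det-𝟙 {m})))

-- Equivariant maps of permutation modules

module _ {g ℓg s ℓs : Level} (K : FiniteAbelianGroup g ℓg) {S : Setoid s ℓs} (α : Action K S) where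
  private
    module K = FiniteAbelianGroup K
    module S = Setoid S
  open Action α

  -- `distinct` states two things at once: different representatives lie in different orbits, and
  -- stabilisers of representatives are trivial.
  record Transversal (p : ℕ) : Set (g ⊔ ℓg ⊔ s ⊔ ℓs) where
    field
      rep      : Fin p → S.Carrier
      cover    : ∀ x → ∃ λ i → ∃ λ k → k · rep i S.≈ x
      distinct : ∀ {i j k l} → k · rep i S.≈ l · rep j → i ≡ j × k K.≈ l

  orbitTransversal : (fin : Finite S) → IsFree → Transversal (Finite.size (orbits-finite fin))
  orbitTransversal fin free = record
    { rep      = O.elem
    ; cover    = λ x → O.index x , O.elem-index x
    ; distinct = λ {i} {j} {k} {l} kx≈ly →
        let l⁻¹kx≈y = S.trans (·-assoc _ _ _) (S.trans (·-cong K.refl kx≈ly) (·-inverseˡ l _))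
            i≡j = ≡.trans (≡.sym (O.index-elem i)) (≡.trans (O.index-cong (l K.⁻¹ K.∙ k , l⁻¹kx≈y)) (O.index-elem j))
        in i≡j , same i≡j l⁻¹kx≈y }
    where
    module O = Finite (orbits-finite fin)
    open AbelianGroupProperties K.abelianGroup using (inverseʳ-unique; ⁻¹-involutive)
    same : ∀ {i j k l} → i ≡ j → (l K.⁻¹ K.∙ k) · O.elem i S.≈ O.elem j → k K.≈ l
    same {k = k} {l} ≡.refl eq = K.trans (inverseʳ-unique (l K.⁻¹) k (free _ _ eq)) (⁻¹-involutive l)

module Kernels {r ℓ g ℓg s ℓs : Level} (R : CommutativeRing r ℓ) (K : FiniteAbelianGroup g ℓg)
               {S : Setoid s ℓs} (fin : Finite S) (α : Action K S) where
  private
    module R = CommutativeRing R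
    module K = FiniteAbelianGroup K
    module S = Setoid S
    module RK = CommutativeRing (groupRing R K)
    module D = Determinants (groupRing R K)
    module ΣR = SemiringSum R.semiring
    module ΣRK = SemiringSum RK.semiring
    module ΣK = FreeModule.FiniteSum R K.finite
    module ΣS = FreeModule.FiniteSum R fin
    module PRK = Polynomials (groupRing R K)
    module RK[u] = CommutativeRing (R [ K ][u])
    module D[u] = Determinants (R [ K ][u])
    module ΣRK[u] = SemiringSum RK[u].semiring
    module DR = Determinants R
  open CommutativeRing R using (_≈_; _+_; _*_; 0#)
  open FreeModule R using (∑; δ; sum-single; ∑-swap)
  open FiniteAbelianGroup K using (_∙_; _⁻¹; ε)
  open GroupRing R K using (_⊛_)
  open Action α
  open Transversal
  open Func using (to)
  open SetoidReasoning R.setoid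

  to-sum : ∀ {n} (y : Fin n → RK.Carrier) k → to (ΣRK.sum y) k ≡ ΣR.sum (λ j → to (y j) k)
  to-sum {zero}  y k = ≡.refl
  to-sum {suc n} y k = ≡.cong (to (y zero) k +_) (to-sum (tail y) k)

  -- The pairs (i , k) correspond to the points k · aᵢ of S. Instead of constructing this bijection
  -- on enumerations, insert a sum of δ over all points, exchange the sums, and use that each point
  -- is met exactly once.
  ∑-transversal : ∀ {p} (a : Transversal K α p) (f : S.Carrier → R.Carrier) → (∀ {x y} → x S.≈ y → f x ≈ f y) →
                  ΣR.sum (λ i → ∑ K.finite λ k → f (k · rep a i)) ≈ ∑ fin f
  ∑-transversal a f f-cong = begin
    ΣR.sum (λ i → ∑ K.finite λ k → f (k · rep a i))
      ≈⟨ DR.sum-cong (λ i → ΣK.∑-cong {λ k → f (k · rep a i)} {λ k → ∑ fin (λ x → at i k x)} λ k → R.sym (point (k · rep a i))) ⟩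
    ΣR.sum (λ i → ∑ K.finite λ k → ∑ fin λ x → at i k x)
      ≈⟨ DR.sum-cong (λ i → ∑-swap K.finite fin (at i)) ⟩
    ΣR.sum (λ i → ∑ fin λ x → ∑ K.finite λ k → at i k x)
      ≈⟨ ΣR.∑-comm (λ i j → ∑ K.finite λ k → at i k (Finite.elem fin j)) ⟩
    ∑ fin (λ x → ΣR.sum λ i → ∑ K.finite λ k → at i k x)
      ≈⟨ ΣS.∑-cong {λ x → ΣR.sum λ i → ∑ K.finite λ k → at i k x} {f} once ⟩
    ∑ fin f ∎
    where
    at : _ → K.Carrier → S.Carrier → R.Carrier
    at i k x = δ fin (k · rep a i) x * f x

    point : ∀ y → ∑ fin (λ x → δ fin y x * f x) ≈ f y
    point y = R.trans (ΣS.∑-single (λ x → δ fin y x * f x) (λ x≈x′ → R.*-cong (ΣS.δ-cong S.refl x≈x′) (f-cong x≈x′)) y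
      (λ x x≉y → R.trans (R.*-congʳ (ΣS.δ-no (x≉y ∘ S.sym))) (R.zeroˡ _)))
      (R.trans (R.*-congʳ (ΣS.δ-yes S.refl)) (R.*-identityˡ _))

    once : ∀ x → ΣR.sum (λ i → ∑ K.finite λ k → at i k x) ≈ f x
    once x = let (i , k , kaᵢ≈x) = cover a x in begin
      ΣR.sum (λ j → ∑ K.finite λ l → at j l x)
        ≈⟨ sum-single (λ j → ∑ K.finite λ l → at j l x) i (λ j j≢i → ΣK.∑-zero {λ l → at j l x} λ l →
             R.trans (R.*-congʳ (ΣS.δ-no λ laⱼ≈x → j≢i (proj₁ (distinct a (S.trans laⱼ≈x (S.sym kaᵢ≈x)))))) (R.zeroˡ _)) ⟩
      ∑ K.finite (λ l → at i l x)
        ≈⟨ ΣK.∑-single (λ l → at i l x) (λ l≈l′ → R.*-congʳ (ΣS.δ-cong (·-cong l≈l′ S.refl) S.refl)) k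
             (λ l l≉k → R.trans (R.*-congʳ (ΣS.δ-no λ laᵢ≈x → l≉k (proj₂ (distinct a (S.trans laᵢ≈x (S.sym kaᵢ≈x)))))) (R.zeroˡ _)) ⟩
      at i k x ≈⟨ R.trans (R.*-congʳ (ΣS.δ-yes kaᵢ≈x)) (R.*-identityˡ _) ⟩
      f x ∎

  -- Invariance under the diagonal action is K-linearity of the map with these coefficients.
  record Kernel : Set (g ⊔ s ⊔ ℓs ⊔ r ⊔ ℓ) where
    field
      value     : S.Carrier → S.Carrier → R.Carrier
      cong      : ∀ {x x′ y y′} → x S.≈ x′ → y S.≈ y′ → value x y ≈ value x′ y′
      invariant : ∀ k x y → value (k · x) (k · y) ≈ value x y
  open Kernel

  -- The matrix, with respect to the elements δ (a i) and δ (b j), of the K-linear map sending δ x to Σ κ x y δ y.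
  matrix : ∀ {p q} → Transversal K α p → Transversal K α q → Kernel → D.Matrix p q
  matrix a b κ i j = record
    { to = λ k → value κ (rep b j) (k · rep a i) ; cong = λ k≈l → cong κ S.refl (·-cong k≈l S.refl) }

  -- The sum over representatives of b and the convolution sum over K together run once through S,
  -- so the product of the matrices is the composition of the kernels.
  matrix-⊠ : ∀ {p q t} (a : Transversal K α p) (b : Transversal K α q) (c : Transversal K α t) κ μ ν →
    (∀ x y → ∑ fin (λ v → value κ v y * value μ x v) ≈ value ν x y) →
    (matrix a b κ D.⊠ matrix b c μ) D.≈ᴹ matrix a c ν
  matrix-⊠ a b c κ μ ν κμ≈ν i j h = begin
    to (ΣRK.sum (λ l → matrix a b κ i l ⊛ matrix b c μ l j)) h
      ≡⟨ to-sum (λ l → matrix a b κ i l ⊛ matrix b c μ l j) h ⟩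
    ΣR.sum (λ l → ∑ K.finite λ k → value κ (rep b l) (k · rep a i) * value μ (rep c j) (((k ⁻¹) ∙ h) · rep b l))
      ≈⟨ DR.sum-cong (λ l → R.trans
           (ΣK.∑-cong {λ k → value κ (rep b l) (k · rep a i) * value μ (rep c j) (((k ⁻¹) ∙ h) · rep b l)}
                      {λ k → f (((k ⁻¹) ∙ h) · rep b l)}
                      -- Invariance under k⁻¹h moves the second argument of κ to the fixed point h ·
                      -- aᵢ; both factors then depend only on the point k⁻¹h · bₗ, and k ↦ k⁻¹h is
                      -- an involution.
                      (λ k → R.*-congʳ (move (rep b l) k)))
           (R.sym (ΣK.∑-reindex (λ k → f (k · rep b l)) (λ k≈k′ → f-cong (·-cong k≈k′ S.refl))
             flip flip flip-cong flip-cong flip-flip flip-flip))) ⟩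
    ΣR.sum (λ l → ∑ K.finite λ k → f (k · rep b l))
      ≈⟨ ∑-transversal b f f-cong ⟩
    ∑ fin f
      ≈⟨ κμ≈ν (rep c j) (h · rep a i) ⟩
    value ν (rep c j) (h · rep a i) ∎
    where
    open AbelianGroupProperties K.abelianGroup using (⁻¹-∙-comm; ⁻¹-involutive)
    f : S.Carrier → R.Carrier
    f v = value κ v (h · rep a i) * value μ (rep c j) v

    f-cong : ∀ {x y} → x S.≈ y → f x ≈ f y
    f-cong x≈y = R.*-cong (cong κ x≈y S.refl) (cong μ S.refl x≈y)

    flip : K.Carrier → K.Carrier
    flip k = (k ⁻¹) ∙ h

    flip-cong : ∀ {k l} → k K.≈ l → flip k K.≈ flip l
    flip-cong k≈l = K.∙-congʳ (K.⁻¹-cong k≈l)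

    flip-flip : ∀ k → flip (flip k) K.≈ k
    flip-flip k =
      K.trans (K.∙-congʳ (K.trans (K.sym (⁻¹-∙-comm _ _)) (K.∙-congʳ (⁻¹-involutive k))))
      (K.trans (K.assoc _ _ _) (K.trans (K.∙-congˡ (K.inverseˡ h)) (K.identityʳ k)))

    flip-∙ : ∀ k → flip k ∙ k K.≈ h
    flip-∙ k = K.trans (K.comm _ _) (K.trans (K.sym (K.assoc _ _ _))
      (K.trans (K.∙-congʳ (K.inverseʳ k)) (K.identityˡ h)))

    move : ∀ b k → value κ b (k · rep a i) ≈ value κ (flip k · b) (h · rep a i)
    move b k = R.trans (R.sym (invariant κ (flip k) b (k · rep a i)))
      (cong κ S.refl (S.trans (S.sym (·-assoc _ _ _)) (·-cong (flip-∙ k) S.refl)))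

  δ-kernel : Kernel
  δ-kernel = record
    { value     = δ fin
    ; cong      = ΣS.δ-cong
    ; invariant = λ k x y → FreeModule.indicator-cong R (Finite._≟_ fin _ _) (Finite._≟_ fin _ _)
        (λ kx≈ky → S.trans (S.sym (·-inverseˡ k x)) (S.trans (·-cong K.refl kx≈ky) (·-inverseˡ k y)))
        (λ x≈y → ·-cong K.refl x≈y) R.refl }

  ∑-*-δ : ∀ (κ : Kernel) x y → ∑ fin (λ v → value κ v y * δ fin x v) ≈ value κ x y
  ∑-*-δ κ x y = R.trans
    (ΣS.∑-single (λ v → value κ v y * δ fin x v) (λ v≈v′ → R.*-cong (cong κ v≈v′ S.refl) (ΣS.δ-cong S.refl v≈v′)) x
      (λ v v≉x → R.trans (R.*-congˡ (ΣS.δ-no (v≉x ∘ S.sym))) (R.zeroʳ _)))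
    (R.trans (R.*-congˡ (ΣS.δ-yes S.refl)) (R.*-identityʳ _))

  ∑-δ-* : ∀ (κ : Kernel) x y → ∑ fin (λ v → δ fin v y * value κ x v) ≈ value κ x y
  ∑-δ-* κ x y = R.trans
    (ΣS.∑-single (λ v → δ fin v y * value κ x v) (λ v≈v′ → R.*-cong (ΣS.δ-cong v≈v′ S.refl) (cong κ S.refl v≈v′)) y
      (λ v v≉y → R.trans (R.*-congʳ (ΣS.δ-no v≉y)) (R.zeroˡ _)))
    (R.trans (R.*-congʳ (ΣS.δ-yes S.refl)) (R.*-identityˡ _))

  𝟙-diagonal : ∀ {n} (i : Fin n) k → to (D.𝟙 i i) k ≡ δ K.finite ε k
  𝟙-diagonal zero    k = ≡.refl
  𝟙-diagonal (suc i) k = 𝟙-diagonal i k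

  𝟙-off-diagonal : ∀ {n} {i j : Fin n} → i ≢ j → ∀ k → to (D.𝟙 i j) k ≡ 0#
  𝟙-off-diagonal {i = zero}  {zero}  i≢j k = contradiction ≡.refl i≢j
  𝟙-off-diagonal {i = zero}  {suc j} i≢j k = ≡.refl
  𝟙-off-diagonal {i = suc i} {zero}  i≢j k = ≡.refl
  𝟙-off-diagonal {i = suc i} {suc j} i≢j k = 𝟙-off-diagonal (i≢j ∘ ≡.cong suc) k

  matrix-δ : ∀ {p} (a : Transversal K α p) → matrix a a δ-kernel D.≈ᴹ D.𝟙
  matrix-δ a i j k with i Fin.≟ j
  ... | yes ≡.refl = R.trans
    (FreeModule.indicator-cong R (Finite._≟_ fin (rep a i) (k · rep a i)) (Finite._≟_ K.finite ε k)
      (λ aᵢ≈kaᵢ → proj₂ (distinct a (S.trans (·-identity _) aᵢ≈kaᵢ)))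
      (λ ε≈k → S.trans (S.sym (·-identity _)) (·-cong ε≈k S.refl)) R.refl)
    (R.reflexive (≡.sym (𝟙-diagonal i k)))
  ... | no i≢j = R.trans
    (ΣS.δ-no λ aⱼ≈kaᵢ → i≢j (≡.sym (proj₁ (distinct a (S.trans (·-identity _) aⱼ≈kaᵢ)))))
    (R.reflexive (≡.sym (𝟙-off-diagonal i≢j k)))

  -- `T a b` is the matrix of the identity map from the basis b to the basis a, constant in u. In
  -- each degree both `X ⊠ T a b` and `T a b ⊠ Y` are the matrix of `κ n` from b to a.
  det-transversals : ∀ {p q} (a : Transversal K α p) (b : Transversal K α q) (κ : ℕ → Kernel)
    (X : D[u].Matrix p p) (Y : D[u].Matrix q q) →
    (∀ i j n k → to (coeff (X i j) n) k ≈ value (κ n) (rep a j) (k · rep a i)) →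
    (∀ i j n k → to (coeff (Y i j) n) k ≈ value (κ n) (rep b j) (k · rep b i)) →
    D[u].det X RK[u].≈ D[u].det Y
  det-transversals {p} {q} a b κ X Y X≈κ Y≈κ = D[u].det-intertwined X Y (T a b) (T b a) XT≈TY (TT≈𝟙 a b) (TT≈𝟙 b a)
    where
    T : ∀ {p q} → Transversal K α p → Transversal K α q → D[u].Matrix p q
    T a b i j = PRK.constant (matrix a b δ-kernel i j)

    TT≈𝟙 : ∀ {p q} (a : Transversal K α p) (b : Transversal K α q) → (T a b D[u].⊠ T b a) D[u].≈ᴹ D[u].𝟙
    TT≈𝟙 a b i j = RK[u].trans {ΣRK[u].sum (λ l → T a b i l RK[u].* T b a l j)}
      {PRK.constant ((matrix a b δ-kernel D.⊠ matrix b a δ-kernel) i j)} {D[u].𝟙 i j}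
      (RK[u].trans {ΣRK[u].sum (λ l → T a b i l RK[u].* T b a l j)}
        {ΣRK[u].sum (λ l → PRK.constant (matrix a b δ-kernel i l ⊛ matrix b a δ-kernel l j))}
        {PRK.constant ((matrix a b δ-kernel D.⊠ matrix b a δ-kernel) i j)}
        (D[u].sum-cong (λ l → RK[u].sym
          {PRK.constant (matrix a b δ-kernel i l ⊛ matrix b a δ-kernel l j)} {T a b i l RK[u].* T b a l j}
          (C.*-homo (matrix a b δ-kernel i l) (matrix b a δ-kernel l j))))
        (RK[u].sym {PRK.constant ((matrix a b δ-kernel D.⊠ matrix b a δ-kernel) i j)}
          {ΣRK[u].sum (λ l → PRK.constant (matrix a b δ-kernel i l ⊛ matrix b a δ-kernel l j))}
          (CH.sum-homo (λ l → matrix a b δ-kernel i l ⊛ matrix b a δ-kernel l j))))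
      (RK[u].trans {PRK.constant ((matrix a b δ-kernel D.⊠ matrix b a δ-kernel) i j)} {PRK.constant (D.𝟙 i j)} {D[u].𝟙 i j}
        (C.⟦⟧-cong {(matrix a b δ-kernel D.⊠ matrix b a δ-kernel) i j} {D.𝟙 i j}
          (λ k → R.trans (matrix-⊠ a b a δ-kernel δ-kernel δ-kernel (∑-*-δ δ-kernel) i j k) (matrix-δ a i j k)))
        (CH.𝟙-homo i j))
      where
      module C = RingMorphisms.IsRingHomomorphism PRK.constant-hom
      module CH = HomomorphismProperties {R = groupRing R K} {S = R [ K ][u]} PRK.constant-hom

    XT≈TY : (X D[u].⊠ T a b) D[u].≈ᴹ (T a b D[u].⊠ Y)
    XT≈TY i j n h = begin
      to (coeff (ΣRK[u].sum (λ l → X i l RK[u].* T a b l j)) n) h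
        ≈⟨ PRK.coeff-sum (λ l → X i l RK[u].* T a b l j) n h ⟩
      to (ΣRK.sum (λ l → coeff (X i l RK[u].* T a b l j) n)) h
        ≈⟨ D.sum-cong {f = λ l → coeff (X i l RK[u].* T a b l j) n} {λ l → matrix a a (κ n) i l ⊛ matrix a b δ-kernel l j} (λ l → RK.trans
             {coeff (X i l RK[u].* T a b l j) n} {coeff (X i l) n ⊛ matrix a b δ-kernel l j} {matrix a a (κ n) i l ⊛ matrix a b δ-kernel l j}
             (PRK.∗-constantʳ (coeff (X i l)) (matrix a b δ-kernel l j) n)
             (RK.*-congʳ {matrix a b δ-kernel l j} {coeff (X i l) n} {matrix a a (κ n) i l} (X≈κ i l n))) h ⟩
      to ((matrix a a (κ n) D.⊠ matrix a b δ-kernel) i j) h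
        ≈⟨ matrix-⊠ a a b (κ n) δ-kernel (κ n) (∑-*-δ (κ n)) i j h ⟩
      to (matrix a b (κ n) i j) h
        ≈⟨ matrix-⊠ a b b δ-kernel (κ n) (κ n) (∑-δ-* (κ n)) i j h ⟨
      to ((matrix a b δ-kernel D.⊠ matrix b b (κ n)) i j) h
        ≈⟨ D.sum-cong {f = λ l → coeff (T a b i l RK[u].* Y l j) n} {λ l → matrix a b δ-kernel i l ⊛ matrix b b (κ n) l j} (λ l → RK.trans
             {coeff (T a b i l RK[u].* Y l j) n} {matrix a b δ-kernel i l ⊛ coeff (Y l j) n} {matrix a b δ-kernel i l ⊛ matrix b b (κ n) l j}
             (PRK.∗-constantˡ (matrix a b δ-kernel i l) (coeff (Y l j)) n)
             (RK.*-congˡ {matrix a b δ-kernel i l} {coeff (Y l j) n} {matrix b b (κ n) l j} (Y≈κ l j n))) h ⟨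
      to (ΣRK.sum (λ l → coeff (T a b i l RK[u].* Y l j) n)) h
        ≈⟨ PRK.coeff-sum (λ l → T a b i l RK[u].* Y l j) n h ⟨
      to (coeff (ΣRK[u].sum (λ l → T a b i l RK[u].* Y l j)) n) h ∎

open Func using (to; cong)
open Transversal

-- Multiplication on the group ring of G as a map linear over that of H

module Cosets {r ℓ g ℓg p : Level} (R : CommutativeRing r ℓ) (G : FiniteAbelianGroup g ℓg) (H : Subgroup G p) where
  private
    module R = CommutativeRing R
    module G = FiniteAbelianGroup G
    module ΣG = FreeModule.FiniteSum R G.finite
    module RG = CommutativeRing (groupRing R G)
    module RK[u] = CommutativeRing (R [ Subgroup.subgroup H ][u])
    module D[u] = Determinants (R [ Subgroup.subgroup H ][u])
  open CommutativeRing R using (_≈_; _*_)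
  open FreeModule R using (∑; δ)
  open FiniteAbelianGroup G using (_∙_; _⁻¹; ε)
  open GroupRing R G using (_⊛_)
  open Kernels R (Subgroup.subgroup H) G.finite (translation G H)
  open AbelianGroupProperties G.abelianGroup using (⁻¹-∙-comm; ⁻¹-involutive; ∙-cancelʳ)
  open CommutativeSemigroupProperties (CommutativeMonoid.commutativeSemigroup G.commutativeMonoid) using (interchange)
  open SetoidReasoning R.setoid

  cosets : Transversal (Subgroup.subgroup H) (translation G H) _
  cosets = orbitTransversal (Subgroup.subgroup H) (translation G H) G.finite (translation-free G H)

  -- Multiplication by s sends δ v to Σ s(w v⁻¹) δ w.
  multiplication-kernel : RG.Carrier → Kernel
  multiplication-kernel s = record
    { value     = λ v w → to s (w ∙ v ⁻¹)
    ; cong      = λ v≈v′ w≈w′ → cong s (G.∙-cong w≈w′ (G.⁻¹-cong v≈v′))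
    ; invariant = λ (h , _) v w → cong s (G.trans (G.∙-congˡ (G.sym (⁻¹-∙-comm h v)))
        (G.trans (interchange h w (h ⁻¹) (v ⁻¹)) (G.trans (G.∙-congʳ (G.inverseʳ h)) (G.identityˡ _)))) }

  multiplication-composition : ∀ s t x y → ∑ G.finite (λ v → to s (y ∙ v ⁻¹) * to t (v ∙ x ⁻¹)) ≈ to (s ⊛ t) (y ∙ x ⁻¹)
  multiplication-composition s t x y = R.sym (begin
    ∑ G.finite (λ k → to s k * to t ((k ⁻¹) ∙ (y ∙ x ⁻¹)))
      ≈⟨ ΣG.∑-reindex (λ k → to s k * to t ((k ⁻¹) ∙ (y ∙ x ⁻¹)))
           (λ k≈k′ → R.*-cong (cong s k≈k′) (cong t (G.∙-congʳ (G.⁻¹-cong k≈k′))))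
           flip flip flip-cong flip-cong flip-flip flip-flip ⟩
    ∑ G.finite (λ v → to s (y ∙ v ⁻¹) * to t ((y ∙ v ⁻¹) ⁻¹ ∙ (y ∙ x ⁻¹)))
      ≈⟨ ΣG.∑-cong {λ v → to s (y ∙ v ⁻¹) * to t ((y ∙ v ⁻¹) ⁻¹ ∙ (y ∙ x ⁻¹))} {λ v → to s (y ∙ v ⁻¹) * to t (v ∙ x ⁻¹)}
           (λ v → R.*-congˡ (cong t (cancel v))) ⟩
    ∑ G.finite (λ v → to s (y ∙ v ⁻¹) * to t (v ∙ x ⁻¹)) ∎)
    where
    flip : G.Carrier → G.Carrier
    flip v = y ∙ v ⁻¹
    flip-cong : ∀ {v w} → v G.≈ w → flip v G.≈ flip w
    flip-cong v≈w = G.∙-congˡ (G.⁻¹-cong v≈w)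
    flip⁻¹ : ∀ v → flip v ⁻¹ G.≈ v ∙ y ⁻¹
    flip⁻¹ v = G.trans (G.sym (⁻¹-∙-comm y (v ⁻¹))) (G.trans (G.comm _ _) (G.∙-congʳ (⁻¹-involutive v)))
    flip-flip : ∀ v → flip (flip v) G.≈ v
    flip-flip v = G.trans (G.∙-congˡ (flip⁻¹ v)) (G.trans (G.comm _ _)
      (G.trans (G.assoc _ _ _) (G.trans (G.∙-congˡ (G.inverseˡ y)) (G.identityʳ v))))
    cancel : ∀ v → flip v ⁻¹ ∙ (y ∙ x ⁻¹) G.≈ v ∙ x ⁻¹
    cancel v = G.trans (G.∙-congʳ (flip⁻¹ v)) (G.trans (G.assoc _ _ _)
      (G.∙-congˡ (G.trans (G.sym (G.assoc _ _ _)) (G.trans (G.∙-congʳ (G.inverseˡ y)) (G.identityˡ _)))))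

  multiplicationRepresentation : MatrixRepresentation (groupRing R G) (groupRing R (Subgroup.subgroup H)) _
  multiplicationRepresentation = record
    { ρ      = λ s → matrix cosets cosets (multiplication-kernel s)
    ; ρ-cong = λ s≈t i j k → s≈t _
    ; ρ-+    = λ s t i j k → R.refl
    ; ρ-*    = λ s t i j k → R.sym (matrix-⊠ cosets cosets cosets
        (multiplication-kernel s) (multiplication-kernel t) (multiplication-kernel (s ⊛ t))
        (multiplication-composition s t) i j k)
    ; ρ-0    = λ i j k → R.refl
    ; ρ-1    = λ i j k → R.trans
        (FreeModule.indicator-cong R (Finite._≟_ G.finite _ _) (Finite._≟_ G.finite _ _)
          (λ ε≈wv⁻¹ → ∙-cancelʳ (rep cosets j ⁻¹) _ _ (G.trans (G.inverseʳ _) ε≈wv⁻¹))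
          (λ v≈w → G.trans (G.sym (G.inverseʳ _)) (G.∙-congʳ v≈w)) R.refl)
        (matrix-δ cosets i j k) }

  ⊛-basisElement : ∀ s v w → to (s ⊛ ΣG.basisElement v) w ≈ to s (w ∙ v ⁻¹)
  ⊛-basisElement s v w = begin
    ∑ G.finite (λ k → to s k * δ G.finite v ((k ⁻¹) ∙ w))
      ≈⟨ ΣG.∑-single (λ k → to s k * δ G.finite v ((k ⁻¹) ∙ w))
           (λ k≈k′ → R.*-cong (cong s k≈k′) (ΣG.δ-cong G.refl (G.∙-congʳ (G.⁻¹-cong k≈k′)))) (w ∙ v ⁻¹)
           (λ k k≉wv⁻¹ → R.trans (R.*-congˡ (ΣG.δ-no λ v≈k⁻¹w → k≉wv⁻¹ (solve-k k v≈k⁻¹w))) (R.zeroʳ _)) ⟩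
    to s (w ∙ v ⁻¹) * δ G.finite v ((w ∙ v ⁻¹) ⁻¹ ∙ w)
      ≈⟨ R.trans (R.*-congˡ (ΣG.δ-yes v≈)) (R.*-identityʳ _) ⟩
    to s (w ∙ v ⁻¹) ∎
    where
    solve-k : ∀ k → v G.≈ (k ⁻¹) ∙ w → k G.≈ w ∙ v ⁻¹
    solve-k k v≈k⁻¹w = ∙-cancelʳ v _ _ (G.trans (G.∙-congˡ v≈k⁻¹w) (G.trans (G.sym (G.assoc _ _ _))
      (G.trans (G.∙-congʳ (G.inverseʳ k)) (G.trans (G.identityˡ w)
        (G.sym (G.trans (G.assoc _ _ _) (G.trans (G.∙-congˡ (G.inverseˡ v)) (G.identityʳ w))))))))
    v≈ : v G.≈ (w ∙ v ⁻¹) ⁻¹ ∙ w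
    v≈ = G.sym (G.trans (G.∙-congʳ (G.trans (G.sym (⁻¹-∙-comm w (v ⁻¹))) (G.trans (G.comm _ _) (G.∙-congʳ (⁻¹-involutive v)))))
      (G.trans (G.assoc _ _ _) (G.trans (G.∙-congˡ (G.inverseˡ w)) (G.identityʳ v))))

  private
    ringOf : ∀ {r ℓ m ℓm} {R : CommutativeRing r ℓ} {M : LeftModule (CommutativeRing.ring R) m ℓm} →
             Endomorphism R M → CommutativeRing r ℓ
    ringOf {R = R} _ = R

  -- The ring over which N takes its determinant is R [ Subgroup.subgroup H ][u] only after unfolding;
  -- the identity homomorphism carries determinants over without comparing the two ring records.
  identity-hom : ∀ P → Homomorphism (ringOf (multiplication R G H P)) (R [ Subgroup.subgroup H ][u]) (λ p → p)
  identity-hom P = record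
    { isSemiringHomomorphism = record
      { isNearSemiringHomomorphism = record
        { +-isMonoidHomomorphism = record
          { isMagmaHomomorphism = record
            { isRelHomomorphism = record { cong = λ p≈q → p≈q }
            ; homo = λ _ _ _ _ → R.refl }
          ; ε-homo = λ _ _ → R.refl }
        ; *-homo = λ _ _ _ _ → R.refl }
      ; 1#-homo = λ _ _ → R.refl }
    ; -‿homo = λ _ _ _ → R.refl }

  -- Column j of the matrix defining `N` comes from the product of P with the constant polynomial δ
  -- bⱼ, so each coefficient of P acts separately.
  N≈det : ∀ P → N R G H P RK[u].≈ D[u].det (ρ[u] multiplicationRepresentation P)
  N≈det P = RK[u].trans {N R G H P} {D[u].det {Finite.size (Action.orbits-finite (translation G H) G.finite)} _} {D[u].det (ρ[u] multiplicationRepresentation P)}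
    (HomomorphismProperties.det-homo {R = ringOf (multiplication R G H P)} {S = R [ Subgroup.subgroup H ][u]} (identity-hom P)
      {n = Finite.size (Action.orbits-finite (translation G H) G.finite)} _)
    (D[u].det-cong λ i j n k → R.trans
      (PRG.∗-constantʳ (coeff P) (ΣG.basisElement (rep cosets j)) n (proj₁ k ∙ rep cosets i))
      (⊛-basisElement (coeff P n) (rep cosets j) (proj₁ k ∙ rep cosets i)))
    where module PRG = Polynomials (groupRing R G)

-- The kernel of I - 𝓐u

module AdjacencyKernel {r ℓ g ℓg v ℓv e ℓe : Level} (R : CommutativeRing r ℓ) (K : FiniteAbelianGroup g ℓg)
                       (Y : FiniteDigraph v ℓv e ℓe) (α : DigraphAction K Y) where
  open FiniteDigraph Y
  open DigraphAction α
  private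
    module R = CommutativeRing R
    module V = Setoid V
    module onV = Action onV
    module RK = CommutativeRing (groupRing R K)
    M = permutationModule R K onV
    module M = LeftModule M
    module PM = PolynomialModule (groupRing R K) M
    module ΣV = FreeModule.FiniteSum R V-finite
  open CommutativeRing R using (_≈_; _+_; _*_; -_; 0#; 1#)
  open FreeModule R using (∑; δ)
  open Kernels R K V-finite onV using (Kernel; δ-kernel; ∑-*-δ)
  open PolynomialRing (groupRing R K) using (u)
  open Kernel

  adjacency-kernel : Kernel
  adjacency-kernel = record
    { value     = adjacency R K Y α
    ; cong      = adjacency-cong R K Y α
    ; invariant = λ k x y → R.trans (adjacency-equivariant R K Y α k x (k onV.· y))
        (adjacency-cong R K Y α V.refl (onV.·-inverseˡ k y)) }

  -- The coefficients of the kernel of I - 𝓐u.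
  𝓘-u-kernel : ℕ → Kernel
  𝓘-u-kernel 0 = δ-kernel
  𝓘-u-kernel 1 = record
    { value     = λ x y → - value adjacency-kernel x y
    ; cong      = λ x≈x′ y≈y′ → R.-‿cong (cong adjacency-kernel x≈x′ y≈y′)
    ; invariant = λ k x y → R.-‿cong (invariant adjacency-kernel k x y) }
  𝓘-u-kernel (suc (suc n)) = record { value = λ x y → 0# ; cong = λ _ _ → R.refl ; invariant = λ k x y → R.refl }

  u∗-zero : ∀ (y : PM.Poly) → coeff (u PM.*ₚ y) 0 M.≈ᴹ M.0ᴹ
  u∗-zero y = M.*ₗ-zeroˡ (coeff y 0)

  u∗-suc : ∀ (y : PM.Poly) n → coeff (u PM.*ₚ y) (suc n) M.≈ᴹ coeff y n
  u∗-suc y n x = R.trans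
    (R.+-cong (M.*ₗ-zeroˡ (coeff y (suc n)) x)
      -- Shifted by one degree, `u` is the constant 1.
      (PM.∗-cong {f = λ i → coeff u (suc i)} {g = PRK.constantCoeff RK.1#} {m = coeff y} {n = coeff y}
        (λ { zero → RK.refl {RK.1#} ; (suc i) → RK.refl {RK.0#} }) (λ i → M.≈ᴹ-refl {coeff y i}) n x))
    (R.trans (R.+-identityˡ _)
      (R.trans (PM.∗-constantˡ RK.1# (coeff y) n x) (M.*ₗ-identityˡ (coeff y n) x)))
    where module PRK = PolynomialRing (groupRing R K)

  𝓘-u-coeff : ∀ x n y → to (coeff (Endomorphism.⟦_⟧ (𝓘-u (groupRing R K) M (𝓐 R K Y α))
    (PM.constant (ΣV.basisElement x))) n) y ≈ value (𝓘-u-kernel n) x y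
  𝓘-u-coeff x n y = go n
    where
    Ax = mapCoefficients (groupRing R K) M (𝓐 R K Y α) (PM.constant (ΣV.basisElement x))
    -0≈0 = RingProperties.-0#≈0# R.ring

    A-basisElement : to (adjacencyMap R K Y α (ΣV.basisElement x)) y ≈ adjacency R K Y α x y
    A-basisElement = R.trans (ΣV.∑-cong {λ w → δ V-finite x w * adjacency R K Y α w y}
      {λ w → adjacency R K Y α w y * δ V-finite x w} (λ w → R.*-comm _ _)) (∑-*-δ adjacency-kernel x y)

    go : ∀ n → to (coeff (PM.constant (ΣV.basisElement x)) n) y + - to (coeff (u PM.*ₚ Ax) n) y ≈ value (𝓘-u-kernel n) x y
    go 0 = R.trans (R.+-congˡ (R.trans (R.-‿cong (u∗-zero Ax y)) -0≈0)) (R.+-identityʳ _)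
    go 1 = R.trans (R.+-identityˡ _) (R.-‿cong (R.trans (u∗-suc Ax 0 y) A-basisElement))
    -- The factor u shifts degrees, so this is 𝓐 applied to a coefficient of positive degree of the
    -- constant polynomial δ x.
    go (suc (suc n)) = R.trans (R.+-identityˡ _) (R.trans
      (R.-‿cong (R.trans (u∗-suc Ax (suc n) y) (ΣV.∑-zero {λ w → 0# * adjacency R K Y α w y} (λ w → R.zeroˡ _)))) -0≈0)

-- Base change

module _ {f ℓ₁ ℓ₂ : Level} (F : HeytingField f ℓ₁ ℓ₂) where
  open import Data.Integer.Base using (+_; -[1+_]; _⊖_)
  open CommutativeRing (fieldRing F) hiding (zero)
  open SemiringMult semiring using (×-homo-+) renaming (_×_ to _×ℕ_)
  open RingProperties ring using (-0#≈0#; -‿involutive; -‿distribˡ-*; -‿+-comm)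
  open SetoidReasoning setoid

  fromℤ-neg : ∀ i → fromℤ F (ℤ.- i) ≈ - fromℤ F i
  fromℤ-neg (+ zero)  = sym -0#≈0#
  fromℤ-neg (+ suc n) = refl
  fromℤ-neg -[1+ n ]  = sym (-‿involutive _)

  fromℤ-⊖ : ∀ m n → fromℤ F (m ⊖ n) ≈ m ×ℕ 1# - n ×ℕ 1#
  fromℤ-⊖ m       zero    = sym (trans (+-congˡ -0#≈0#) (+-identityʳ _))
  fromℤ-⊖ zero    (suc n) = sym (+-identityˡ _)
  fromℤ-⊖ (suc m) (suc n) = begin
    fromℤ F (suc m ⊖ suc n)           ≡⟨ ≡.cong (fromℤ F) (ℤ.[1+m]⊖[1+n]≡m⊖n m n) ⟩
    fromℤ F (m ⊖ n)                   ≈⟨ fromℤ-⊖ m n ⟩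
    x - y                             ≈⟨ +-identityˡ _ ⟨
    0# + (x - y)                      ≈⟨ +-congʳ (-‿inverseʳ 1#) ⟨
    (1# - 1#) + (x - y)               ≈⟨ +-interchange _ _ _ _ ⟩
    (1# + x) + (- 1# - y)             ≈⟨ +-congˡ (-‿+-comm 1# y) ⟩
    (1# + x) - (1# + y)               ∎
    where
    x = m ×ℕ 1#
    y = n ×ℕ 1#
    open CommutativeSemigroupProperties +-commutativeSemigroup using () renaming (interchange to +-interchange)

  fromℤ-+ : ∀ i j → fromℤ F (i ℤ.+ j) ≈ fromℤ F i + fromℤ F j
  fromℤ-+ (+ m)    (+ n)    = ×-homo-+ 1# m n
  fromℤ-+ (+ m)    -[1+ n ] = fromℤ-⊖ m (suc n)
  fromℤ-+ -[1+ m ] (+ n)    = trans (fromℤ-⊖ n (suc m)) (+-comm _ _)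
  fromℤ-+ -[1+ m ] -[1+ n ] = begin
    - (suc (suc (m ℕ.+ n)) ×ℕ 1#)       ≈⟨ -‿cong (+-congˡ (+-congˡ (×-homo-+ 1# m n))) ⟩
    - (1# + (1# + (m ×ℕ 1# + n ×ℕ 1#))) ≈⟨ -‿cong (+-congˡ (x∙yz≈y∙xz _ _ _)) ⟩
    - (1# + (m ×ℕ 1# + (1# + n ×ℕ 1#))) ≈⟨ -‿cong (+-assoc _ _ _) ⟨
    - (suc m ×ℕ 1# + suc n ×ℕ 1#)       ≈⟨ -‿+-comm _ _ ⟨
    - (suc m ×ℕ 1#) - suc n ×ℕ 1#       ∎
    where open CommutativeSemigroupProperties +-commutativeSemigroup using (x∙yz≈y∙xz)

  fromℤ-+* : ∀ m j → fromℤ F (+ m ℤ.* j) ≈ (m ×ℕ 1#) * fromℤ F j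
  fromℤ-+* zero    j = sym (zeroˡ _)
  fromℤ-+* (suc m) j = begin
    fromℤ F (+ suc m ℤ.* j)                      ≡⟨ ≡.cong (fromℤ F) (ℤ.suc-* (+ m) j) ⟩
    fromℤ F (j ℤ.+ + m ℤ.* j)                    ≈⟨ fromℤ-+ j (+ m ℤ.* j) ⟩
    fromℤ F j + fromℤ F (+ m ℤ.* j)              ≈⟨ +-cong (sym (*-identityˡ _)) (fromℤ-+* m j) ⟩
    1# * fromℤ F j + (m ×ℕ 1#) * fromℤ F j       ≈⟨ distribʳ _ _ _ ⟨
    (suc m ×ℕ 1#) * fromℤ F j                    ∎

  fromℤ-* : ∀ i j → fromℤ F (i ℤ.* j) ≈ fromℤ F i * fromℤ F j
  fromℤ-* (+ m)    j = fromℤ-+* m j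
  fromℤ-* -[1+ m ] j = begin
    fromℤ F (-[1+ m ] ℤ.* j)          ≡⟨ ≡.cong (fromℤ F) (ℤ.neg-distribˡ-* (+ suc m) j) ⟨
    fromℤ F (ℤ.- (+ suc m ℤ.* j))     ≈⟨ fromℤ-neg (+ suc m ℤ.* j) ⟩
    - fromℤ F (+ suc m ℤ.* j)         ≈⟨ -‿cong (fromℤ-+* (suc m) j) ⟩
    - ((suc m ×ℕ 1#) * fromℤ F j)     ≈⟨ -‿distribˡ-* _ _ ⟩
    - (suc m ×ℕ 1#) * fromℤ F j       ∎

  fromℤ-hom : Homomorphism ℤ.+-*-commutativeRing (fieldRing F) (fromℤ F)
  fromℤ-hom = record
    { isSemiringHomomorphism = record
      { isNearSemiringHomomorphism = record
        { +-isMonoidHomomorphism = record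
          { isMagmaHomomorphism = record
            { isRelHomomorphism = record { cong = λ i≡j → reflexive (≡.cong (fromℤ F) i≡j) }
            ; homo = fromℤ-+ }
          ; ε-homo = refl }
        ; *-homo = fromℤ-* }
      ; 1#-homo = +-identityʳ 1# }
    ; -‿homo = fromℤ-neg }

module _ {r ℓ s ℓs : Level} {R : CommutativeRing r ℓ} {S : CommutativeRing s ℓs}
         {φ : CommutativeRing.Carrier R → CommutativeRing.Carrier S} (hom : Homomorphism R S φ) where
  private
    module R = CommutativeRing R
    module S = CommutativeRing S
  open RingMorphisms.IsRingHomomorphism hom
  open HomomorphismProperties {R = R} {S = S} hom

  indicator-homo : ∀ {p} {P : Set p} (P? : Dec P) {x y} → φ x S.≈ y →
                   φ (if does P? then x else R.0#) S.≈ (if does P? then y else S.0#)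
  indicator-homo (yes _) φx≈y = φx≈y
  indicator-homo (no _)  φx≈y = 0#-homo

  module _ {a ℓa : Level} {X : Setoid a ℓa} (fin : Finite X) where
    private module ΣS = FreeModule.FiniteSum S fin

    ∑-homo : ∀ f → φ (FreeModule.∑ R fin f) S.≈ FreeModule.∑ S fin (φ ∘ f)
    ∑-homo f = sum-homo (f ∘ Finite.elem fin)

    δ-homo : ∀ x y → φ (FreeModule.δ R fin x y) S.≈ FreeModule.δ S fin x y
    δ-homo x y = indicator-homo (Finite._≟_ fin x y) 1#-homo

  module _ {g ℓg : Level} (K : FiniteAbelianGroup g ℓg) where
    private
      module K = FiniteAbelianGroup K
      module ΣK = FreeModule.FiniteSum S K.finite
      RK = groupRing R K
      SK = groupRing S K
      module RK = CommutativeRing RK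
      module SK = CommutativeRing SK

    infix 4 _↦_
    -- A relation on values: the coefficients of `baseChange`, which carry their own congruence
    -- proofs, satisfy it by reflexivity.
    _↦_ : Free R K.setoid → Free S K.setoid → Set _
    x ↦ y = ∀ k → φ (to x k) S.≈ to y k

    ⊛-homo : ∀ {x x′ y y′} → x ↦ x′ → y ↦ y′ → (x RK.* y) ↦ (x′ SK.* y′)
    ⊛-homo {x} {x′} {y} {y′} x↦x′ y↦y′ k = S.trans
      (∑-homo K.finite (λ l → to x l R.* to y ((l K.⁻¹) K.∙ k)))
      (ΣK.∑-cong {λ l → φ (to x l R.* to y ((l K.⁻¹) K.∙ k))} {λ l → to x′ l S.* to y′ ((l K.⁻¹) K.∙ k)}
        λ l → S.trans (*-homo _ _) (S.*-cong (x↦x′ l) (y↦y′ _)))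

    cauchyProduct-homo : ∀ {p p′ q q′} → (∀ i → p i ↦ p′ i) → (∀ i → q i ↦ q′ i) →
      ∀ n → cauchyProduct RK._*_ RK._+_ p q n ↦ cauchyProduct SK._*_ SK._+_ p′ q′ n
    cauchyProduct-homo {p} {p′} {q} {q′} p↦p′ q↦q′ zero    k = ⊛-homo {p 0} {p′ 0} {q 0} {q′ 0} (p↦p′ 0) (q↦q′ 0) k
    cauchyProduct-homo {p} {p′} {q} {q′} p↦p′ q↦q′ (suc n) k = S.trans (+-homo _ _)
      (S.+-cong (⊛-homo {p 0} {p′ 0} {q (suc n)} {q′ (suc n)} (p↦p′ 0) (q↦q′ (suc n)) k)
        (cauchyProduct-homo (p↦p′ ∘ suc) q↦q′ n k))

  module _ {g ℓg v ℓv e ℓe : Level} (K : FiniteAbelianGroup g ℓg) (Y : FiniteDigraph v ℓv e ℓe) (α : DigraphAction K Y) where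
    open FiniteDigraph Y
    private
      module ΣE = FreeModule.FiniteSum S E-finite
      module AR = AdjacencyKernel R K Y α
      module AS = AdjacencyKernel S K Y α

    adjacency-homo : ∀ x y → φ (adjacency R K Y α x y) S.≈ adjacency S K Y α x y
    adjacency-homo x y = S.trans
      (∑-homo E-finite (λ ε → if does (to o ε V≟ x) then FreeModule.δ R V-finite (to t ε) y else R.0#))
      (ΣE.∑-cong {λ ε → φ (if does (to o ε V≟ x) then FreeModule.δ R V-finite (to t ε) y else R.0#)}
        {λ ε → if does (to o ε V≟ x) then FreeModule.δ S V-finite (to t ε) y else S.0#}
        λ ε → indicator-homo (to o ε V≟ x) (δ-homo V-finite (to t ε) y))
      where open Finite V-finite using () renaming (_≟_ to _V≟_)

    𝓘-u-kernel-homo : ∀ n x y → φ (Kernels.Kernel.value (AR.𝓘-u-kernel n) x y) S.≈ Kernels.Kernel.value (AS.𝓘-u-kernel n) x y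
    𝓘-u-kernel-homo 0 x y = δ-homo V-finite x y
    𝓘-u-kernel-homo 1 x y = S.trans (-‿homo _) (S.-‿cong (adjacency-homo x y))
    𝓘-u-kernel-homo (suc (suc n)) x y = 0#-homo

module BaseChange {f ℓ₁ ℓ₂ : Level} (F : HeytingField f ℓ₁ ℓ₂) where
  private
    module F = CommutativeRing (fieldRing F)
    module ℤ-hom = RingMorphisms.IsRingHomomorphism (fromℤ-hom F)

  baseChange-hom : ∀ {g ℓg} (K : FiniteAbelianGroup g ℓg) →
    Homomorphism (ℤ.+-*-commutativeRing [ K ][u]) (fieldRing F [ K ][u]) (baseChange F K)
  baseChange-hom K = record
    { isSemiringHomomorphism = record
      { isNearSemiringHomomorphism = record
        { +-isMonoidHomomorphism = record
          { isMagmaHomomorphism = record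
            { isRelHomomorphism = record { cong = λ p≈q n k → ℤ-hom.⟦⟧-cong (p≈q n k) }
            ; homo = λ p q n k → ℤ-hom.+-homo (to (coeff p n) k) (to (coeff q n) k) }
          ; ε-homo = λ n k → ℤ-hom.0#-homo }
        ; *-homo = λ p q n k → cauchyProduct-homo {R = ℤ.+-*-commutativeRing} {S = fieldRing F} (fromℤ-hom F) K
            {coeff p} {coeff (baseChange F K p)} {coeff q} {coeff (baseChange F K q)}
            (λ i l → F.refl) (λ i l → F.refl) n k }
      ; 1#-homo = λ { zero k → δ-homo {R = ℤ.+-*-commutativeRing} {S = fieldRing F} (fromℤ-hom F) (FiniteAbelianGroup.finite K) (FiniteAbelianGroup.ε K) k
                    ; (suc n) k → ℤ-hom.0#-homo } }
    ; -‿homo = λ p n k → ℤ-hom.-‿homo (to (coeff p n) k) }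

  module _ {g ℓg v ℓv e ℓe : Level} (K : FiniteAbelianGroup g ℓg) (Y : FiniteDigraph v ℓv e ℓe)
           (α : DigraphAction K Y) (free : Action.IsFree (DigraphAction.onV α)) where
    open FiniteDigraph Y using (V-finite)
    open DigraphAction α
    open Action onV using (_·_)
    private
      module FK[u] = CommutativeRing (fieldRing F [ K ][u])
      module D[u] = Determinants (fieldRing F [ K ][u])

    orbitCount : ℕ
    orbitCount = Finite.size (Action.orbits-finite onV V-finite)

    orbitReps : Transversal K onV orbitCount
    orbitReps = orbitTransversal K onV V-finite free

    HasKernel : D[u].Matrix orbitCount orbitCount → Set _
    HasKernel X = ∀ i j n k → to (coeff (X i j) n) k F.≈
      Kernels.Kernel.value (AdjacencyKernel.𝓘-u-kernel (fieldRing F) K Y α n)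
        (Transversal.rep orbitReps j) (k · Transversal.rep orbitReps i)

    private
      baseChange-det : (A : Determinants.Matrix (ℤ.+-*-commutativeRing [ K ][u]) orbitCount orbitCount) →
        HasKernel (λ i j → baseChange F K (A i j)) →
        ∃ λ X → (baseChange F K (Determinant.det (ℤ.+-*-commutativeRing [ K ][u]) A) FK[u].≈ D[u].det X) × HasKernel X
      baseChange-det A A-kernel = (λ i j → baseChange F K (A i j)) ,
        HomomorphismProperties.det-homo {R = ℤ.+-*-commutativeRing [ K ][u]} {S = fieldRing F [ K ][u]} (baseChange-hom K) A ,
        A-kernel

    -- The matrix is hidden behind an existential because the sequel needs only its kernel, not how
    -- `γ` builds it.
    baseChange-γ : ∃ λ X → (baseChange F K (γ Y α free) FK[u].≈ D[u].det X) × HasKernel X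
    baseChange-γ = baseChange-det _ λ i j n k → F.trans
      (F.reflexive (≡.cong (fromℤ F) (AdjacencyKernel.𝓘-u-coeff ℤ.+-*-commutativeRing K Y α
        (Transversal.rep orbitReps j) n (k · Transversal.rep orbitReps i))))
      (𝓘-u-kernel-homo {R = ℤ.+-*-commutativeRing} {S = fieldRing F} (fromℤ-hom F) K Y α n
        (Transversal.rep orbitReps j) (k · Transversal.rep orbitReps i))

-- The representatives gₖ xⱼ of the H-orbits

module _ {g ℓg p s ℓs : Level} {G : FiniteAbelianGroup g ℓg} (H : Subgroup G p) {S : Setoid s ℓs} {α : Action G S} where
  private
    module G = FiniteAbelianGroup G
    module S = Setoid S
  open Action α
  open Transversal

  -- Each point is l · aᵢ for exactly one i and l in G, and l in turn is h bₖ for exactly one k and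
  -- h in H.
  productTransversal : ∀ {n m} → Transversal G α n → Transversal (Subgroup.subgroup H) (translation G H) m →
                       Transversal (Subgroup.subgroup H) (restrict H α) (n ℕ.* m)
  productTransversal {n} {m} a b = record
    { rep      = λ p → let (i , k) = remQuot {n} m p in rep b k · rep a i
    ; cover    = λ x →
        let (i , l , l·aᵢ≈x) = cover a x ; (k , h , h∙bₖ≈l) = cover b l
        in combine i k , h , S.trans
             (·-cong G.refl (S.reflexive (≡.cong (λ (i , k) → rep b k · rep a i) (Fin.remQuot-combine i k))))
             (S.trans (S.sym (·-assoc _ _ _)) (S.trans (·-cong h∙bₖ≈l S.refl) l·aᵢ≈x))
    ; distinct = λ {p} {q} {h} {h′} eq →
        let (i≡j , hbₖ≈h′bₗ) = distinct a (S.trans (·-assoc _ _ _) (S.trans eq (S.sym (·-assoc _ _ _))))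
            (k≡l , h≈h′) = distinct b {k = h} {h′} hbₖ≈h′bₗ
        in ≡.trans (≡.sym (Fin.combine-remQuot {n} m p))
             (≡.trans (≡.cong₂ combine i≡j k≡l) (Fin.combine-remQuot {n} m q)) , h≈h′ }

-- The norm formula

module _ {g ℓg p v ℓv e ℓe f ℓ₁ ℓ₂ : Level} (G : FiniteAbelianGroup g ℓg) (H : Subgroup G p)
  (Y : FiniteDigraph v ℓv e ℓe) (α : DigraphAction G Y) (free : Action.IsFree (DigraphAction.onV α))
  (F : HeytingField f ℓ₁ ℓ₂) where
  private
    module F = CommutativeRing (fieldRing F)
    module G = FiniteAbelianGroup G
    module RK[u] = CommutativeRing (fieldRing F [ Subgroup.subgroup H ][u])
    module D[u] = Determinants (fieldRing F [ Subgroup.subgroup H ][u])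
    module DG[u] = Determinants (fieldRing F [ G ][u])
    module V = Setoid (FiniteDigraph.V Y)
    module KG = AdjacencyKernel (fieldRing F) G Y α
    module KK = AdjacencyKernel (fieldRing F) (Subgroup.subgroup H) Y (restrictAction H α)
    module KV = Kernels (fieldRing F) (Subgroup.subgroup H) (FiniteDigraph.V-finite Y) (restrict H (DigraphAction.onV α))
    module GV = Kernels (fieldRing F) G (FiniteDigraph.V-finite Y) (DigraphAction.onV α)
    module BC = BaseChange F
    free′ : Action.IsFree (restrict H (DigraphAction.onV α))
    free′ h = free (proj₁ h)
  open DigraphAction α
  open Action onV
  open Cosets (fieldRing F) G H
  open Transversal

  -- Adjacency and δ do not involve the acting group; the cases merely let the two families unfold.
  kernel-restrict : ∀ n x y → Kernels.Kernel.value (KG.𝓘-u-kernel n) x y F.≈ Kernels.Kernel.value (KK.𝓘-u-kernel n) x y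
  kernel-restrict 0             x y = F.refl
  kernel-restrict 1             x y = F.refl
  kernel-restrict (suc (suc n)) x y = F.refl

  private
    rep[u] = ρ[u] multiplicationRepresentation
    a = BC.orbitReps G Y α free
    z = productTransversal H a cosets
    y = BC.orbitReps (Subgroup.subgroup H) Y (restrictAction H α) free′

  -- (h bₖ bₗ⁻¹) aᵢ and aⱼ are translated by bₗ to h bₖ aᵢ and bₗ aⱼ.
  flatten-kernel : ∀ X → BC.HasKernel G Y α free X → ∀ p q n h →
    to (coeff (D[u].flatten (λ i j → rep[u] (X i j)) p q) n) h F.≈
    Kernels.Kernel.value (KK.𝓘-u-kernel n) (rep z q) (proj₁ h · rep z p)
  flatten-kernel X X-kernel p q n h = F.trans (X-kernel i j n _) (F.trans
    (F.sym (Kernels.Kernel.invariant (KG.𝓘-u-kernel n) bₗ (rep a j) ((proj₁ h G.∙ bₖ G.∙ bₗ G.⁻¹) · rep a i)))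
    (F.trans (Kernels.Kernel.cong (KG.𝓘-u-kernel n) V.refl moved) (kernel-restrict n _ _)))
    where
    i = proj₁ (remQuot {BC.orbitCount G Y α free} _ p)
    j = proj₁ (remQuot {BC.orbitCount G Y α free} _ q)
    bₖ = rep cosets (proj₂ (remQuot {BC.orbitCount G Y α free} _ p))
    bₗ = rep cosets (proj₂ (remQuot {BC.orbitCount G Y α free} _ q))
    moved : bₗ · (proj₁ h G.∙ bₖ G.∙ bₗ G.⁻¹) · rep a i V.≈ proj₁ h · bₖ · rep a i
    moved = V.trans (V.sym (·-assoc _ _ _)) (V.trans
      (·-cong (G.trans (G.comm _ _) (G.trans (G.assoc _ _ _) (G.trans (G.∙-congˡ (G.inverseˡ bₗ)) (G.identityʳ _)))) V.refl)
      (·-assoc _ _ _))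

  norm-γ : RK[u]._≈_ (N (fieldRing F) G H (baseChange F G (γ Y α free))) (baseChange F (Subgroup.subgroup H) (γ Y (restrictAction H α) free′))
  norm-γ =
    let (X , γ≈detX , X-kernel) = BC.baseChange-γ G Y α free
        (X′ , γ≈detX′ , X′-kernel) = BC.baseChange-γ (Subgroup.subgroup H) Y (restrictAction H α) free′
        P = baseChange F G (γ Y α free)
        P′ = baseChange F (Subgroup.subgroup H) (γ Y (restrictAction H α) free′)
        M = D[u].flatten (λ i j → rep[u] (X i j))
    in RK[u].trans {N (fieldRing F) G H P} {D[u].det (rep[u] P)} {P′} (N≈det P)
      (RK[u].trans {D[u].det (rep[u] P)} {D[u].det (rep[u] (DG[u].det X))} {P′}
        (D[u].det-cong (MatrixRepresentation.ρ-cong (polynomialRepresentation multiplicationRepresentation) {P} {DG[u].det X} γ≈detX))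
      (RK[u].trans {D[u].det (rep[u] (DG[u].det X))} {D[u].det M} {P′}
        (RK[u].sym {D[u].det M} {D[u].det (rep[u] (DG[u].det X))} (det-flatten[u] multiplicationRepresentation _ X
          -- In degree 0 the kernel of I - 𝓐u is δ, whose matrix is the identity.
          (λ i j k → F.trans (X-kernel i j 0 k) (GV.matrix-δ a i j k))))
      (RK[u].trans {D[u].det M} {D[u].det X′} {P′}
        -- Both matrices have the same kernels, read at the representatives gₖ xⱼ and at those
        -- chosen in the definition of `γ` for H.
        (KV.det-transversals z y KK.𝓘-u-kernel M X′ (flatten-kernel X X-kernel) X′-kernel)
        (RK[u].sym {P′} {D[u].det X′} γ≈detX′))))

theorem3p5 : {g ℓg p v ℓv e ℓe f ℓ₁ ℓ₂ : Level} →
    (G : FiniteAbelianGroup g ℓg) (H : Subgroup G p) →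
    (Y : FiniteDigraph v ℓv e ℓe) → FiniteDigraph.StronglyConnected Y →
    (α : DigraphAction G Y) (free : Action.IsFree (DigraphAction.onV α)) →
    (F : HeytingField f ℓ₁ ℓ₂) → AlgebraicallyClosed F → CharacteristicZero F →
    CommutativeRing._≈_ (fieldRing F [ Subgroup.subgroup H ][u])
    (N (fieldRing F) G H (baseChange F G (γ Y α free)))
    (baseChange F (Subgroup.subgroup H) (γ Y (restrictAction H α) (λ h → free (proj₁ h))))
theorem3p5 G H Y _ α free F _ _ = norm-γ G H Y α free F
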